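{- Let $G$ be an $\mathcal{M}_{2,2}^*$-circuit which is distinct from $K_5-e$, $H_1$ and $H_2$, and suppose that $G$ has no nontrivial $2$-vertex-separation and no nontrivial $3$-edge-separation. Then $G$ has at least two admissible nodes.
   Context: All graphs are finite and simple. A graph $G=(V,E)$ is an $\mathcal{M}_{2,2}^*$-circuit if $|E|=2|V|-1$ and every nonempty proper subset $F\subsetneq E$ satisfies $|F|\le 2|V(F)|-2$, where $V(F)$ is the set of vertices incident with $F$. $K_5-e$ is $K_5$ minus one edge. $H_1$ is two copies of $K_4$ sharing exactly one edge (6 vertices, 11 edges). $H_2$ is the graph on vertices $v_1,\dots,v_7$ in which $\{v_1,v_2,v_3,v_4\}$ and $\{v_4,v_5,v_6,v_7\}$ each induce a $K_4$, plus the single extra edge $v_1v_7$ (7 vertices, 13 edges). A $2$-vertex-separation of $G$ is a pair of induced subgraphs $F_1=(V_1,E_1)$, $F_2=(V_2,E_2)$ with $F_1\cup F_2=G$, $|V_1\cap V_2|=2$ and $V_1\setminus V_2\ne\emptyset\ne V_2\setminus V_1$; it is nontrivial if neither $F_1$ nor $F_2$ is isomorphic to $K_4$. A $3$-edge-separation is a pair of nonempty vertex-disjoint induced subgraphs $(F_1,F_2)$ with $F_1\cup F_2=G-S$ for some edge set $S$ with $|S|=3$; it is nontrivial if the three edges of $S$ are pairwise non-adjacent (share no endpoints). A node is a vertex of degree $3$. A $1$-reduction at a node $v$ with neighbours $x,y,z$ deletes $v$ and adds an edge between two of $x,y,z$ that are not already adjacent (the inverse of a $1$-extension). A node $v$ of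 an $\mathcal{M}_{2,2}^*$-circuit $G$ is admissible if some $1$-reduction at $v$ produces an $\mathcal{M}_{2,2}^*$-circuit. -}

module Defs where

open import Data.Nat using (ℕ; zero; suc; _+_; _*_; _≤_; _<_)
open import Data.Bool using (Bool; true; false; _∧_; _∨_; not; if_then_else_)
open import Data.Fin using (Fin; zero; suc; toℕ; punchIn) renaming (_<?_ to _<ᶠ?_; _≟_ to _≟ᶠ_)
open import Data.Nat using (_≤ᵇ_; _≡ᵇ_)
open import Data.Product using (Σ; ∃; ∃-syntax; _×_; _,_)
open import Data.Sum using (_⊎_)
open import Relation.Nullary using (¬_)
open import Relation.Nullary.Decidable using (⌊_⌋)
open import Relation.Binary.PropositionalEquality using (_≡_; _≢_)
open import Function.Bundles using (_↔_; Inverse)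

record Graph (n : ℕ) : Set where
  constructor mkGraph
  field adj : Fin n → Fin n → Bool
open Graph public

IsSimple : ∀ {n} → Graph n → Set
IsSimple {n} G = (∀ (i j : Fin n) → adj G i j ≡ adj G j i) × (∀ (i : Fin n) → adj G i i ≡ false)

countB : ∀ {n} → (Fin n → Bool) → ℕ
countB {zero}  P = 0
countB {suc n} P = (if P zero then 1 else 0) + countB (λ i → P (suc i))

sumF : ∀ {n} → (Fin n → ℕ) → ℕ
sumF {zero}  f = 0
sumF {suc n} f = f zero + sumF (λ i → f (suc i))

anyB : ∀ {n} → (Fin n → Bool) → Bool
anyB {zero}  P = false
anyB {suc n} P = P zero ∨ anyB (λ i → P (suc i))

eqᵇ : ∀ {n} → Fin n → Fin n → Bool
eqᵇ i j = ⌊ i ≟ᶠ j ⌋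

ltᵇ : ∀ {n} → Fin n → Fin n → Bool
ltᵇ i j = ⌊ i <ᶠ? j ⌋

-- An edge set (symmetric Boolean relation); number of unordered edges {i,j}, i<j.
EdgeSet : ℕ → Set
EdgeSet n = Fin n → Fin n → Bool

edgeCount : ∀ {n} → EdgeSet n → ℕ
edgeCount F = sumF (λ i → countB (λ j → ltᵇ i j ∧ F i j))

incident : ∀ {n} → EdgeSet n → Fin n → Bool
incident F v = anyB (λ u → F v u)

IsEdgeSubset : ∀ {n} → Graph n → EdgeSet n → Set
IsEdgeSubset {n} G F =
  (∀ (i j : Fin n) → F i j ≡ F j i) × (∀ (i j : Fin n) → F i j ≡ true → adj G i j ≡ true)

IsCircuit : ∀ {n} → Graph n → Set
IsCircuit {n} G =
  IsSimple G
  × (edgeCount (adj G) + 1 ≡ 2 * n)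
  × (∀ (F : EdgeSet n) → IsEdgeSubset G F →
       1 ≤ edgeCount F → edgeCount F < edgeCount (adj G) →
       edgeCount F + 2 ≤ 2 * countB (incident F))

_≅_ : ∀ {n m} → Graph n → Graph m → Set
_≅_ {n} {m} G H = Σ (Fin n ↔ Fin m) λ f →
  ∀ (i j : Fin n) → adj G i j ≡ adj H (Inverse.to f i) (Inverse.to f j)

isPair : ∀ {n} → ℕ → ℕ → Fin n → Fin n → Bool
isPair a b i j = ((toℕ i ≡ᵇ a) ∧ (toℕ j ≡ᵇ b)) ∨ ((toℕ i ≡ᵇ b) ∧ (toℕ j ≡ᵇ a))

K5-e : Graph 5
K5-e = mkGraph λ i j →
  not (eqᵇ i j) ∧ not (isPair 0 1 i j)

-- H1 on {0,..,5}: K4 on {0,1,2,3} and K4 on {2,3,4,5} sharing edge 23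
H1 : Graph 6
H1 = mkGraph λ i j →
  not (eqᵇ i j) ∧ (((toℕ i ≤ᵇ 3) ∧ (toℕ j ≤ᵇ 3)) ∨ ((2 ≤ᵇ toℕ i) ∧ (2 ≤ᵇ toℕ j)))

-- H2 on {0,..,6} (v_k ↦ k-1): K4 on {0,1,2,3}, K4 on {3,4,5,6}, plus edge 06
H2 : Graph 7
H2 = mkGraph λ i j →
  not (eqᵇ i j) ∧ (((toℕ i ≤ᵇ 3) ∧ (toℕ j ≤ᵇ 3)) ∨ ((3 ≤ᵇ toℕ i) ∧ (3 ≤ᵇ toℕ j))
                    ∨ isPair 0 6 i j)

-- Separations.  Vertex subsets are Boolean predicates on Fin n; an induced
-- subgraph is determined by its vertex set.

VSet : ℕ → Set
VSet n = Fin n → Bool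

InducesK4 : ∀ {n} → Graph n → VSet n → Set
InducesK4 {n} G V =
  (countB V ≡ 4) × (∀ (i j : Fin n) → V i ≡ true → V j ≡ true → i ≢ j → adj G i j ≡ true)

Is2VertexSep : ∀ {n} → Graph n → VSet n → VSet n → Set
Is2VertexSep {n} G V1 V2 =
  (∀ (v : Fin n) → V1 v ∨ V2 v ≡ true)
  × (∀ (i j : Fin n) → adj G i j ≡ true → (V1 i ∧ V1 j ≡ true) ⊎ (V2 i ∧ V2 j ≡ true))
  × (countB (λ v → V1 v ∧ V2 v) ≡ 2)
  × (∃[ v ] (V1 v ∧ not (V2 v) ≡ true))
  × (∃[ v ] (V2 v ∧ not (V1 v) ≡ true))

HasNontrivial2VertexSep : ∀ {n} → Graph n → Set
HasNontrivial2VertexSep {n} G = Σ (VSet n) λ V1 → Σ (VSet n) λ V2 →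
  Is2VertexSep G V1 V2 × ¬ InducesK4 G V1 × ¬ InducesK4 G V2

Is3EdgeSep : ∀ {n} → Graph n → VSet n → VSet n → EdgeSet n → Set
Is3EdgeSep {n} G V1 V2 S =
  (∃[ v ] V1 v ≡ true) × (∃[ v ] V2 v ≡ true)
  × (∀ (v : Fin n) → V1 v ∧ V2 v ≡ false)
  × (∀ (v : Fin n) → V1 v ∨ V2 v ≡ true)
  × IsEdgeSubset G S
  × (edgeCount S ≡ 3)
  × (∀ (i j : Fin n) → adj G i j ≡ true →
       (S i j ≡ false → (V1 i ∧ V1 j ≡ true) ⊎ (V2 i ∧ V2 j ≡ true))
       × ((V1 i ∧ V1 j ≡ true) ⊎ (V2 i ∧ V2 j ≡ true) → S i j ≡ false))

PairwiseNonAdjacent : ∀ {n} → EdgeSet n → Set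
PairwiseNonAdjacent {n} S = ∀ (i j k : Fin n) → S i j ≡ true → S i k ≡ true → j ≡ k

HasNontrivial3EdgeSep : ∀ {n} → Graph n → Set
HasNontrivial3EdgeSep {n} G = Σ (VSet n) λ V1 → Σ (VSet n) λ V2 → Σ (EdgeSet n) λ S →
  Is3EdgeSep G V1 V2 S × PairwiseNonAdjacent S

degree : ∀ {n} → Graph n → Fin n → ℕ
degree G v = countB (adj G v)

IsNode : ∀ {n} → Graph n → Fin n → Set
IsNode G v = degree G v ≡ 3

-- delete v (vertices of the result are Fin m, embedded via punchIn v)
-- and add the edge xy, where x = punchIn v x', y = punchIn v y'
oneReduction : ∀ {m} → Graph (suc m) → Fin (suc m) → Fin m → Fin m → Graph m
oneReduction G v x' y' = mkGraph λ i j →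
  adj G (punchIn v i) (punchIn v j)
  ∨ ((eqᵇ i x' ∧ eqᵇ j y') ∨ (eqᵇ i y' ∧ eqᵇ j x'))

IsAdmissible : ∀ {m} → Graph (suc m) → Fin (suc m) → Set
IsAdmissible {m} G v =
  IsNode G v ×
  (Σ (Fin m) λ x' → Σ (Fin m) λ y' →
     (x' ≢ y')
     × (adj G v (punchIn v x') ≡ true)
     × (adj G v (punchIn v y') ≡ true)
     × (adj G (punchIn v x') (punchIn v y') ≡ false)
     × IsCircuit (oneReduction G v x' y'))

{-# OPTIONS --safe #-}

-- Call X tight if it induces 2|X| − 2 edges.  Tight sets that meet without covering V
-- have tight union and intersection, with no edge joining X ∖ Y to Y ∖ X.  In the
-- absence of nontrivial separations, a tight X with |X|, |V ∖ X| ≥ 2 has at least four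
-- leaving edges.  A node v that is not admissible either lies in a K₄ or is
-- "branching": each neighbour r of v is avoided by a tight set that contains the other
-- two neighbours but not v.
--
-- Nodes induce a forest.  So if each branching node (outside some tight X) has two
-- neighbours that are nodes (outside X), two of these neighbours are not branching;
-- being adjacent to branching nodes, they lie in no K₄ and are admissible.  If there is
-- no branching node outside X and X crosses no K₄ around a node, partition V ∖ X into
-- maximal tight clusters: as Σ deg = 4n − 2 and a cluster with at least two vertices
-- has degree sum at least four times its size, at least two nodes outside X lie in no
-- K₄.
--
-- If some branching node v has a neighbour a that is not a node, take X maximal among
-- the tight sets avoiding a and containing v and a tight set Z for (v, a); should both
-- arguments fail, Z can be enlarged.  If there is no branching node, let X be maximal
-- among the tight sets containing a K₄ and missing at least three vertices.
module Submission where

-- Tight sets are what stands in the way of a 1-reduction. Joining neighbours `x`, `y` of a node `v`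
-- in `G − v` breaks sparsity exactly at the tight sets that contain `x` and `y`, avoid `v` and are
-- not all of `V − v`. Such a set cannot contain the third neighbour `r`, as `v` would bring three
-- edges to a set with room for two; so the obstruction belongs to `r`.
--
-- Enlarging `Z`: if a branching node `u` outside `X` lacks two neighbours that are nodes outside
-- `X`, then, since maximality of `X` forbids two neighbours in `X`, some neighbour `r` outside `X`
-- is not a node, and it can be chosen so that its obstruction meets `X`. The union of that
-- obstruction with `X` is again one for `(u , r)`, and it is larger than `Z` because `X` also
-- contains `v`.
--
-- Three missing vertices force a K₄ around a node that crosses `X` to meet it in one vertex. If
-- only one or two vertices lie outside a K₄ around a node, `K5-e` and `H1` show up; `H2` shows up
-- when `X` is itself a K₄ and a crossing K₄ covers the rest.

open import Defs
open import Data.Bool using (Bool; true; false; _∧_; _∨_; not; if_then_else_; T)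
open import Data.Bool.Properties using (∨-zeroʳ) renaming (_≟_ to _≟ᵇ_)
open import Data.Empty using (⊥; ⊥-elim)
open import Data.Fin using (Fin; zero; suc; toℕ; punchIn; punchOut) renaming (_≟_ to _≟ᶠ_; _<?_ to _<ᶠ?_)
import Data.Fin.Properties as Fin
open import Data.Fin.Subset.Properties using (anySubset?)
open import Data.Integer using (ℤ; -[1+_]; _⊖_) renaming (+_ to ⁺_; _+_ to _+ℤ_; _*_ to _*ℤ_; -_ to -ℤ_)
open import Data.List using (List; []; _∷_; _++_; map; concatMap; foldr)
open import Data.Maybe using (Maybe; just; nothing)
open import Data.Nat using (ℕ; zero; suc; _+_; _*_; _∸_; _≤_; _<_; z≤n; s≤s; _≤ᵇ_; _≡ᵇ_; _≤?_) renaming (_≟_ to _≟ⁿ_)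
open import Data.Nat.Properties
open import Data.Nat.Induction using (<-wellFounded)
open import Data.Product using (Σ; ∃; ∃₂; _×_; _,_; proj₁; proj₂)
open import Data.Sum using (_⊎_; inj₁; inj₂)
open import Data.Unit using (⊤; tt)
open import Data.Vec using (Vec; []; _∷_; lookup; tabulate)
open import Data.Vec.Properties using (lookup∘tabulate)
open import Data.Vec.N-ary using (N-ary; _$ⁿ_)
open import Function using (_∘_; id; case_of_)
open import Function.Bundles using (mk↔ₛ′)
open import Induction.WellFounded using (Acc; acc)
open import Relation.Nullary using (¬_; Dec; yes; no)
open import Relation.Nullary.Decidable using (toWitness; map′; _×-dec_; _→-dec_; ¬?; does; dec-true)
open import Relation.Binary.PropositionalEquality using (_≡_; _≢_; refl; sym; trans; cong; cong₂; subst; module ≡-Reasoning)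

-- Linear arithmetic over ℕ: a certificate (Farkas multipliers) is searched by
-- Fourier–Motzkin elimination, and only its verification is proved correct.

infixl 6 _⊕_
infixl 7 _⊛_
infix  5.5 _≼_ _≈_
infix  3 _⊢_

data Lin (k : ℕ) : Set where
  var : Fin k → Lin k
  con : ℕ → Lin k
  _⊕_ : Lin k → Lin k → Lin k
  _⊛_ : ℕ → Lin k → Lin k

data Rel (k : ℕ) : Set where
  _≼_ _≈_ : Lin k → Lin k → Rel k

record Problem (k : ℕ) : Set where
  constructor _⊢_
  field
    hypotheses : List (Rel k)
    goal       : Rel k

⟦_⟧ : ∀ {k} → Lin k → Vec ℕ k → ℕ
⟦ var i ⟧ ρ = lookup ρ i
⟦ con c ⟧ ρ = c
⟦ s ⊕ t ⟧ ρ = ⟦ s ⟧ ρ + ⟦ t ⟧ ρ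
⟦ c ⊛ t ⟧ ρ = c * ⟦ t ⟧ ρ

⟦_⟧ʳ : ∀ {k} → Rel k → Vec ℕ k → Set
⟦ s ≼ t ⟧ʳ ρ = ⟦ s ⟧ ρ ≤ ⟦ t ⟧ ρ
⟦ s ≈ t ⟧ʳ ρ = ⟦ s ⟧ ρ ≡ ⟦ t ⟧ ρ

Implies : ∀ {k} → List (Rel k) → Rel k → Vec ℕ k → Set
Implies []       g ρ = ⟦ g ⟧ʳ ρ
Implies (h ∷ hs) g ρ = ⟦ h ⟧ʳ ρ → Implies hs g ρ

private
  -- The first entry is the constant term, so a form is evaluated by `dot` with `1 ∷ ρ`.
  Form : ℕ → Set
  Form k = Vec ℕ (suc k)

  dot : ∀ {k} → Vec ℕ k → Vec ℕ k → ℕ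
  dot []       []       = 0
  dot (a ∷ as) (x ∷ xs) = a * x + dot as xs

  zeros : ∀ {k} → Vec ℕ k
  zeros {zero}  = []
  zeros {suc k} = 0 ∷ zeros

  unit : ∀ {k} → Fin k → Vec ℕ k
  unit zero    = 1 ∷ zeros
  unit (suc i) = 0 ∷ unit i

  _+ᵛ_ : ∀ {k} → Vec ℕ k → Vec ℕ k → Vec ℕ k
  []       +ᵛ []       = []
  (a ∷ as) +ᵛ (b ∷ bs) = (a + b) ∷ (as +ᵛ bs)

  _*ᵛ_ : ∀ {k} → ℕ → Vec ℕ k → Vec ℕ k
  c *ᵛ []       = []
  c *ᵛ (a ∷ as) = (c * a) ∷ (c *ᵛ as)

  _≤ᵛ_ : ∀ {k} → Vec ℕ k → Vec ℕ k → Bool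
  []       ≤ᵛ []       = true
  (a ∷ as) ≤ᵛ (b ∷ bs) = (a ≤ᵇ b) ∧ (as ≤ᵛ bs)

  form : ∀ {k} → Lin k → Form k
  form (var i) = 0 ∷ unit i
  form (con c) = c ∷ zeros
  form (s ⊕ t) = form s +ᵛ form t
  form (c ⊛ t) = c *ᵛ form t

  dot-zeros : ∀ {k} (xs : Vec ℕ k) → dot zeros xs ≡ 0
  dot-zeros []       = refl
  dot-zeros (x ∷ xs) = dot-zeros xs

  dot-unit : ∀ {k} (i : Fin k) xs → dot (unit i) xs ≡ lookup xs i
  dot-unit zero    (x ∷ xs) = trans (cong₂ _+_ (+-identityʳ x) (dot-zeros xs)) (+-identityʳ x)
  dot-unit (suc i) (x ∷ xs) = dot-unit i xs

  interchange : ∀ a b c d → (a + b) + (c + d) ≡ (a + c) + (b + d)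
  interchange a b c d = trans (+-assoc a b (c + d))
    (trans (cong (a +_) (trans (sym (+-assoc b c d)) (trans (cong (_+ d) (+-comm b c)) (+-assoc c b d))))
           (sym (+-assoc a c (b + d))))

  dot-+ : ∀ {k} (as bs xs : Vec ℕ k) → dot (as +ᵛ bs) xs ≡ dot as xs + dot bs xs
  dot-+ []       []       []       = refl
  dot-+ (a ∷ as) (b ∷ bs) (x ∷ xs) =
    trans (cong₂ _+_ (*-distribʳ-+ x a b) (dot-+ as bs xs))
          (interchange (a * x) (b * x) (dot as xs) (dot bs xs))

  dot-* : ∀ {k} c (as xs : Vec ℕ k) → dot (c *ᵛ as) xs ≡ c * dot as xs
  dot-* c []       []       = sym (*-zeroʳ c)
  dot-* c (a ∷ as) (x ∷ xs) =
    trans (cong₂ _+_ (*-assoc c a x) (dot-* c as xs)) (sym (*-distribˡ-+ c (a * x) (dot as xs)))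

  T-∧ : ∀ {a b} → T (a ∧ b) → T a × T b
  T-∧ {true} t = tt , t

  dot-≤ : ∀ {k} (as bs xs : Vec ℕ k) → T (as ≤ᵛ bs) → dot as xs ≤ dot bs xs
  dot-≤ []       []       []       _ = z≤n
  dot-≤ (a ∷ as) (b ∷ bs) (x ∷ xs) t =
    +-mono-≤ (*-monoˡ-≤ x (≤ᵇ⇒≤ a b (proj₁ (T-∧ t)))) (dot-≤ as bs xs (proj₂ (T-∧ t)))

  form-sound : ∀ {k} (t : Lin k) ρ → dot (form t) (1 ∷ ρ) ≡ ⟦ t ⟧ ρ
  form-sound (var i) ρ = dot-unit i ρ
  form-sound (con c) ρ = trans (cong₂ _+_ (*-identityʳ c) (dot-zeros ρ)) (+-identityʳ c)
  form-sound (s ⊕ t) ρ = trans (dot-+ (form s) (form t) _) (cong₂ _+_ (form-sound s ρ) (form-sound t ρ))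
  form-sound (c ⊛ t) ρ = trans (dot-* c (form t) _) (cong (c *_) (form-sound t ρ))

  -- An equation can be used in either direction, so its multiplier may have any sign; an inequality
  -- with a negative multiplier contributes nothing.
  weighted : ∀ {k} → List (Rel k) → List ℤ → Form k × Form k
  weighted (_ ≼ _ ∷ hs) (-[1+ _ ] ∷ ms) = weighted hs ms
  weighted (s ≼ t ∷ hs) (⁺ m ∷ ms)      = let (l , r) = weighted hs ms in
    (m *ᵛ form s) +ᵛ l , (m *ᵛ form t) +ᵛ r
  weighted (s ≈ t ∷ hs) (⁺ m ∷ ms)      = let (l , r) = weighted hs ms in
    (m *ᵛ form s) +ᵛ l , (m *ᵛ form t) +ᵛ r
  weighted (s ≈ t ∷ hs) (-[1+ m ] ∷ ms) = let (l , r) = weighted hs ms in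
    (suc m *ᵛ form t) +ᵛ l , (suc m *ᵛ form s) +ᵛ r
  weighted _            _               = zeros , zeros

  -- The goal enters with multiplier `c + 1`. As the hypotheses give `l ≤ r`, the comparison yields
  -- `(c + 1) s ≤ (c + 1) t + c`, which rounds to `s ≤ t` over the integers. Comparing coefficients
  -- is sound because the variables are natural numbers.
  certifies : ∀ {k} → List (Rel k) → Lin k → Lin k → ℕ × List ℤ → Bool
  certifies hs s t (c , ms) = let (l , r) = weighted hs ms in
    ((suc c *ᵛ form s) +ᵛ r) ≤ᵛ ((suc c *ᵛ form t) +ᵛ ((c ∷ zeros) +ᵛ l))

  AllHold : ∀ {k} → List (Rel k) → Vec ℕ k → Set
  AllHold []       ρ = ⊤
  AllHold (h ∷ hs) ρ = ⟦ h ⟧ʳ ρ × AllHold hs ρ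

  scale-≤ : ∀ {k} m (s t : Lin k) (l r : Form k) ρ → ⟦ s ⟧ ρ ≤ ⟦ t ⟧ ρ → dot l (1 ∷ ρ) ≤ dot r (1 ∷ ρ) →
            dot ((m *ᵛ form s) +ᵛ l) (1 ∷ ρ) ≤ dot ((m *ᵛ form t) +ᵛ r) (1 ∷ ρ)
  scale-≤ m s t l r ρ p q
    rewrite dot-+ (m *ᵛ form s) l (1 ∷ ρ) | dot-+ (m *ᵛ form t) r (1 ∷ ρ)
          | dot-* m (form s) (1 ∷ ρ) | dot-* m (form t) (1 ∷ ρ)
          | form-sound s ρ | form-sound t ρ = +-mono-≤ (*-monoʳ-≤ m p) q

  weighted-sound : ∀ {k} (hs : List (Rel k)) ms ρ → AllHold hs ρ →
                   dot (proj₁ (weighted hs ms)) (1 ∷ ρ) ≤ dot (proj₂ (weighted hs ms)) (1 ∷ ρ)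
  weighted-sound []           _               ρ _       = ≤-refl
  weighted-sound (_ ≼ _ ∷ _)  []              ρ _       = ≤-refl
  weighted-sound (_ ≈ _ ∷ _)  []              ρ _       = ≤-refl
  weighted-sound (_ ≼ _ ∷ hs) (-[1+ _ ] ∷ ms) ρ (_ , a) = weighted-sound hs ms ρ a
  weighted-sound (s ≼ t ∷ hs) (⁺ m ∷ ms)      ρ (h , a) = scale-≤ m s t _ _ ρ h (weighted-sound hs ms ρ a)
  weighted-sound (s ≈ t ∷ hs) (⁺ m ∷ ms)      ρ (h , a) =
    scale-≤ m s t _ _ ρ (≤-reflexive h) (weighted-sound hs ms ρ a)
  weighted-sound (s ≈ t ∷ hs) (-[1+ m ] ∷ ms) ρ (h , a) =
    scale-≤ (suc m) t s _ _ ρ (≤-reflexive (sym h)) (weighted-sound hs ms ρ a)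

  cancel : ∀ c s t l r → suc c * s + r ≤ suc c * t + (c + l) → l ≤ r → s ≤ t
  cancel c s t l r p q = ≮⇒≥ λ t<s → <-irrefl refl (begin-strict
    suc c * t + (c + r)     <⟨ n<1+n _ ⟩
    suc (suc c * t + (c + r)) ≡⟨ sym (+-suc (suc c * t) (c + r)) ⟩
    suc c * t + (suc c + r) ≡⟨ sym (+-assoc (suc c * t) (suc c) r) ⟩
    suc c * t + suc c + r   ≡⟨ cong (_+ r) (+-comm (suc c * t) (suc c)) ⟩
    suc c + suc c * t + r   ≡⟨ cong (_+ r) (sym (*-suc (suc c) t)) ⟩
    suc c * suc t + r       ≤⟨ +-monoˡ-≤ r (*-monoʳ-≤ (suc c) t<s) ⟩
    suc c * s + r           ≤⟨ p ⟩
    suc c * t + (c + l)     ≤⟨ +-monoʳ-≤ (suc c * t) (+-monoʳ-≤ c q) ⟩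
    suc c * t + (c + r)     ∎)
    where open ≤-Reasoning

  certifies-sound : ∀ {k} (hs : List (Rel k)) s t cert → T (certifies hs s t cert) →
                    ∀ ρ → AllHold hs ρ → ⟦ s ⟧ ρ ≤ ⟦ t ⟧ ρ
  certifies-sound hs s t (c , ms) ok ρ a =
    cancel c _ _ (dot l (1 ∷ ρ)) (dot r (1 ∷ ρ)) (begin
      suc c * ⟦ s ⟧ ρ + dot r (1 ∷ ρ)              ≡⟨ sym lhs ⟩
      dot ((suc c *ᵛ form s) +ᵛ r) (1 ∷ ρ)         ≤⟨ dot-≤ ((suc c *ᵛ form s) +ᵛ r) ((suc c *ᵛ form t) +ᵛ ((c ∷ zeros) +ᵛ l)) (1 ∷ ρ) ok ⟩
      dot ((suc c *ᵛ form t) +ᵛ ((c ∷ zeros) +ᵛ l)) (1 ∷ ρ) ≡⟨ rhs ⟩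
      suc c * ⟦ t ⟧ ρ + (c + dot l (1 ∷ ρ))        ∎)
      (weighted-sound hs ms ρ a)
    where
    open ≤-Reasoning
    l = proj₁ (weighted hs ms)
    r = proj₂ (weighted hs ms)
    scaled : ∀ u → dot (suc c *ᵛ form u) (1 ∷ ρ) ≡ suc c * ⟦ u ⟧ ρ
    scaled u = trans (dot-* (suc c) (form u) (1 ∷ ρ)) (cong (suc c *_) (form-sound u ρ))
    lhs = trans (dot-+ (suc c *ᵛ form s) r (1 ∷ ρ)) (cong (_+ dot r (1 ∷ ρ)) (scaled s))
    rhs = trans (dot-+ (suc c *ᵛ form t) _ (1 ∷ ρ))
      (cong₂ _+_ (scaled t)
        (trans (dot-+ (c ∷ zeros) l (1 ∷ ρ)) (cong (_+ dot l (1 ∷ ρ)) (form-sound (con c) ρ))))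

  -- A row ℓ, c, p of the elimination is Σ ℓᵢ xᵢ + c ≤ 0 (or = 0), where p records
  -- the combination of the hypotheses and the negated goal that it comes from.
  record Row : Set where
    constructor row
    field
      isEq   : Bool
      coeffs : List ℤ
      origin : List ℤ

  combine : ℤ → List ℤ → ℤ → List ℤ → List ℤ
  combine a (x ∷ xs) b (y ∷ ys) = (a *ℤ x +ℤ b *ℤ y) ∷ combine a xs b ys
  combine _ _        _ _        = []

  data Head : Set where
    head⁺ head⁻ : ℕ → Head
    head⁰     : Head

  head : Row → Head
  head (row _ (⁺ zero ∷ _) _)  = head⁰
  head (row _ (⁺ suc m ∷ _) _) = head⁺ (suc m)
  head (row _ (-[1+ m ] ∷ _) _) = head⁻ (suc m)
  head (row _ [] _)            = head⁰

  behead : Row → Row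
  behead (row e (_ ∷ cs) o) = row e cs o
  behead r                  = r

  infix 5 _·_⊹_·_

  _·_⊹_·_ : ℤ → Row → ℤ → Row → Row
  a · row e cs o ⊹ b · row e′ cs′ o′ =
    behead (row (e ∧ e′) (combine a cs b cs′) (combine a o b o′))

  pivot : List Row → Maybe (Row × List Row)
  pivot [] = nothing
  pivot (r ∷ rs) with Row.isEq r | head r
  ... | true | head⁺ _ = just (r , rs)
  ... | true | head⁻ _ = just (r , rs)
  ... | _    | _ with pivot rs
  ...   | just (p , rs′) = just (p , r ∷ rs′)
  ...   | nothing        = nothing

  reduceBy : Row → Row → Row
  reduceBy p r with head p | head r
  ... | head⁺ a | head⁺ b = (⁺ a) · r ⊹ (-ℤ (⁺ b)) · p
  ... | head⁺ a | head⁻ b = (⁺ a) · r ⊹ (⁺ b) · p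
  ... | head⁻ a | head⁺ b = (⁺ a) · r ⊹ (⁺ b) · p
  ... | head⁻ a | head⁻ b = (⁺ a) · r ⊹ (-ℤ (⁺ b)) · p
  ... | _     | _     = behead r

  pairings : List Row → Row → List Row
  pairings rs r with head r
  -- `behead r` is the combination of `r` with the implicit bound that the variable is at least 0.
  ... | head⁺ a = behead r ∷ concatMap against rs
    where
    against : Row → List Row
    against q with head q
    ... | head⁻ b = ((⁺ b) · r ⊹ (⁺ a) · q) ∷ []
    ... | _     = []
  ... | head⁻ _ = []
  ... | head⁰   = behead r ∷ []

  -- When an equation eliminates a variable, the bound that this variable is at least 0 must survive
  -- as a row. Its origin is zero since the coefficientwise check grants it for free; the argument
  -- only supplies the lengths.
  nonNegative : Row → Row
  nonNegative (row _ cs o) = row false (minusFirst cs) (map (λ _ → ⁺ 0) o)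
    where
    minusFirst : List ℤ → List ℤ
    minusFirst []       = []
    minusFirst (_ ∷ cs) = -[1+ 0 ] ∷ map (λ _ → ⁺ 0) cs

  eliminate : ℕ → List Row → List Row
  eliminate zero    rs = rs
  eliminate (suc k) rs with pivot rs
  ... | just (p , rs′) = eliminate k (map (reduceBy p) (nonNegative p ∷ rs′))
  ... | nothing        = eliminate k (concatMap (pairings rs) rs)

  refutation : List Row → ℕ × List ℤ
  refutation [] = 0 , []
  -- A positive constant refutes the row. The negated goal was used `g` times, so `g` is `c + 1`; it
  -- can be 0 when the hypotheses are contradictory, as for the goal `con 1 ≼ con 0`, and then
  -- `c = 0` serves.
  refutation (row _    (⁺ suc _ ∷ []) (⁺ g ∷ ms) ∷ _)      = g ∸ 1 , ms
  refutation (row true (-[1+ _ ] ∷ []) (⁺ zero ∷ ms) ∷ _) = 0 , map -ℤ_ ms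
  refutation (_ ∷ rs) = refutation rs

  toℤs : ∀ {k} → Vec ℕ k → Vec ℕ k → List ℤ
  toℤs []       []       = []
  toℤs (a ∷ as) (b ∷ bs) = (a ⊖ b) ∷ toℤs as bs

  rotate : List ℤ → List ℤ
  rotate []       = []
  rotate (c ∷ cs) = cs ++ c ∷ []

  indicatorAt : ℕ → ℕ → List ℤ
  indicatorAt zero    _       = []
  -- The index `l` lies past the end of the remaining list, so only zeros follow.
  indicatorAt (suc l) zero    = (⁺ 1) ∷ indicatorAt l l
  indicatorAt (suc l) (suc i) = (⁺ 0) ∷ indicatorAt l i

  difference : ∀ {k} → Lin k → Lin k → List ℤ
  difference s t = rotate (toℤs (form s) (form t))

  hypothesisRows : ∀ {k} → ℕ → ℕ → List (Rel k) → List Row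
  hypothesisRows l i []            = []
  hypothesisRows l i (s ≼ t ∷ hs) = row false (difference s t) (indicatorAt l i) ∷ hypothesisRows l (suc i) hs
  hypothesisRows l i (s ≈ t ∷ hs) = row true (difference s t) (indicatorAt l i) ∷ hypothesisRows l (suc i) hs

  search : ∀ {k} → List (Rel k) → Lin k → Lin k → ℕ × List ℤ
  search {k} hs s t = refutation (eliminate k
    (row false (difference (con 1 ⊕ t) s) (indicatorAt l 0) ∷ hypothesisRows l 1 hs))
    where
    l = suc (foldr (λ _ → suc) 0 hs)

  provable : ∀ {k} → List (Rel k) → Rel k → Bool
  provable hs (s ≼ t) = certifies hs s t (search hs s t)
  provable hs (s ≈ t) = certifies hs s t (search hs s t) ∧ certifies hs t s (search hs t s)

  provable-sound : ∀ {k} (hs : List (Rel k)) g → T (provable hs g) → ∀ ρ → AllHold hs ρ → ⟦ g ⟧ʳ ρ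
  provable-sound hs (s ≼ t) ok ρ a = certifies-sound hs s t _ ok ρ a
  provable-sound hs (s ≈ t) ok ρ a =
    ≤-antisym (certifies-sound hs s t _ (proj₁ (T-∧ ok)) ρ a) (certifies-sound hs t s _ (proj₂ (T-∧ ok)) ρ a)

  curried : ∀ {k} (hs : List (Rel k)) g ρ → (AllHold hs ρ → ⟦ g ⟧ʳ ρ) → Implies hs g ρ
  curried []       g ρ f = f tt
  curried (h ∷ hs) g ρ f = λ x → curried hs g ρ (λ a → f (x , a))

  close : ∀ k → N-ary k (Lin k) (Problem k) → Problem k
  close k p = p $ⁿ tabulate var

Valid : ∀ {k} → Problem k → Vec ℕ k → Set
Valid (hs ⊢ g) = Implies hs g

Solvable : ∀ {k} → Problem k → Set
Solvable (hs ⊢ g) = T (provable hs g)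

-- For a concrete problem the implicit argument computes to the unit type, so the search runs during
-- type checking and the call needs only the hypotheses.
linear : ∀ k (p : N-ary k (Lin k) (Problem k)) ρ {_ : Solvable (close k p)} → Valid (close k p) ρ
linear k p ρ {ok} = valid (close k p) ok
  where
  valid : ∀ q → Solvable q → Valid q ρ
  valid (hs ⊢ g) ok = curried hs g ρ (provable-sound hs g ok ρ)

absurd : ∀ {ℓ} {A : Set ℓ} → 1 ≤ 0 → A
absurd ()

-- Counting over finite types

𝟙 : Bool → ℕ
𝟙 b = if b then 1 else 0

total : List Bool → ℕ
total = foldr (λ b t → 𝟙 b + t) 0

allBool? : ∀ {ℓ} {P : Bool → Set ℓ} → (∀ b → Dec (P b)) → Dec (∀ b → P b)
allBool? d = map′ (λ { (t , f) true → t ; (t , f) false → f }) (λ h → h true , h false) (d true ×-dec d false)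

sumF-cong : ∀ {n} {f g : Fin n → ℕ} → (∀ i → f i ≡ g i) → sumF f ≡ sumF g
sumF-cong {zero}  h = refl
sumF-cong {suc n} h = cong₂ _+_ (h zero) (sumF-cong (h ∘ suc))

sumF-mono : ∀ {n} {f g : Fin n → ℕ} → (∀ i → f i ≤ g i) → sumF f ≤ sumF g
sumF-mono {zero}  h = z≤n
sumF-mono {suc n} h = +-mono-≤ (h zero) (sumF-mono (h ∘ suc))

sumF-+ : ∀ {n} (f g : Fin n → ℕ) → sumF (λ i → f i + g i) ≡ sumF f + sumF g
sumF-+ {zero}  f g = refl
sumF-+ {suc n} f g = trans (cong (f zero + g zero +_) (sumF-+ (f ∘ suc) (g ∘ suc)))
  (linear 4 (λ a b c d → [] ⊢ a ⊕ b ⊕ (c ⊕ d) ≈ a ⊕ c ⊕ (b ⊕ d))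
    (f zero ∷ g zero ∷ sumF (f ∘ suc) ∷ sumF (g ∘ suc) ∷ []))

sumF-0 : ∀ n → sumF {n} (λ _ → 0) ≡ 0
sumF-0 zero    = refl
sumF-0 (suc n) = sumF-0 n

sumF-*ʳ : ∀ {n} (f : Fin n → ℕ) k → sumF (λ i → f i * k) ≡ sumF f * k
sumF-*ʳ {zero}  f k = refl
sumF-*ʳ {suc n} f k = trans (cong (f zero * k +_) (sumF-*ʳ (f ∘ suc) k)) (sym (*-distribʳ-+ k (f zero) _))

sumF-swap : ∀ {n m} (f : Fin n → Fin m → ℕ) →
            sumF (λ i → sumF (λ j → f i j)) ≡ sumF (λ j → sumF (λ i → f i j))
sumF-swap {zero}  {m} f = sym (sumF-0 m)
sumF-swap {suc n} f =
  trans (cong (sumF (f zero) +_) (sumF-swap (f ∘ suc))) (sym (sumF-+ (f zero) _))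

sumF-punchIn : ∀ {n} (v : Fin (suc n)) (f : Fin (suc n) → ℕ) → sumF f ≡ f v + sumF (f ∘ punchIn v)
sumF-punchIn zero f = refl
sumF-punchIn {suc n} (suc v) f = trans (cong (f zero +_) (sumF-punchIn v (f ∘ suc)))
  (linear 3 (λ a b c → [] ⊢ a ⊕ (b ⊕ c) ≈ b ⊕ (a ⊕ c))
    (f zero ∷ f (suc v) ∷ sumF (λ i → f (suc (punchIn v i))) ∷ []))

countB≡sumF : ∀ {n} (P : Fin n → Bool) → countB P ≡ sumF (𝟙 ∘ P)
countB≡sumF {zero}  P = refl
countB≡sumF {suc n} P = cong (𝟙 (P zero) +_) (countB≡sumF (P ∘ suc))

count₂ : ∀ {n} → (Fin n → Fin n → Bool) → ℕ
count₂ R = sumF (λ i → countB (R i))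

counts : ∀ {n} → List (Fin n → Bool) → ℕ
counts = foldr (λ P t → countB P + t) 0

counts₂ : ∀ {n} → List (Fin n → Fin n → Bool) → ℕ
counts₂ = foldr (λ R t → count₂ R + t) 0

counts≡sumF : ∀ {n} (Ps : List (Fin n → Bool)) → counts Ps ≡ sumF (λ i → total (map (λ P → P i) Ps))
counts≡sumF {n} []       = sym (sumF-0 n)
counts≡sumF     (P ∷ Ps) = trans (cong₂ _+_ (countB≡sumF P) (counts≡sumF Ps)) (sym (sumF-+ (𝟙 ∘ P) _))

counts₂≡sumF : ∀ {n} (Rs : List (Fin n → Fin n → Bool)) →
               counts₂ Rs ≡ sumF (λ i → counts (map (λ R → R i) Rs))
counts₂≡sumF {n} []       = sym (sumF-0 n)
counts₂≡sumF     (R ∷ Rs) = trans (cong (count₂ R +_) (counts₂≡sumF Rs)) (sym (sumF-+ (λ i → countB (R i)) _))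

-- Reduces a linear identity between cardinalities to one truth table for the membership bits of a
-- single element.
counts-≡ : ∀ {n} (Ps Qs : List (Fin n → Bool)) →
           (∀ i → total (map (λ P → P i) Ps) ≡ total (map (λ P → P i) Qs)) → counts Ps ≡ counts Qs
counts-≡ Ps Qs h rewrite counts≡sumF Ps | counts≡sumF Qs = sumF-cong h

private
  counts₂≡sumF² : ∀ {n} (Rs : List (Fin n → Fin n → Bool)) →
                  counts₂ Rs ≡ sumF (λ i → sumF (λ j → total (map (λ R → R i j) Rs)))
  counts₂≡sumF² Rs = trans (counts₂≡sumF Rs) (sumF-cong λ i →
    trans (counts≡sumF (map (λ R → R i) Rs)) (sumF-cong λ j → cong total (map-∘′ i j Rs)))
    where
    map-∘′ : ∀ {n} (i j : Fin n) (Rs : List (Fin n → Fin n → Bool)) →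
             map (λ P → P j) (map (λ R → R i) Rs) ≡ map (λ R → R i j) Rs
    map-∘′ i j []       = refl
    map-∘′ i j (R ∷ Rs) = cong (R i j ∷_) (map-∘′ i j Rs)

counts₂-≤ : ∀ {n} (Ps Qs : List (Fin n → Fin n → Bool)) →
            (∀ i j → total (map (λ P → P i j) Ps) ≤ total (map (λ P → P i j) Qs)) → counts₂ Ps ≤ counts₂ Qs
counts₂-≤ Ps Qs h rewrite counts₂≡sumF² Ps | counts₂≡sumF² Qs = sumF-mono λ i → sumF-mono (h i)

counts₂-≡ : ∀ {n} (Ps Qs : List (Fin n → Fin n → Bool)) →
            (∀ i j → total (map (λ P → P i j) Ps) ≡ total (map (λ P → P i j) Qs)) → counts₂ Ps ≡ counts₂ Qs
counts₂-≡ Ps Qs h rewrite counts₂≡sumF² Ps | counts₂≡sumF² Qs = sumF-cong λ i → sumF-cong (h i)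

count₂-swap : ∀ {n} (R : Fin n → Fin n → Bool) → count₂ R ≡ count₂ (λ i j → R j i)
count₂-swap R = begin
  count₂ R                                  ≡⟨ sumF-cong (λ i → countB≡sumF (R i)) ⟩
  sumF (λ i → sumF (λ j → 𝟙 (R i j)))       ≡⟨ sumF-swap (λ i j → 𝟙 (R i j)) ⟩
  sumF (λ j → sumF (λ i → 𝟙 (R i j)))       ≡⟨ sumF-cong (λ j → sym (countB≡sumF (λ i → R i j))) ⟩
  count₂ (λ i j → R j i)                    ∎
  where open ≡-Reasoning

eqᵇ-refl : ∀ {n} (v : Fin n) → eqᵇ v v ≡ true
eqᵇ-refl v with v ≟ᶠ v
... | yes _ = refl
... | no  q = ⊥-elim (q refl)

-- Vertex sets as Boolean predicates.

module _ {n : ℕ} where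

  infix  4 _∈_ _∉_ _⊆_ _∈?_ _⊆?_
  infixl 7 _∩_ _∖_
  infixl 6 _∪_

  -- Membership is a record and the set operations are opaque so that the sets
  -- occurring in a membership statement can be inferred.
  record _∈_ (i : Fin n) (X : VSet n) : Set where
    constructor ∈⁺
    field ∈⁻ : X i ≡ true
  open _∈_ public

  record _∉_ (i : Fin n) (X : VSet n) : Set where
    constructor ∉⁺
    field ∉⁻ : X i ≡ false
  open _∉_ public

  _⊆_ : VSet n → VSet n → Set
  X ⊆ Y = ∀ {i} → i ∈ X → i ∈ Y

  full ∅ : VSet n
  full _ = true
  ∅    _ = false

  opaque

    _∪_ _∩_ _∖_ : VSet n → VSet n → VSet n
    (X ∪ Y) i = X i ∨ Y i
    (X ∩ Y) i = X i ∧ Y i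
    (X ∖ Y) i = X i ∧ not (Y i)

    ∁ : VSet n → VSet n
    ∁ X i = not (X i)

    ⁅_⁆ : Fin n → VSet n
    ⁅ v ⁆ i = eqᵇ v i

  ∣_∣ : VSet n → ℕ
  ∣ X ∣ = countB X

  ∈-∉ : ∀ {X : VSet n} {i} → i ∈ X → i ∉ X → ⊥
  ∈-∉ (∈⁺ p) (∉⁺ q) with trans (sym p) q
  ... | ()

  _∈?_ : ∀ i (X : VSet n) → i ∈ X ⊎ i ∉ X
  i ∈? X with X i in eq
  ... | true  = inj₁ (∈⁺ eq)
  ... | false = inj₂ (∉⁺ eq)

  ∈-dec : ∀ i (X : VSet n) → Dec (i ∈ X)
  ∈-dec i X = map′ ∈⁺ ∈⁻ (X i ≟ᵇ true)

  ∉-dec : ∀ i (X : VSet n) → Dec (i ∉ X)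
  ∉-dec i X = map′ ∉⁺ ∉⁻ (X i ≟ᵇ false)

  ¬∈⇒∉ : ∀ {X : VSet n} {i} → ¬ i ∈ X → i ∉ X
  ¬∈⇒∉ {X} {i} h with i ∈? X
  ... | inj₁ p = ⊥-elim (h p)
  ... | inj₂ q = q

  ∈-full : ∀ {i} → i ∈ full
  ∈-full = ∈⁺ refl

  opaque
    unfolding _∪_

    ⁅⁆-refl : ∀ v → v ∈ ⁅ v ⁆
    ⁅⁆-refl v = ∈⁺ (eqᵇ-refl v)

    ∈-⁅⁆ : ∀ {v i} → i ∈ ⁅ v ⁆ → v ≡ i
    ∈-⁅⁆ {v} {i} (∈⁺ p) with v ≟ᶠ i
    ∈-⁅⁆ (∈⁺ p)  | yes q = q
    ∈-⁅⁆ (∈⁺ ()) | no _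

    ∪-∈ˡ : ∀ {X Y : VSet n} {i} → i ∈ X → i ∈ X ∪ Y
    ∪-∈ˡ {Y = Y} {i} (∈⁺ p) = ∈⁺ (cong (_∨ Y i) p)

    ∪-∈ʳ : ∀ {X Y : VSet n} {i} → i ∈ Y → i ∈ X ∪ Y
    ∪-∈ʳ {X} {i = i} (∈⁺ p) = ∈⁺ (trans (cong (X i ∨_) p) (∨-zeroʳ (X i)))

    ∈-∪ : ∀ {X Y : VSet n} {i} → i ∈ X ∪ Y → i ∈ X ⊎ i ∈ Y
    ∈-∪ {X} {Y} {i} (∈⁺ p) with i ∈? X
    ... | inj₁ q = inj₁ q
    ... | inj₂ (∉⁺ q) = inj₂ (∈⁺ (trans (cong (_∨ Y i) (sym q)) p))

    ∩-∈ : ∀ {X Y : VSet n} {i} → i ∈ X → i ∈ Y → i ∈ X ∩ Y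
    ∩-∈ (∈⁺ p) (∈⁺ q) = ∈⁺ (cong₂ _∧_ p q)

    ∈-∩ : ∀ {X Y : VSet n} {i} → i ∈ X ∩ Y → i ∈ X × i ∈ Y
    ∈-∩ {X} {Y} {i} (∈⁺ p) with X i in eq
    ... | true = ∈⁺ eq , ∈⁺ p

    ∖-∈ : ∀ {X Y : VSet n} {i} → i ∈ X → i ∉ Y → i ∈ X ∖ Y
    ∖-∈ (∈⁺ p) (∉⁺ q) = ∈⁺ (cong₂ _∧_ p (cong not q))

    ∈-∖ : ∀ {X Y : VSet n} {i} → i ∈ X ∖ Y → i ∈ X × i ∉ Y
    ∈-∖ {X} {Y} {i} (∈⁺ p) with X i in eq | Y i in eq′
    ... | true | false = ∈⁺ eq , ∉⁺ eq′

    ∁-∈ : ∀ {X : VSet n} {i} → i ∉ X → i ∈ ∁ X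
    ∁-∈ (∉⁺ p) = ∈⁺ (cong not p)

    ∈-∁ : ∀ {X : VSet n} {i} → i ∈ ∁ X → i ∉ X
    ∈-∁ {X} {i} (∈⁺ p) with X i in eq
    ... | false = ∉⁺ eq

  ∉-⁅⁆ : ∀ {v i} → v ≢ i → i ∉ ⁅ v ⁆
  ∉-⁅⁆ h = ¬∈⇒∉ (h ∘ ∈-⁅⁆)

  ∉-⁅⁆⇒≢ : ∀ {v i} → i ∉ ⁅ v ⁆ → v ≢ i
  ∉-⁅⁆⇒≢ h refl = ∈-∉ (⁅⁆-refl _) h

  ∪-∉ : ∀ {X Y : VSet n} {i} → i ∉ X → i ∉ Y → i ∉ X ∪ Y
  ∪-∉ p q = ¬∈⇒∉ λ r → case ∈-∪ r of λ { (inj₁ s) → ∈-∉ s p ; (inj₂ s) → ∈-∉ s q }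

  ∁-∉ : ∀ {X : VSet n} {i} → i ∈ X → i ∉ ∁ X
  ∁-∉ p = ¬∈⇒∉ (∈-∉ p ∘ ∈-∁)

  ∩-∉ˡ : ∀ {X Y : VSet n} {i} → i ∉ X → i ∉ X ∩ Y
  ∩-∉ˡ p = ¬∈⇒∉ λ q → ∈-∉ (proj₁ (∈-∩ q)) p

  _⊆?_ : ∀ (X Y : VSet n) → Dec (X ⊆ Y)
  X ⊆? Y = map′ (λ h {i} → h i) (λ h i → h {i}) (Fin.all? λ i → ∈-dec i X →-dec ∈-dec i Y)

  countB-cong : ∀ {P Q : VSet n} → (∀ i → P i ≡ Q i) → ∣ P ∣ ≡ ∣ Q ∣
  countB-cong {P} {Q} h = trans (countB≡sumF P) (trans (sumF-cong (cong 𝟙 ∘ h)) (sym (countB≡sumF Q)))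

  𝟙-mono : ∀ {a b} → (a ≡ true → b ≡ true) → 𝟙 a ≤ 𝟙 b
  𝟙-mono {false} h = z≤n
  𝟙-mono {true}  h rewrite h refl = ≤-refl

  countB-mono : ∀ {P Q : VSet n} → P ⊆ Q → ∣ P ∣ ≤ ∣ Q ∣
  countB-mono {P} {Q} h rewrite countB≡sumF P | countB≡sumF Q = sumF-mono λ i → 𝟙-mono (λ p → ∈⁻ (h {i} (∈⁺ p)))

∣full∣ : ∀ n → ∣ full {n} ∣ ≡ n
∣full∣ zero    = refl
∣full∣ (suc n) = cong suc (∣full∣ n)

∣∅∣ : ∀ n → ∣ ∅ {n} ∣ ≡ 0
∣∅∣ zero    = refl
∣∅∣ (suc n) = ∣∅∣ n

private
  eqᵇ-suc : ∀ {n} (v i : Fin n) → eqᵇ (suc v) (suc i) ≡ eqᵇ v i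
  eqᵇ-suc v i with v ≟ᶠ i
  ... | yes _ = refl
  ... | no  _ = refl

  countB-eqᵇ : ∀ {n} (v : Fin n) → countB (eqᵇ v) ≡ 1
  countB-eqᵇ {suc n} zero    = cong suc (∣∅∣ n)
  countB-eqᵇ {suc n} (suc v) = trans (countB-cong (eqᵇ-suc v)) (countB-eqᵇ v)

  findIndex : ∀ {n} (P : VSet n) → 1 ≤ countB P → ∃ λ i → P i ≡ true
  findIndex {zero}  P ()
  findIndex {suc n} P h with P zero in eq
  ... | true  = zero , eq
  ... | false = let (i , p) = findIndex (P ∘ suc) h in suc i , p

module _ {n : ℕ} where

  find : ∀ (X : VSet n) → 1 ≤ ∣ X ∣ → ∃ (_∈ X)
  find X h = let (i , p) = findIndex X h in i , ∈⁺ p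

  opaque
    unfolding _∪_

    ∣⁅⁆∣ : ∀ (v : Fin n) → ∣ ⁅ v ⁆ ∣ ≡ 1
    ∣⁅⁆∣ = countB-eqᵇ

    ∣∣-split : ∀ (X Y : VSet n) → ∣ X ∣ ≡ ∣ X ∩ Y ∣ + ∣ X ∖ Y ∣
    ∣∣-split X Y = linear 3 (λ a b c → (a ⊕ con 0 ≈ b ⊕ (c ⊕ con 0) ∷ []) ⊢ a ≈ b ⊕ c)
      (∣ X ∣ ∷ ∣ X ∩ Y ∣ ∷ ∣ X ∖ Y ∣ ∷ [])
      (counts-≡ (X ∷ []) (X ∩ Y ∷ X ∖ Y ∷ []) (λ i → pointwise (X i) (Y i)))
      where
      pointwise : ∀ a b → total (a ∷ []) ≡ total (a ∧ b ∷ a ∧ not b ∷ [])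
      pointwise = toWitness {a? = allBool? λ a → allBool? λ b → _ ≟ⁿ _} tt

    ∣∪∣+∣∩∣ : ∀ (X Y : VSet n) → ∣ X ∪ Y ∣ + ∣ X ∩ Y ∣ ≡ ∣ X ∣ + ∣ Y ∣
    ∣∪∣+∣∩∣ X Y = linear 4 (λ a b c d → (a ⊕ (b ⊕ con 0) ≈ c ⊕ (d ⊕ con 0) ∷ []) ⊢ a ⊕ b ≈ c ⊕ d)
      (∣ X ∪ Y ∣ ∷ ∣ X ∩ Y ∣ ∷ ∣ X ∣ ∷ ∣ Y ∣ ∷ [])
      (counts-≡ (X ∪ Y ∷ X ∩ Y ∷ []) (X ∷ Y ∷ []) (λ i → pointwise (X i) (Y i)))
      where
      pointwise : ∀ a b → total ((a ∨ b) ∷ (a ∧ b) ∷ []) ≡ total (a ∷ b ∷ [])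
      pointwise = toWitness {a? = allBool? λ a → allBool? λ b → _ ≟ⁿ _} tt

    ∣∁∣ : ∀ (X : VSet n) → ∣ X ∣ + ∣ ∁ X ∣ ≡ n
    ∣∁∣ X = trans (sym (∣∣-split full X)) (∣full∣ n)

  ∣∣≤n : ∀ (X : VSet n) → ∣ X ∣ ≤ n
  ∣∣≤n X = ≤-trans (m≤m+n ∣ X ∣ ∣ ∁ X ∣) (≤-reflexive (∣∁∣ X))

  ∈∧∉⇒≢ : ∀ {X : VSet n} {u v} → u ∈ X → v ∉ X → u ≢ v
  ∈∧∉⇒≢ p q refl = ∈-∉ p q

  ∣∣-none : ∀ {X : VSet n} → (∀ {i} → i ∉ X) → ∣ X ∣ ≡ 0
  ∣∣-none h = trans (countB-cong λ i → ∉⁻ (h {i})) (∣∅∣ n)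

  insert : ∀ {X : VSet n} {v} → v ∉ X → ∣ X ∪ ⁅ v ⁆ ∣ ≡ suc ∣ X ∣
  insert {X} {v} p = linear 4 (λ u k x e → (u ⊕ k ≈ x ⊕ e ∷ e ≈ con 1 ∷ k ≈ con 0 ∷ []) ⊢ u ≈ con 1 ⊕ x)
    (∣ X ∪ ⁅ v ⁆ ∣ ∷ ∣ X ∩ ⁅ v ⁆ ∣ ∷ ∣ X ∣ ∷ ∣ ⁅ v ⁆ ∣ ∷ [])
    (∣∪∣+∣∩∣ X ⁅ v ⁆) (∣⁅⁆∣ v) (∣∣-none (¬∈⇒∉ λ q → let (r , s) = ∈-∩ q in ∈∧∉⇒≢ r p (sym (∈-⁅⁆ s))))

  ∣∩⁅⁆∣ : ∀ {X : VSet n} {v} → v ∈ X → ∣ X ∩ ⁅ v ⁆ ∣ ≡ 1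
  ∣∩⁅⁆∣ {X} {v} p = ≤-antisym
    (≤-trans (countB-mono {P = X ∩ ⁅ v ⁆} (proj₂ ∘ ∈-∩)) (≤-reflexive (∣⁅⁆∣ v)))
    (≤-trans (≤-reflexive (sym (∣⁅⁆∣ v)))
      (countB-mono {P = ⁅ v ⁆} λ q → ∩-∈ (subst (_∈ X) (∈-⁅⁆ q) p) q))

  remove : ∀ {X : VSet n} {v} → v ∈ X → ∣ X ∣ ≡ suc ∣ X ∖ ⁅ v ⁆ ∣
  remove {X} {v} p = trans (∣∣-split X ⁅ v ⁆) (cong (_+ ∣ X ∖ ⁅ v ⁆ ∣) (∣∩⁅⁆∣ p))

  count≥1 : ∀ {X : VSet n} {v} → v ∈ X → 1 ≤ ∣ X ∣
  count≥1 {X} p rewrite remove {X} p = s≤s z≤n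

  count≥2 : ∀ {X : VSet n} {u v} → u ∈ X → v ∈ X → u ≢ v → 2 ≤ ∣ X ∣
  count≥2 {X} p q h rewrite remove {X} p = s≤s (count≥1 (∖-∈ q (∉-⁅⁆ h)))

  count≥3 : ∀ {X : VSet n} {u v w} → u ∈ X → v ∈ X → w ∈ X → u ≢ v → u ≢ w → v ≢ w → 3 ≤ ∣ X ∣
  count≥3 {X} p q r h k l rewrite remove {X} p =
    s≤s (count≥2 (∖-∈ q (∉-⁅⁆ h)) (∖-∈ r (∉-⁅⁆ k)) l)

  count≥4 : ∀ {X : VSet n} {t u v w} → t ∈ X → u ∈ X → v ∈ X → w ∈ X →
            t ≢ u → t ≢ v → t ≢ w → u ≢ v → u ≢ w → v ≢ w → 4 ≤ ∣ X ∣
  count≥4 {X} o p q r a b c h k l rewrite remove {X} o =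
    s≤s (count≥3 (∖-∈ p (∉-⁅⁆ a)) (∖-∈ q (∉-⁅⁆ b)) (∖-∈ r (∉-⁅⁆ c)) h k l)

  findOther : ∀ (X : VSet n) u → 2 ≤ ∣ X ∣ → ∃ λ v → v ∈ X × u ≢ v
  findOther X u h = let (v , p) = find (X ∖ ⁅ u ⁆) large
                        (q , r) = ∈-∖ p
                    in v , q , ∉-⁅⁆⇒≢ r
    where
    large : 1 ≤ ∣ X ∖ ⁅ u ⁆ ∣
    large with u ∈? X
    ... | inj₁ p = ≤-pred (subst (2 ≤_) (remove {X} p) h)
    ... | inj₂ q = ≤-trans (≤-trans (s≤s z≤n) h) (countB-mono {P = X} λ p →
      ∖-∈ p (∉-⁅⁆ λ { refl → ∈-∉ p q }))

  find₂ : ∀ (X : VSet n) → 2 ≤ ∣ X ∣ → ∃₂ λ u v → u ∈ X × v ∈ X × u ≢ v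
  find₂ X h = let (u , p) = find X (≤-trans (s≤s z≤n) h)
                  (v , q , r) = findOther X u h
              in u , v , p , q , r

  ∣∣≡0⇒∉ : ∀ {X : VSet n} → ∣ X ∣ ≡ 0 → ∀ {i} → i ∉ X
  ∣∣≡0⇒∉ h = ¬∈⇒∉ λ p → case subst (1 ≤_) h (count≥1 p) of λ ()

  ∣∣≡1⇒≡ : ∀ {X : VSet n} {u v} → ∣ X ∣ ≡ 1 → u ∈ X → v ∈ X → u ≡ v
  ∣∣≡1⇒≡ {X} {u} {v} h p q with u ≟ᶠ v
  ... | yes r = r
  ... | no  r = case subst (2 ≤_) h (count≥2 p q r) of λ { (s≤s ()) }

  full-or-missing : ∀ (X : VSet n) → (∀ {i} → i ∈ X) ⊎ ∃ (_∉ X)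
  full-or-missing X with ∣ ∁ X ∣ in eq
  ... | zero  = inj₁ λ {i} → everything i
    where
    everything : ∀ i → i ∈ X
    everything i with i ∈? X
    ... | inj₁ p = p
    ... | inj₂ q = ⊥-elim (∈-∉ (∁-∈ q) (∣∣≡0⇒∉ eq))
  ... | suc k = let (i , p) = find (∁ X) (subst (1 ≤_) (sym eq) (s≤s z≤n)) in inj₂ (i , ∈-∁ p)

  all⇒∣∣≡n : ∀ {X : VSet n} → (∀ {i} → i ∈ X) → ∣ X ∣ ≡ n
  all⇒∣∣≡n h = trans (countB-cong λ i → ∈⁻ (h {i})) (∣full∣ n)

  ⊆∧≥⇒⊇ : ∀ {X Y : VSet n} → X ⊆ Y → ∣ Y ∣ ≤ ∣ X ∣ → Y ⊆ X
  ⊆∧≥⇒⊇ {X} {Y} s h {i} p with i ∈? X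
  ... | inj₁ q = q
  ... | inj₂ q = ⊥-elim (<-irrefl refl (≤-trans (≤-trans (≤-reflexive (sym (insert {X} q))) grown) h))
    where
    grown : ∣ X ∪ ⁅ i ⁆ ∣ ≤ ∣ Y ∣
    grown = countB-mono {P = X ∪ ⁅ i ⁆} λ r → case ∈-∪ r of λ
      { (inj₁ q) → s q ; (inj₂ q) → subst (_∈ Y) (∈-⁅⁆ q) p }

  count₂-cong : ∀ {R S : EdgeSet n} → (∀ i j → R i j ≡ S i j) → count₂ R ≡ count₂ S
  count₂-cong h = sumF-cong λ i → countB-cong (h i)

  count₂-mono : ∀ {R S : EdgeSet n} → (∀ i j → R i j ≡ true → S i j ≡ true) → count₂ R ≤ count₂ S
  count₂-mono h = sumF-mono λ i → countB-mono (λ {j} p → ∈⁺ (h i j (∈⁻ p)))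

  if-count : ∀ b (P : VSet n) → countB (λ j → b ∧ P j) ≡ 𝟙 b * ∣ P ∣
  if-count true  P = sym (+-identityʳ ∣ P ∣)
  if-count false P = ∣∅∣ n

  count₂-product : ∀ (X Y : VSet n) → count₂ (λ i j → X i ∧ Y j) ≡ ∣ X ∣ * ∣ Y ∣
  count₂-product X Y = trans (sumF-cong λ i → if-count (X i) Y)
    (trans (sumF-*ʳ (𝟙 ∘ X) ∣ Y ∣) (cong (_* ∣ Y ∣) (sym (countB≡sumF X))))

  count₂-point : ∀ (p q : Fin n) → count₂ (λ i j → eqᵇ p i ∧ eqᵇ q j) ≡ 1
  count₂-point p q = trans (count₂-product (eqᵇ p) (eqᵇ q)) (cong₂ _*_ (countB-eqᵇ p) (countB-eqᵇ q))

  count₂≥1 : ∀ {R : EdgeSet n} {p q} → R p q ≡ true → 1 ≤ count₂ R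
  count₂≥1 {R} {p} {q} h = subst (_≤ count₂ R) (count₂-point p q) (count₂-mono inside)
    where
    inside : ∀ i j → eqᵇ p i ∧ eqᵇ q j ≡ true → R i j ≡ true
    inside i j e with p ≟ᶠ i | q ≟ᶠ j
    inside i j e  | yes refl | yes refl = h
    inside i j () | yes _    | no _
    inside i j () | no _     | _

  count₂-find : ∀ (R : EdgeSet n) → 1 ≤ count₂ R → ∃₂ λ p q → R p q ≡ true
  count₂-find R h with full-or-missing (λ i → ∣ R i ∣ ≡ᵇ 0)
  ... | inj₂ (i , p) = i , findIndex (R i) (positive ∣ R i ∣ (∉⁻ p))
    where
    positive : ∀ k → (k ≡ᵇ 0) ≡ false → 1 ≤ k
    positive (suc k) _ = s≤s z≤n
  ... | inj₁ none = ⊥-elim (<-irrefl refl (≤-trans h (≤-reflexive (trans (sumF-cong vanish) (sumF-0 n)))))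
    where
    vanish : ∀ i → ∣ R i ∣ ≡ 0
    vanish i = ≡ᵇ⇒≡ ∣ R i ∣ 0 (subst T (sym (∈⁻ (none {i}))) tt)

  count₂≥2 : ∀ {R : EdgeSet n} {p q i j} → R p q ≡ true → R i j ≡ true → ¬ (p ≡ i × q ≡ j) → 2 ≤ count₂ R
  count₂≥2 {R} {p} {q} {i} {j} hp hi ne =
    linear 3 (λ a b r → (a ⊕ (b ⊕ con 0) ≼ r ⊕ con 0 ∷ a ≈ con 1 ∷ b ≈ con 1 ∷ []) ⊢ con 2 ≼ r)
      (count₂ (point p q) ∷ count₂ (point i j) ∷ count₂ R ∷ [])
      (counts₂-≤ (point p q ∷ point i j ∷ []) (R ∷ []) pointwise) (count₂-point p q) (count₂-point i j)
    where
    point : Fin n → Fin n → EdgeSet n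
    point p q a b = eqᵇ p a ∧ eqᵇ q b
    pointwise : ∀ a b → total (point p q a b ∷ point i j a b ∷ []) ≤ total (R a b ∷ [])
    pointwise a b with p ≟ᶠ a | q ≟ᶠ b | i ≟ᶠ a | j ≟ᶠ b
    ... | yes refl | yes refl | yes refl | yes refl = ⊥-elim (ne (refl , refl))
    ... | yes refl | yes refl | yes _ | no _  rewrite hp = ≤-refl
    ... | yes refl | yes refl | no _  | _     rewrite hp = ≤-refl
    ... | yes _ | no _  | yes refl | yes refl rewrite hi = ≤-refl
    ... | no _  | _     | yes refl | yes refl rewrite hi = ≤-refl
    ... | yes _ | no _  | yes _ | no _  = z≤n
    ... | yes _ | no _  | no _  | _     = z≤n
    ... | no _  | _     | yes _ | no _  = z≤n
    ... | no _  | _     | no _  | _     = z≤n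

  count₂≡1⇒ : ∀ {R : EdgeSet n} {p q i j} → count₂ R ≡ 1 → R p q ≡ true → R i j ≡ true → p ≡ i × q ≡ j
  count₂≡1⇒ {R} {p} {q} {i} {j} h hp hi with (p ≟ᶠ i) ×-dec (q ≟ᶠ j)
  ... | yes r  = r
  ... | no  ne = case subst (2 ≤_) h (count₂≥2 {R} hp hi ne) of λ { (s≤s ()) }

  IsSymmetric : EdgeSet n → Set
  IsSymmetric F = ∀ i j → F i j ≡ F j i

  -- Ordered pairs make edge counts additive in each of the two vertex sets; this is the bridge to
  -- the definition of a circuit, where an edge is counted once.
  count₂≡2*edgeCount : ∀ (F : EdgeSet n) → IsSymmetric F → (∀ i → F i i ≡ false) → count₂ F ≡ 2 * edgeCount F
  count₂≡2*edgeCount F symm irr =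
    linear 3 (λ f l g → (f ⊕ con 0 ≈ l ⊕ (g ⊕ con 0) ∷ g ≈ l ∷ []) ⊢ f ≈ 2 ⊛ l)
      (count₂ F ∷ edgeCount F ∷ count₂ (λ i j → ltᵇ j i ∧ F i j) ∷ [])
      (counts₂-≡ (F ∷ []) ((λ i j → ltᵇ i j ∧ F i j) ∷ (λ i j → ltᵇ j i ∧ F i j) ∷ []) pointwise)
      (trans (count₂-swap (λ i j → ltᵇ j i ∧ F i j)) (count₂-cong λ i j → cong (ltᵇ i j ∧_) (symm j i)))
    where
    pointwise : ∀ i j → total (F i j ∷ []) ≡ total ((ltᵇ i j ∧ F i j) ∷ (ltᵇ j i ∧ F i j) ∷ [])
    pointwise i j with i <ᶠ? j | j <ᶠ? i
    ... | yes p | yes q = ⊥-elim (<-asym p q)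
    ... | yes _ | no _  = refl
    ... | no _  | yes _ = refl
    ... | no p  | no q  with Fin.toℕ-injective (≤-antisym (≮⇒≥ q) (≮⇒≥ p))
    ...   | refl rewrite irr i = refl

  pair : Fin n → Fin n → EdgeSet n
  pair x y i j = (eqᵇ i x ∧ eqᵇ j y) ∨ (eqᵇ i y ∧ eqᵇ j x)

  count₂-pair : ∀ {x y} → x ≢ y → count₂ (pair x y) ≡ 2
  count₂-pair {x} {y} x≢y =
    linear 3 (λ a b r → (r ⊕ con 0 ≈ a ⊕ (b ⊕ con 0) ∷ a ≈ con 1 ∷ b ≈ con 1 ∷ []) ⊢ r ≈ con 2)
      (count₂ (λ i j → eqᵇ x i ∧ eqᵇ y j) ∷ count₂ (λ i j → eqᵇ y i ∧ eqᵇ x j) ∷ count₂ (pair x y) ∷ [])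
      (counts₂-≡ (pair x y ∷ []) ((λ i j → eqᵇ x i ∧ eqᵇ y j) ∷ (λ i j → eqᵇ y i ∧ eqᵇ x j) ∷ []) pointwise)
      (count₂-point x y) (count₂-point y x)
    where
    eqᵇ-comm : ∀ i x → eqᵇ {n} i x ≡ eqᵇ x i
    eqᵇ-comm i x with i ≟ᶠ x | x ≟ᶠ i
    ... | yes _ | yes _ = refl
    ... | no _  | no _  = refl
    ... | yes p | no q  = ⊥-elim (q (sym p))
    ... | no p  | yes q = ⊥-elim (p (sym q))
    pointwise : ∀ i j → total (pair x y i j ∷ []) ≡ total ((eqᵇ x i ∧ eqᵇ y j) ∷ (eqᵇ y i ∧ eqᵇ x j) ∷ [])
    pointwise i j rewrite eqᵇ-comm i x | eqᵇ-comm j y | eqᵇ-comm i y | eqᵇ-comm j x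
      with x ≟ᶠ i | y ≟ᶠ j | y ≟ᶠ i | x ≟ᶠ j
    ... | yes p | yes _ | yes q | yes _ = ⊥-elim (x≢y (trans p (sym q)))
    ... | yes p | yes _ | yes q | no _  = refl
    ... | yes p | yes _ | no _  | _     = refl
    ... | yes p | no _  | yes _ | yes _ = refl
    ... | yes p | no _  | yes _ | no _  = refl
    ... | yes p | no _  | no _  | _     = refl
    ... | no _  | _     | yes _ | yes _ = refl
    ... | no _  | _     | yes _ | no _  = refl
    ... | no _  | _     | no _  | _     = refl

  pair-sym : ∀ p q i j → pair p q i j ≡ pair p q j i
  pair-sym p q i j = swap (eqᵇ i p) (eqᵇ j q) (eqᵇ i q) (eqᵇ j p)
    where
    swap : ∀ a b c d → (a ∧ b) ∨ (c ∧ d) ≡ (d ∧ c) ∨ (b ∧ a)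
    swap = toWitness {a? = allBool? λ a → allBool? λ b → allBool? λ c → allBool? λ d → _ ≟ᵇ _} tt

  Extensional : (VSet n → Set) → Set
  Extensional P = ∀ {X Y} → (∀ i → X i ≡ Y i) → P X → P Y

  -- The search runs over Boolean vectors. A given predicate and its table agree only pointwise, so
  -- the property has to be transported along pointwise equality.
  anyVSet? : ∀ {P : VSet n → Set} → Extensional P → (∀ X → Dec (P X)) → Dec (∃ P)
  anyVSet? {P} ext P? = map′ (λ (v , p) → lookup v , p)
    (λ (X , p) → tabulate X , ext (λ i → sym (lookup∘tabulate X i)) p) (anySubset? (λ v → P? (lookup v)))

  Maximal : (VSet n → Set) → VSet n → Set
  Maximal P Y = P Y × (∀ Z → P Z → Y ⊆ Z → Z ⊆ Y)

  extendToMaximal : ∀ {P : VSet n → Set} → Extensional P → (∀ X → Dec (P X)) →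
                    ∀ X → P X → ∃ λ Y → X ⊆ Y × Maximal P Y
  extendToMaximal {P} ext P? X p = go X p (<-wellFounded (n ∸ ∣ X ∣))
    where
    Larger : VSet n → VSet n → Set
    Larger X Z = P Z × X ⊆ Z × ∣ X ∣ < ∣ Z ∣
    larger? : ∀ X → Dec (∃ (Larger X))
    larger? X = anyVSet?
      (λ e (p , s , l) → ext e p , (λ {i} q → ∈⁺ (trans (sym (e i)) (∈⁻ (s q)))) , subst (∣ X ∣ <_) (countB-cong e) l)
      (λ Z → P? Z ×-dec ((X ⊆? Z) ×-dec (suc ∣ X ∣ ≤? ∣ Z ∣)))
    go : ∀ X → P X → Acc _<_ (n ∸ ∣ X ∣) → ∃ λ Y → X ⊆ Y × Maximal P Y
    go X p (acc rs) with larger? X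
    ... | yes (Z , q , s , l) =
      let (Y , t , m) = go Z q (rs (∸-monoʳ-< l (∣∣≤n Z))) in Y , t ∘ s , m
    ... | no none = X , id , p , λ Z q s →
      ⊆∧≥⇒⊇ s (≮⇒≥ λ l → none (Z , q , s , l))

  count≡2 : ∀ {X : VSet n} {u v} → u ∈ X → v ∈ X → u ≢ v → (∀ {w} → w ∈ X → u ≡ w ⊎ v ≡ w) → ∣ X ∣ ≡ 2
  count≡2 {X} {u} {v} p q h only = trans (remove {X} p) (cong suc (trans (remove {X ∖ ⁅ u ⁆} (∖-∈ q (∉-⁅⁆ h)))
    (cong suc (∣∣-none (¬∈⇒∉ λ r → let (s , w≢v) = ∈-∖ r ; (t , w≢u) = ∈-∖ s in
      case only t of λ { (inj₁ refl) → ∉-⁅⁆⇒≢ w≢u refl ; (inj₂ refl) → ∉-⁅⁆⇒≢ w≢v refl })))))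

  count≡3⇒ : ∀ {X : VSet n} {u v w} → ∣ X ∣ ≡ 3 → u ∈ X → v ∈ X → w ∈ X → u ≢ v → u ≢ w → v ≢ w →
             ∀ {t} → t ∈ X → u ≡ t ⊎ v ≡ t ⊎ w ≡ t
  count≡3⇒ {X} {u} {v} {w} h p q r a b c {t} s with u ≟ᶠ t | v ≟ᶠ t | w ≟ᶠ t
  ... | yes k | _     | _     = inj₁ k
  ... | no _  | yes k | _     = inj₂ (inj₁ k)
  ... | no _  | no _  | yes k = inj₂ (inj₂ k)
  ... | no k  | no l  | no m  = case subst (4 ≤_) h (count≥4 p q r s a b k c l m) of λ { (s≤s (s≤s (s≤s ()))) }

  opaque

    ⟪_⟫ : ∀ {P : Fin n → Set} → (∀ i → Dec (P i)) → VSet n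
    ⟪ P? ⟫ i = does (P? i)

    ⟪⟫-∈ : ∀ {P : Fin n → Set} {P? : ∀ i → Dec (P i)} {i} → P i → i ∈ ⟪ P? ⟫
    ⟪⟫-∈ {P? = P?} {i} p = ∈⁺ (dec-true (P? i) p)

    ∈-⟪⟫ : ∀ {P : Fin n → Set} {P? : ∀ i → Dec (P i)} {i} → i ∈ ⟪ P? ⟫ → P i
    ∈-⟪⟫ {P? = P?} {i} (∈⁺ h) with P? i
    ... | yes p = p

-- Edge counts of a graph, with every edge counted in both directions

module EdgeCounts {n : ℕ} (G : Graph n) (simple : IsSimple G) where

  infix 4 _~_

  _~_ : Fin n → Fin n → Set
  u ~ v = adj G u v ≡ true

  ~-sym : ∀ {u v} → u ~ v → v ~ u
  ~-sym {u} {v} p = trans (proj₁ simple v u) p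

  ~-irrefl : ∀ {v} → ¬ v ~ v
  ~-irrefl {v} p = case trans (sym p) (proj₂ simple v) of λ ()

  ~⇒≢ : ∀ {u v} → u ~ v → u ≢ v
  ~⇒≢ p refl = ~-irrefl p

  ~-dec : ∀ u v → Dec (u ~ v)
  ~-dec u v = adj G u v ≟ᵇ true

  ¬~⇒false : ∀ {u v} → ¬ u ~ v → adj G u v ≡ false
  ¬~⇒false {u} {v} h with adj G u v
  ... | true  = ⊥-elim (h refl)
  ... | false = refl

  N : Fin n → VSet n
  N = adj G

  between : VSet n → VSet n → EdgeSet n
  between X Y i j = X i ∧ (Y j ∧ adj G i j)

  opaque

    e : VSet n → VSet n → ℕ
    e X Y = count₂ (between X Y)

  between-∈ : ∀ {X Y : VSet n} {i j} → i ∈ X → j ∈ Y → i ~ j → between X Y i j ≡ true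
  between-∈ (∈⁺ p) (∈⁺ q) r = cong₂ _∧_ p (cong₂ _∧_ q r)

  ∈-between : ∀ {X Y : VSet n} {i j} → between X Y i j ≡ true → i ∈ X × j ∈ Y × i ~ j
  ∈-between {X} {Y} {i} {j} p with X i in a | Y j in b | adj G i j in c
  ... | true | true | true = ∈⁺ a , ∈⁺ b , refl

  opaque
    unfolding e _∪_

    e-sym : ∀ X Y → e X Y ≡ e Y X
    e-sym X Y = trans (count₂-swap (between X Y))
      (count₂-cong λ i j → trans (cong (λ a → X j ∧ (Y i ∧ a)) (proj₁ simple j i)) (swap (X j) (Y i) _))
      where
      swap : ∀ a b c → a ∧ (b ∧ c) ≡ b ∧ (a ∧ c)
      swap = toWitness {a? = allBool? λ a → allBool? λ b → allBool? λ c → _ ≟ᵇ _} tt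

    e-even : ∀ X → ∃ λ k → e X X ≡ 2 * k
    e-even X = edgeCount (between X X) , count₂≡2*edgeCount (between X X)
      (λ i j → trans (cong (λ a → X i ∧ (X j ∧ a)) (proj₁ simple i j)) (swap (X i) (X j) _)) irreflexive
      where
      swap : ∀ a b c → a ∧ (b ∧ c) ≡ b ∧ (a ∧ c)
      swap = toWitness {a? = allBool? λ a → allBool? λ b → allBool? λ c → _ ≟ᵇ _} tt
      irreflexive : ∀ i → between X X i i ≡ false
      irreflexive i with between X X i i in p
      ... | true  = ⊥-elim (~-irrefl (proj₂ (proj₂ (∈-between {X} {X} p))))
      ... | false = refl

    e-mono : ∀ {X Y X′ Y′} → X ⊆ X′ → Y ⊆ Y′ → e X Y ≤ e X′ Y′
    e-mono {X} {Y} s t = count₂-mono {R = between X Y} λ i j p → let (a , b , c) = ∈-between p in between-∈ (s a) (t b) c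

    e-cover : ∀ X Y Z → (∀ {i j} → i ∈ X → j ∈ Z → i ~ j → j ∈ Y) → e X Z ≤ e X Y
    e-cover X Y Z h = count₂-mono {R = between X Z} λ i j p →
      let (a , b , c) = ∈-between {X} {Z} p in between-∈ a (h a b c) c

    e-rows : ∀ X Y → e X Y ≡ sumF (λ i → 𝟙 (X i) * ∣ Y ∩ N i ∣)
    e-rows X Y = sumF-cong λ i → if-count (X i) (Y ∩ N i)

    e-find : ∀ X Y → 1 ≤ e X Y → ∃₂ λ u v → u ∈ X × v ∈ Y × u ~ v
    e-find X Y h = let (u , v , p) = count₂-find _ h in u , v , ∈-between p

    e≥1 : ∀ {X Y u v} → u ∈ X → v ∈ Y → u ~ v → 1 ≤ e X Y
    e≥1 {X} {Y} p q r = count₂≥1 {R = between X Y} (between-∈ p q r)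

    e≡1⇒≡ : ∀ {X Y u v u′ v′} → e X Y ≡ 1 → u ∈ X → v ∈ Y → u ~ v → u′ ∈ X → v′ ∈ Y → u′ ~ v′ →
            u ≡ u′ × v ≡ v′
    e≡1⇒≡ {X} {Y} h p q r p′ q′ r′ = count₂≡1⇒ {R = between X Y} h (between-∈ p q r) (between-∈ p′ q′ r′)

    e-singleton : ∀ v Y → e ⁅ v ⁆ Y ≡ ∣ Y ∩ N v ∣
    e-singleton v Y = trans (e-rows ⁅ v ⁆ Y) (trans (sumF-cong pointwise)
      (trans (sumF-*ʳ (𝟙 ∘ ⁅ v ⁆) ∣ Y ∩ N v ∣)
        (trans (cong (_* ∣ Y ∩ N v ∣) (trans (sym (countB≡sumF ⁅ v ⁆)) (∣⁅⁆∣ v))) (+-identityʳ _))))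
      where
      pointwise : ∀ i → 𝟙 (⁅ v ⁆ i) * ∣ Y ∩ N i ∣ ≡ 𝟙 (⁅ v ⁆ i) * ∣ Y ∩ N v ∣
      pointwise i with v ≟ᶠ i
      ... | yes refl = refl
      ... | no _     = refl

    e-degree : ∀ v → e ⁅ v ⁆ full ≡ degree G v
    e-degree v = e-singleton v full

    e-∪ˡ : ∀ X Y Z → e (X ∪ Y) Z + e (X ∩ Y) Z ≡ e X Z + e Y Z
    e-∪ˡ X Y Z = linear 4 (λ a b c d → (a ⊕ (b ⊕ con 0) ≈ c ⊕ (d ⊕ con 0) ∷ []) ⊢ a ⊕ b ≈ c ⊕ d)
      (e (X ∪ Y) Z ∷ e (X ∩ Y) Z ∷ e X Z ∷ e Y Z ∷ [])
      (counts₂-≡ (between (X ∪ Y) Z ∷ between (X ∩ Y) Z ∷ []) (between X Z ∷ between Y Z ∷ [])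
        λ i j → pointwise (X i) (Y i) (Z j ∧ adj G i j))
      where
      pointwise : ∀ x y z → total (((x ∨ y) ∧ z) ∷ ((x ∧ y) ∧ z) ∷ []) ≡ total ((x ∧ z) ∷ (y ∧ z) ∷ [])
      pointwise = toWitness {a? = allBool? λ a → allBool? λ b → allBool? λ c → _ ≟ⁿ _} tt

    e-∁ʳ : ∀ X → e X full ≡ e X X + e X (∁ X)
    e-∁ʳ X = linear 3 (λ a b c → (a ⊕ con 0 ≈ b ⊕ (c ⊕ con 0) ∷ []) ⊢ a ≈ b ⊕ c)
      (e X full ∷ e X X ∷ e X (∁ X) ∷ [])
      (counts₂-≡ (between X full ∷ []) (between X X ∷ between X (∁ X) ∷ [])
        λ i j → pointwise (X i) (X j) (adj G i j))
      where
      pointwise : ∀ x y a → total ((x ∧ a) ∷ []) ≡ total ((x ∧ (y ∧ a)) ∷ (x ∧ (not y ∧ a)) ∷ [])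
      pointwise = toWitness {a? = allBool? λ a → allBool? λ b → allBool? λ c → _ ≟ⁿ _} tt

    -- An edge joining `X ∖ Y` to `Y ∖ X` is induced by the union but by neither set; any other edge
    -- counts equally on both sides. The factor 2 stands for the two directions.
    e-uncross : ∀ X Y → e (X ∪ Y) (X ∪ Y) + e (X ∩ Y) (X ∩ Y) ≡ e X X + e Y Y + 2 * e (X ∖ Y) (Y ∖ X)
    e-uncross X Y = linear 6 (λ a b c d f g → (a ⊕ (b ⊕ con 0) ≈ c ⊕ (d ⊕ (f ⊕ (g ⊕ con 0))) ∷ f ≈ g ∷ [])
        ⊢ a ⊕ b ≈ c ⊕ d ⊕ 2 ⊛ f)
      (e (X ∪ Y) (X ∪ Y) ∷ e (X ∩ Y) (X ∩ Y) ∷ e X X ∷ e Y Y ∷ e (X ∖ Y) (Y ∖ X) ∷ e (Y ∖ X) (X ∖ Y) ∷ [])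
      (counts₂-≡ (between (X ∪ Y) (X ∪ Y) ∷ between (X ∩ Y) (X ∩ Y) ∷ [])
        (between X X ∷ between Y Y ∷ between (X ∖ Y) (Y ∖ X) ∷ between (Y ∖ X) (X ∖ Y) ∷ [])
        λ i j → pointwise (X i) (Y i) (X j) (Y j) (adj G i j))
      (e-sym (X ∖ Y) (Y ∖ X))
      where
      pointwise : ∀ x y x′ y′ a →
        total (((x ∨ y) ∧ ((x′ ∨ y′) ∧ a)) ∷ ((x ∧ y) ∧ ((x′ ∧ y′) ∧ a)) ∷ []) ≡
        total ((x ∧ (x′ ∧ a)) ∷ (y ∧ (y′ ∧ a)) ∷ ((x ∧ not y) ∧ ((y′ ∧ not x′) ∧ a)) ∷
               ((y ∧ not x) ∧ ((x′ ∧ not y′) ∧ a)) ∷ [])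
      pointwise = toWitness {a? = allBool? λ a → allBool? λ b → allBool? λ c → allBool? λ d → allBool? λ e → _ ≟ⁿ _} tt

    e-complement : ∀ X → e full full ≡ e X X + e (∁ X) (∁ X) + 2 * e X (∁ X)
    e-complement X = linear 5 (λ a b c d d′ → (a ⊕ con 0 ≈ b ⊕ (c ⊕ (d ⊕ (d′ ⊕ con 0))) ∷ d ≈ d′ ∷ [])
        ⊢ a ≈ b ⊕ c ⊕ 2 ⊛ d)
      (e full full ∷ e X X ∷ e (∁ X) (∁ X) ∷ e X (∁ X) ∷ e (∁ X) X ∷ [])
      (counts₂-≡ (between full full ∷ []) (between X X ∷ between (∁ X) (∁ X) ∷ between X (∁ X) ∷ between (∁ X) X ∷ [])
        λ i j → pointwise (X i) (X j) (adj G i j))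
      (e-sym X (∁ X))
      where
      pointwise : ∀ x y a → total (a ∷ []) ≡
        total ((x ∧ (y ∧ a)) ∷ (not x ∧ (not y ∧ a)) ∷ (x ∧ (not y ∧ a)) ∷ (not x ∧ (y ∧ a)) ∷ [])
      pointwise = toWitness {a? = allBool? λ a → allBool? λ b → allBool? λ c → _ ≟ⁿ _} tt

    e-diagonal : ∀ (X : VSet n) → count₂ (λ i j → X i ∧ (X j ∧ eqᵇ i j)) ≡ ∣ X ∣
    e-diagonal X = trans (sumF-cong λ i → trans (if-count (X i) (λ j → X j ∧ eqᵇ i j)) (pointwise i))
      (sym (countB≡sumF X))
      where
      pointwise : ∀ i → 𝟙 (X i) * countB (λ j → X j ∧ eqᵇ i j) ≡ 𝟙 (X i)
      pointwise i with X i in eq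
      ... | false = refl
      ... | true  = trans (+-identityʳ _) (∣∩⁅⁆∣ {X = X} (∈⁺ eq))

    e≤complete : ∀ X → e X X + ∣ X ∣ ≤ ∣ X ∣ * ∣ X ∣
    e≤complete X = linear 4 (λ a d s p → (a ⊕ (d ⊕ con 0) ≼ p ⊕ con 0 ∷ d ≈ s ∷ []) ⊢ a ⊕ s ≼ p)
      (e X X ∷ count₂ diagonal ∷ ∣ X ∣ ∷ ∣ X ∣ * ∣ X ∣ ∷ [])
      (subst (λ p → counts₂ (between X X ∷ diagonal ∷ []) ≤ p + 0) (count₂-product X X)
        (counts₂-≤ (between X X ∷ diagonal ∷ []) ((λ i j → X i ∧ X j) ∷ []) pointwise))
      (e-diagonal X)
      where
      diagonal : EdgeSet n
      diagonal i j = X i ∧ (X j ∧ eqᵇ i j)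
      pointwise : ∀ i j → total (between X X i j ∷ diagonal i j ∷ []) ≤ total ((X i ∧ X j) ∷ [])
      pointwise i j with i ≟ᶠ j
      ... | yes refl rewrite proj₂ simple i with X i
      ...   | true  = ≤-refl
      ...   | false = ≤-refl
      pointwise i j | no _ with X i | X j | adj G i j
      ... | true  | true  | true  = ≤-refl
      ... | true  | true  | false = z≤n
      ... | true  | false | _     = z≤n
      ... | false | _     | _     = z≤n

    e-clique : ∀ X → (∀ {i j} → i ∈ X → j ∈ X → i ≢ j → i ~ j) → e X X + ∣ X ∣ ≡ ∣ X ∣ * ∣ X ∣
    e-clique X clique = linear 4 (λ a d s p → (a ⊕ (d ⊕ con 0) ≈ p ⊕ con 0 ∷ d ≈ s ∷ []) ⊢ a ⊕ s ≈ p)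
      (e X X ∷ count₂ diagonal ∷ ∣ X ∣ ∷ ∣ X ∣ * ∣ X ∣ ∷ [])
      (subst (λ p → counts₂ (between X X ∷ diagonal ∷ []) ≡ p + 0) (count₂-product X X)
        (counts₂-≡ (between X X ∷ diagonal ∷ []) ((λ i j → X i ∧ X j) ∷ []) pointwise))
      (e-diagonal X)
      where
      diagonal : EdgeSet n
      diagonal i j = X i ∧ (X j ∧ eqᵇ i j)
      pointwise : ∀ i j → total (between X X i j ∷ diagonal i j ∷ []) ≡ total ((X i ∧ X j) ∷ [])
      pointwise i j with i ≟ᶠ j
      ... | yes refl rewrite proj₂ simple i with X i
      ...   | true  = refl
      ...   | false = refl
      pointwise i j | no i≢j with X i in p | X j in q
      ... | true  | true  rewrite clique (∈⁺ p) (∈⁺ q) i≢j = refl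
      ... | true  | false = refl
      ... | false | _     = refl

  e≡0⇒¬~ : ∀ {X Y u v} → e X Y ≡ 0 → u ∈ X → v ∈ Y → ¬ u ~ v
  e≡0⇒¬~ h p q r = case subst (1 ≤_) h (e≥1 p q r) of λ ()

  no-edges⇒e≡0 : ∀ X Y → (∀ {u v} → u ∈ X → v ∈ Y → ¬ u ~ v) → e X Y ≡ 0
  no-edges⇒e≡0 X Y h with e X Y in eq
  ... | zero  = refl
  ... | suc k = let (_ , _ , p , q , r) = e-find X Y (subst (1 ≤_) (sym eq) (s≤s z≤n)) in ⊥-elim (h p q r)

  Disjoint : VSet n → VSet n → Set
  Disjoint X Y = ∀ {i} → i ∈ X → i ∈ Y → ⊥

  ∣∪∣-disjoint : ∀ {X Y} → Disjoint X Y → ∣ X ∪ Y ∣ ≡ ∣ X ∣ + ∣ Y ∣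
  ∣∪∣-disjoint {X} {Y} d = linear 4 (λ u i x y → (u ⊕ i ≈ x ⊕ y ∷ i ≈ con 0 ∷ []) ⊢ u ≈ x ⊕ y)
    (∣ X ∪ Y ∣ ∷ ∣ X ∩ Y ∣ ∷ ∣ X ∣ ∷ ∣ Y ∣ ∷ [])
    (∣∪∣+∣∩∣ X Y) (∣∣-none (¬∈⇒∉ λ p → let (q , r) = ∈-∩ p in d q r))

  e-∪ˡ-disjoint : ∀ {X Y} Z → Disjoint X Y → e (X ∪ Y) Z ≡ e X Z + e Y Z
  e-∪ˡ-disjoint {X} {Y} Z d = linear 4 (λ u i x y → (u ⊕ i ≈ x ⊕ y ∷ i ≈ con 0 ∷ []) ⊢ u ≈ x ⊕ y)
    (e (X ∪ Y) Z ∷ e (X ∩ Y) Z ∷ e X Z ∷ e Y Z ∷ [])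
    (e-∪ˡ X Y Z) (no-edges⇒e≡0 (X ∩ Y) Z λ p _ _ → let (q , r) = ∈-∩ p in d q r)

  e-∪-disjoint : ∀ {X Y} → Disjoint X Y → e (X ∪ Y) (X ∪ Y) ≡ e X X + e Y Y + 2 * e X Y
  e-∪-disjoint {X} {Y} d = linear 6
    (λ u i x y c c′ → (u ⊕ i ≈ x ⊕ y ⊕ 2 ⊛ c′ ∷ i ≈ con 0 ∷ c′ ≈ c ∷ []) ⊢ u ≈ x ⊕ y ⊕ 2 ⊛ c)
    (e (X ∪ Y) (X ∪ Y) ∷ e (X ∩ Y) (X ∩ Y) ∷ e X X ∷ e Y Y ∷ e X Y ∷ e (X ∖ Y) (Y ∖ X) ∷ [])
    (e-uncross X Y)
    (no-edges⇒e≡0 (X ∩ Y) (X ∩ Y) λ p _ _ → let (q , r) = ∈-∩ p in d q r)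
    (≤-antisym (e-mono (proj₁ ∘ ∈-∖) (proj₁ ∘ ∈-∖))
      (e-mono (λ p → ∖-∈ p (¬∈⇒∉ (d p))) (λ p → ∖-∈ p (¬∈⇒∉ λ q → d q p))))

  ⁅⁆-disjoint : ∀ {X v} → v ∉ X → Disjoint X ⁅ v ⁆
  ⁅⁆-disjoint p q r = ∈∧∉⇒≢ q p (sym (∈-⁅⁆ r))

  e-⁅⁆⁅⁆ : ∀ v → e ⁅ v ⁆ ⁅ v ⁆ ≡ 0
  e-⁅⁆⁅⁆ v = no-edges⇒e≡0 ⁅ v ⁆ ⁅ v ⁆ λ p q r → ~⇒≢ r (trans (sym (∈-⁅⁆ p)) (∈-⁅⁆ q))

  e-insert : ∀ {X v} → v ∉ X → e (X ∪ ⁅ v ⁆) (X ∪ ⁅ v ⁆) ≡ e X X + 2 * ∣ X ∩ N v ∣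
  e-insert {X} {v} p = linear 6
    (λ u x s c c′ d → (u ≈ x ⊕ s ⊕ 2 ⊛ c ∷ s ≈ con 0 ∷ c ≈ c′ ∷ c′ ≈ d ∷ []) ⊢ u ≈ x ⊕ 2 ⊛ d)
    (e (X ∪ ⁅ v ⁆) (X ∪ ⁅ v ⁆) ∷ e X X ∷ e ⁅ v ⁆ ⁅ v ⁆ ∷ e X ⁅ v ⁆ ∷ e ⁅ v ⁆ X ∷ ∣ X ∩ N v ∣ ∷ [])
    (e-∪-disjoint (⁅⁆-disjoint p)) (e-⁅⁆⁅⁆ v) (e-sym X ⁅ v ⁆) (e-singleton v X)

  degrees≥ : ∀ {X Y k} → (∀ {v} → v ∈ X → k ≤ ∣ Y ∩ N v ∣) → k * ∣ X ∣ ≤ e X Y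
  degrees≥ {X} {Y} {k} h rewrite *-comm k ∣ X ∣ = subst (∣ X ∣ * k ≤_) (sym (e-rows X Y))
    (subst (_≤ sumF (λ i → 𝟙 (X i) * ∣ Y ∩ N i ∣)) (trans (sumF-*ʳ (𝟙 ∘ X) k) (cong (_* k) (sym (countB≡sumF X))))
      (sumF-mono pointwise))
    where
    pointwise : ∀ i → 𝟙 (X i) * k ≤ 𝟙 (X i) * ∣ Y ∩ N i ∣
    pointwise i with X i in p
    ... | true  = +-monoˡ-≤ 0 (h (∈⁺ p))
    ... | false = z≤n

  degrees≤ : ∀ {X Y k} → (∀ {v} → v ∈ X → ∣ Y ∩ N v ∣ ≤ k) → e X Y ≤ k * ∣ X ∣
  degrees≤ {X} {Y} {k} h rewrite *-comm k ∣ X ∣ = subst (_≤ ∣ X ∣ * k) (sym (e-rows X Y))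
    (subst (sumF (λ i → 𝟙 (X i) * ∣ Y ∩ N i ∣) ≤_) (trans (sumF-*ʳ (𝟙 ∘ X) k) (cong (_* k) (sym (countB≡sumF X))))
      (sumF-mono pointwise))
    where
    pointwise : ∀ i → 𝟙 (X i) * ∣ Y ∩ N i ∣ ≤ 𝟙 (X i) * k
    pointwise i with X i in p
    ... | true  = +-monoˡ-≤ 0 (h (∈⁺ p))
    ... | false = z≤n

-- Sparsity and tight sets in a circuit.

module Circuit {n : ℕ} (G : Graph n) (circuit : IsCircuit G) where

  simple : IsSimple G
  simple = proj₁ circuit

  open EdgeCounts G simple public

  private
    anyB⇒∃ : ∀ {k} (P : Fin k → Bool) → anyB P ≡ true → ∃ λ i → P i ≡ true
    anyB⇒∃ {suc k} P h with P zero in eq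
    ... | true  = zero , eq
    ... | false = let (i , p) = anyB⇒∃ (P ∘ suc) h in suc i , p

    incident-⊆ : ∀ {F : EdgeSet n} {X} → (∀ {i j} → F i j ≡ true → i ∈ X) → ∣ incident F ∣ ≤ ∣ X ∣
    incident-⊆ {F} h = countB-mono {P = incident F} λ {i} p → let (j , q) = anyB⇒∃ (F i) (∈⁻ p) in h {i} {j} q

    doubled : ∀ {F} → IsEdgeSubset G F → count₂ F ≡ 2 * edgeCount F
    doubled {F} (symm , sub) = count₂≡2*edgeCount F symm irreflexive
      where
      irreflexive : ∀ i → F i i ≡ false
      irreflexive i with F i i in p
      ... | true  = ⊥-elim (~-irrefl (sub i i p))
      ... | false = refl

    Bound : EdgeSet n → Set
    Bound F = 1 ≤ edgeCount F → edgeCount F < edgeCount (adj G) → edgeCount F + 2 ≤ 2 * ∣ incident F ∣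

    removeEdge : EdgeSet n → Fin n → Fin n → EdgeSet n
    removeEdge F p q i j = F i j ∧ not (pair p q i j)

    count₂-removeEdge : ∀ {F} → IsEdgeSubset G F → ∀ {p q} → F p q ≡ true →
                        count₂ F ≡ 2 + count₂ (removeEdge F p q)
    count₂-removeEdge {F} (symm , sub) {p} {q} h =
      linear 3 (λ f g r → (f ⊕ con 0 ≈ r ⊕ (g ⊕ con 0) ∷ r ≈ con 2 ∷ []) ⊢ f ≈ con 2 ⊕ g)
        (count₂ F ∷ count₂ (removeEdge F p q) ∷ count₂ (pair p q) ∷ [])
        (counts₂-≡ (F ∷ []) (pair p q ∷ removeEdge F p q ∷ []) λ i j → split (F i j) (pair p q i j) (inside i j))
        (count₂-pair (~⇒≢ (sub p q h)))
      where
      inside : ∀ i j → pair p q i j ≡ true → F i j ≡ true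
      inside i j e with i ≟ᶠ p | j ≟ᶠ q | i ≟ᶠ q | j ≟ᶠ p
      ... | yes refl | yes refl | _        | _        = h
      ... | yes _    | no _     | yes refl | yes refl = trans (symm q p) h
      ... | no _     | _        | yes refl | yes refl = trans (symm q p) h
      split : ∀ a b → (b ≡ true → a ≡ true) → total (a ∷ []) ≡ total (b ∷ (a ∧ not b) ∷ [])
      split true  true  _ = refl
      split true  false _ = refl
      split false true  k = case k refl of λ ()
      split false false _ = refl

  opaque
    unfolding e

    e-total : e full full + 2 ≡ 4 * n
    e-total = linear 3 (λ c k n → (c ≈ 2 ⊛ k ∷ k ⊕ con 1 ≈ 2 ⊛ n ∷ []) ⊢ c ⊕ con 2 ≈ 4 ⊛ n)
      (count₂ (adj G) ∷ edgeCount (adj G) ∷ n ∷ [])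
      (doubled (proj₁ simple , λ i j → id)) (proj₁ (proj₂ circuit))

    -- Carries the bound on edge sets over to nonempty proper vertex sets: the edges induced by `X`
    -- are incident with vertices of `X` only, and an edgeless `X` satisfies the bound trivially.
    sparse : ∀ {X w u} → w ∈ X → u ∉ X → e X X + 4 ≤ 4 * ∣ X ∣
    sparse {X} {w} {u} w∈X u∉X = cases (1 ≤? edgeCount F) (suc (edgeCount F) ≤? edgeCount (adj G))
      where
      F : EdgeSet n
      F = between X X
      F-subset : IsEdgeSubset G F
      F-subset = (λ i j → trans (cong (λ a → X i ∧ (X j ∧ a)) (proj₁ simple i j)) (swap (X i) (X j) _))
               , λ i j p → proj₂ (proj₂ (∈-between {X} {X} p))
        where
        swap : ∀ a b c → a ∧ (b ∧ c) ≡ b ∧ (a ∧ c)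
        swap = toWitness {a? = allBool? λ a → allBool? λ b → allBool? λ c → _ ≟ᵇ _} tt
      F-bound : Bound F
      F-bound = proj₂ (proj₂ circuit) F F-subset
      F-incident : ∣ incident F ∣ ≤ ∣ X ∣
      F-incident = incident-⊆ {F} (proj₁ ∘ ∈-between {X} {X})
      missing : suc ∣ X ∣ ≤ n
      missing = subst (_≤ n) (insert u∉X) (∣∣≤n (X ∪ ⁅ u ⁆))
      cases : Dec (1 ≤ edgeCount F) → Dec (edgeCount F < edgeCount (adj G)) → e X X + 4 ≤ 4 * ∣ X ∣
      cases (no none) _ = linear 3 (λ c k x → (c ≈ 2 ⊛ k ∷ k ≼ con 0 ∷ con 1 ≼ x ∷ []) ⊢ c ⊕ con 4 ≼ 4 ⊛ x)
        (e X X ∷ edgeCount F ∷ ∣ X ∣ ∷ []) (doubled F-subset) (≤-pred (≰⇒> none)) (count≥1 w∈X)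
      cases (yes pos) (yes fewer) =
        linear 4 (λ c k i x → (c ≈ 2 ⊛ k ∷ k ⊕ con 2 ≼ 2 ⊛ i ∷ i ≼ x ∷ []) ⊢ c ⊕ con 4 ≼ 4 ⊛ x)
          (e X X ∷ edgeCount F ∷ ∣ incident F ∣ ∷ ∣ X ∣ ∷ []) (doubled F-subset) (F-bound pos fewer) F-incident
      -- If all edges lay inside `X`, dropping one of them would leave 2n - 2 edges on at most n - 1
      -- vertices, against the bound 2(n - 1) - 2.
      cases (yes pos) (no all) with count₂-find F (subst (1 ≤_) (sym (doubled F-subset)) (≤-trans pos (m≤m+n _ _)))
      ... | p , q , pq = absurd
        (linear 5 (λ k′ E i x n → (k′ ⊕ con 2 ≼ 2 ⊛ i ∷ i ≼ x ∷ con 1 ⊕ x ≼ n ∷ E ≼ con 1 ⊕ k′ ∷ E ⊕ con 1 ≈ 2 ⊛ n ∷ [])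
            ⊢ con 1 ≼ con 0)
          (edgeCount F′ ∷ edgeCount (adj G) ∷ ∣ incident F′ ∣ ∷ ∣ X ∣ ∷ n ∷ [])
          (proj₂ (proj₂ circuit) F′ F′-subset several fewer)
          (incident-⊆ {F′} (proj₁ ∘ ∈-between {X} {X} ∘ F′⇒F)) missing
          (subst (edgeCount (adj G) ≤_) removed (≮⇒≥ all)) (proj₁ (proj₂ circuit)))
        where
        F′ : EdgeSet n
        F′ = removeEdge F p q
        F′⇒F : ∀ {i j} → F′ i j ≡ true → F i j ≡ true
        F′⇒F {i} {j} h with F i j
        ... | true = refl
        F′-subset : IsEdgeSubset G F′
        F′-subset = (λ i j → cong₂ (λ a b → a ∧ not b) (proj₁ F-subset i j) (pair-sym p q i j))
                  , λ i j h → proj₂ F-subset i j (F′⇒F h)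
        removed : edgeCount F ≡ suc (edgeCount F′)
        removed = linear 4 (λ k k′ c c′ → (c ≈ 2 ⊛ k ∷ c′ ≈ 2 ⊛ k′ ∷ c ≈ con 2 ⊕ c′ ∷ []) ⊢ k ≈ con 1 ⊕ k′)
          (edgeCount F ∷ edgeCount F′ ∷ count₂ F ∷ count₂ F′ ∷ [])
          (doubled F-subset) (doubled F′-subset) (count₂-removeEdge F-subset {p} {q} pq)
        several : 1 ≤ edgeCount F′
        several = linear 4 (λ k′ E x n → (E ≼ con 1 ⊕ k′ ∷ E ⊕ con 1 ≈ 2 ⊛ n ∷ con 1 ⊕ x ≼ n ∷ con 1 ≼ x ∷ []) ⊢ con 1 ≼ k′)
          (edgeCount F′ ∷ edgeCount (adj G) ∷ ∣ X ∣ ∷ n ∷ [])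
          (subst (edgeCount (adj G) ≤_) removed (≮⇒≥ all)) (proj₁ (proj₂ circuit)) missing (count≥1 w∈X)
        fewer : edgeCount F′ < edgeCount (adj G)
        fewer = linear 5 (λ k k′ c E a → (k ≈ con 1 ⊕ k′ ∷ c ≈ 2 ⊛ k ∷ c ≼ a ∷ a ≈ 2 ⊛ E ∷ []) ⊢ con 1 ⊕ k′ ≼ E)
          (edgeCount F ∷ edgeCount F′ ∷ count₂ F ∷ edgeCount (adj G) ∷ count₂ (adj G) ∷ [])
          removed (doubled F-subset) (count₂-mono {R = F} (λ i j → proj₂ F-subset i j)) (doubled (proj₁ simple , λ i j → id))

  -- A simple graph has at most n(n - 1)/2 edges, which is less than 2n - 1 for n from 1 to 4.
  n≥5 : 5 ≤ n
  n≥5 = bound n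
    (linear 2 (λ t m → (t ⊕ con 2 ≈ 4 ⊛ m ∷ []) ⊢ con 1 ≼ m) (e full full ∷ n ∷ []) e-total)
    (linear 3 (λ t m q → (t ⊕ con 2 ≈ 4 ⊛ m ∷ t ⊕ m ≼ q ∷ []) ⊢ 5 ⊛ m ≼ q ⊕ con 2) (e full full ∷ n ∷ n * n ∷ [])
      e-total (subst (λ k → e full full + k ≤ k * k) (∣full∣ n) (e≤complete full)))
    where
    bound : ∀ k → 1 ≤ k → 5 * k ≤ k * k + 2 → 5 ≤ k
    bound 1 _ h = case ≤⇒≤ᵇ h of λ ()
    bound 2 _ h = case ≤⇒≤ᵇ h of λ ()
    bound 3 _ h = case ≤⇒≤ᵇ h of λ ()
    bound 4 _ h = case ≤⇒≤ᵇ h of λ ()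
    bound (suc (suc (suc (suc (suc k))))) _ _ = s≤s (s≤s (s≤s (s≤s (s≤s z≤n))))

  another : ∀ (v : Fin n) → ∃ λ w → v ≢ w
  another v = let (w , _ , h) = findOther full v (≤-trans (s≤s (s≤s z≤n)) (subst (5 ≤_) (sym (∣full∣ n)) n≥5)) in w , h

  -- Of the 2n - 1 edges, at most 2(n - 1) - 2 survive the deletion of `v`.
  degree≥3 : ∀ v → 3 ≤ degree G v
  degree≥3 v = let (w , v≢w) = another v in
    linear 9 (λ t a d c s p f m d′ → (t ⊕ con 2 ≈ 4 ⊛ m ∷ t ≈ a ⊕ c ⊕ 2 ⊛ d ∷ a ≈ con 0 ∷ c ⊕ con 4 ≼ 4 ⊛ p ∷
        s ⊕ p ≈ m ∷ s ≈ con 1 ∷ f ≈ a ⊕ d ∷ f ≈ d′ ∷ []) ⊢ con 3 ≼ d′)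
      (e full full ∷ e ⁅ v ⁆ ⁅ v ⁆ ∷ e ⁅ v ⁆ (∁ ⁅ v ⁆) ∷ e (∁ ⁅ v ⁆) (∁ ⁅ v ⁆) ∷ ∣ ⁅ v ⁆ ∣ ∷ ∣ ∁ ⁅ v ⁆ ∣ ∷
        e ⁅ v ⁆ full ∷ n ∷ degree G v ∷ [])
      e-total (e-complement ⁅ v ⁆) (e-⁅⁆⁅⁆ v) (sparse (∁-∈ (∉-⁅⁆ v≢w)) (∁-∉ (⁅⁆-refl v)))
      (∣∁∣ ⁅ v ⁆) (∣⁅⁆∣ v) (e-∁ʳ ⁅ v ⁆) (e-degree v)

  Tight : VSet n → Set
  Tight X = e X X + 4 ≡ 4 * ∣ X ∣

  Tight? : ∀ X → Dec (Tight X)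
  Tight? X = _ ≟ⁿ _

  opaque
    unfolding e

    Tight-ext : Extensional Tight
    Tight-ext {X} {Y} h t = trans (cong (_+ 4) (count₂-cong λ i j →
      sym (cong₂ (λ a b → a ∧ (b ∧ adj G i j)) (h i) (h j)))) (trans t (cong (4 *_) (countB-cong h)))

  tight-singleton : ∀ v → Tight ⁅ v ⁆
  tight-singleton v = linear 2 (λ a s → (a ≈ con 0 ∷ s ≈ con 1 ∷ []) ⊢ a ⊕ con 4 ≈ 4 ⊛ s)
    (e ⁅ v ⁆ ⁅ v ⁆ ∷ ∣ ⁅ v ⁆ ∣ ∷ []) (e-⁅⁆⁅⁆ v) (∣⁅⁆∣ v)

  tight-nonempty : ∀ {X} → Tight X → ∃ (_∈ X)
  tight-nonempty {X} t = find X (linear 2 (λ a s → (a ⊕ con 4 ≈ 4 ⊛ s ∷ []) ⊢ con 1 ≼ s) (e X X ∷ ∣ X ∣ ∷ []) t)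

  full-e : ∀ {X} → (∀ {i} → i ∈ X) → e X X ≡ e full full × ∣ X ∣ ≡ n
  full-e h = ≤-antisym (e-mono (λ _ → ∈-full) (λ _ → ∈-full)) (e-mono (λ _ → h) (λ _ → h)) , all⇒∣∣≡n h

  -- The whole graph has one edge more than a tight set of that size.
  tight-proper : ∀ {X} → Tight X → ∃ (_∉ X)
  tight-proper {X} t with full-or-missing X
  ... | inj₂ missing = missing
  ... | inj₁ all = absurd (linear 4
    (λ a s b m → (a ⊕ con 4 ≈ 4 ⊛ s ∷ a ≈ b ∷ s ≈ m ∷ b ⊕ con 2 ≈ 4 ⊛ m ∷ []) ⊢ con 1 ≼ con 0)
    (e X X ∷ ∣ X ∣ ∷ e full full ∷ n ∷ []) t (proj₁ (full-e all)) (proj₂ (full-e all)) e-total)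

  -- Two vertices would have to span two edges, and three vertices four.
  tight-size : ∀ {X} → Tight X → 2 ≤ ∣ X ∣ → 4 ≤ ∣ X ∣
  tight-size {X} t h = go ∣ X ∣ h t (e≤complete X)
    where
    go : ∀ k → 2 ≤ k → e X X + 4 ≡ 4 * k → e X X + k ≤ k * k → 4 ≤ k
    go 1 (s≤s ())
    go 2 _ t c = absurd (linear 1 (λ x → (x ⊕ con 4 ≈ con 8 ∷ x ⊕ con 2 ≼ con 4 ∷ []) ⊢ con 1 ≼ con 0)
      (e X X ∷ []) t c)
    go 3 _ t c = absurd (linear 1 (λ x → (x ⊕ con 4 ≈ con 12 ∷ x ⊕ con 3 ≼ con 9 ∷ []) ⊢ con 1 ≼ con 0)
      (e X X ∷ []) t c)
    go (suc (suc (suc (suc k)))) _ _ _ = s≤s (s≤s (s≤s (s≤s z≤n)))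

  -- The vertices `w` and `u` make union and intersection nonempty and proper, so `sparse` applies
  -- to both. By `e-uncross`, their two slacks and twice the number of crossing edges sum to zero.
  uncross : ∀ {X Y w u} → Tight X → Tight Y → w ∈ X → w ∈ Y → u ∉ X → u ∉ Y →
            Tight (X ∪ Y) × Tight (X ∩ Y) × e (X ∖ Y) (Y ∖ X) ≡ 0
  uncross {X} {Y} tX tY p q r s =
      linear 9 (λ a i x y d u′ i′ x′ y′ → hyps a i x y d u′ i′ x′ y′ ⊢ a ⊕ con 4 ≈ 4 ⊛ u′) ρ h₁ h₂ tX tY h₃ h₄
    , linear 9 (λ a i x y d u′ i′ x′ y′ → hyps a i x y d u′ i′ x′ y′ ⊢ i ⊕ con 4 ≈ 4 ⊛ i′) ρ h₁ h₂ tX tY h₃ h₄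
    , linear 9 (λ a i x y d u′ i′ x′ y′ → hyps a i x y d u′ i′ x′ y′ ⊢ d ≈ con 0) ρ h₁ h₂ tX tY h₃ h₄
    where
    hyps : (a i x y d u′ i′ x′ y′ : Lin 9) → List (Rel 9)
    hyps a i x y d u′ i′ x′ y′ =
      a ⊕ i ≈ x ⊕ y ⊕ 2 ⊛ d ∷ u′ ⊕ i′ ≈ x′ ⊕ y′ ∷ x ⊕ con 4 ≈ 4 ⊛ x′ ∷ y ⊕ con 4 ≈ 4 ⊛ y′ ∷
      a ⊕ con 4 ≼ 4 ⊛ u′ ∷ i ⊕ con 4 ≼ 4 ⊛ i′ ∷ []
    ρ : Vec ℕ 9
    ρ = e (X ∪ Y) (X ∪ Y) ∷ e (X ∩ Y) (X ∩ Y) ∷ e X X ∷ e Y Y ∷ e (X ∖ Y) (Y ∖ X) ∷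
        ∣ X ∪ Y ∣ ∷ ∣ X ∩ Y ∣ ∷ ∣ X ∣ ∷ ∣ Y ∣ ∷ []
    h₁ = e-uncross X Y
    h₂ = ∣∪∣+∣∩∣ X Y
    h₃ = sparse {X ∪ Y} (∪-∈ˡ p) (∪-∉ r s)
    h₄ = sparse {X ∩ Y} (∩-∈ p q) (∩-∉ˡ r)

  tight-insert : ∀ {X v} → Tight X → v ∉ X → ∣ X ∩ N v ∣ ≡ 2 → Tight (X ∪ ⁅ v ⁆)
  tight-insert {X} {v} t p h = linear 5
    (λ a x d s s′ → (a ≈ x ⊕ 2 ⊛ d ∷ s′ ≈ con 1 ⊕ s ∷ x ⊕ con 4 ≈ 4 ⊛ s ∷ d ≈ con 2 ∷ []) ⊢ a ⊕ con 4 ≈ 4 ⊛ s′)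
    (e (X ∪ ⁅ v ⁆) (X ∪ ⁅ v ⁆) ∷ e X X ∷ ∣ X ∩ N v ∣ ∷ ∣ X ∣ ∷ ∣ X ∪ ⁅ v ⁆ ∣ ∷ [])
    (e-insert p) (insert p) t h

  -- One more vertex leaves room for only two more edges, as long as the enlarged set is proper.
  insert-full : ∀ {X v} → Tight X → v ∉ X → 3 ≤ ∣ X ∩ N v ∣ → ∀ {w} → w ∈ X ∪ ⁅ v ⁆
  insert-full {X} {v} t p h with full-or-missing (X ∪ ⁅ v ⁆)
  ... | inj₁ all = all
  ... | inj₂ (u , q) = absurd (linear 5
    (λ a x d s s′ → (a ≈ x ⊕ 2 ⊛ d ∷ s′ ≈ con 1 ⊕ s ∷ x ⊕ con 4 ≈ 4 ⊛ s ∷ con 3 ≼ d ∷ a ⊕ con 4 ≼ 4 ⊛ s′ ∷ []) ⊢ con 1 ≼ con 0)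
    (e (X ∪ ⁅ v ⁆) (X ∪ ⁅ v ⁆) ∷ e X X ∷ ∣ X ∩ N v ∣ ∷ ∣ X ∣ ∷ ∣ X ∪ ⁅ v ⁆ ∣ ∷ [])
    (e-insert p) (insert p) t h (sparse (∪-∈ʳ (⁅⁆-refl v)) q))

  -- A tight set on n - 1 vertices has 2n - 4 of the 2n - 1 edges, so three are left for `v`.
  last-vertex : ∀ {X v} → Tight X → v ∉ X → (∀ {w} → w ∈ X ∪ ⁅ v ⁆) → IsNode G v × ∣ X ∩ N v ∣ ≡ 3
  last-vertex {X} {v} t p all =
    trans (≤-antisym (countB-mono {P = N v} inside) (countB-mono {P = X ∩ N v} (proj₂ ∘ ∈-∩))) three , three
    where
    three : ∣ X ∩ N v ∣ ≡ 3
    three = linear 7 (λ a x d s s′ f m → (a ≈ x ⊕ 2 ⊛ d ∷ s′ ≈ con 1 ⊕ s ∷ x ⊕ con 4 ≈ 4 ⊛ s ∷ a ≈ f ∷ s′ ≈ m ∷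
        f ⊕ con 2 ≈ 4 ⊛ m ∷ []) ⊢ d ≈ con 3)
      (e (X ∪ ⁅ v ⁆) (X ∪ ⁅ v ⁆) ∷ e X X ∷ ∣ X ∩ N v ∣ ∷ ∣ X ∣ ∷ ∣ X ∪ ⁅ v ⁆ ∣ ∷ e full full ∷ n ∷ [])
      (e-insert p) (insert p) t (proj₁ (full-e all)) (proj₂ (full-e all)) e-total
    inside : N v ⊆ X ∩ N v
    inside q = case ∈-∪ all of λ
      { (inj₁ r) → ∩-∈ r q ; (inj₂ r) → ⊥-elim (~-irrefl (subst (v ~_) (sym (∈-⁅⁆ r)) (∈⁻ q))) }

-- Consequences of the absence of nontrivial separations.

module Separated {n : ℕ} (G : Graph n) (circuit : IsCircuit G)
  (no2 : ¬ HasNontrivial2VertexSep G) (no3 : ¬ HasNontrivial3EdgeSep G) where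

  open Circuit G circuit public

  private
    cutSet : VSet n → EdgeSet n
    cutSet X i j = between X (∁ X) i j ∨ between (∁ X) X i j

  opaque
    unfolding _∪_

    no-2-vertex-separation : ∀ {V₁ V₂ a b u w} →
      (∀ i → i ∈ V₁ ⊎ i ∈ V₂) →
      (∀ {i j} → i ~ j → (i ∈ V₁ × j ∈ V₁) ⊎ (i ∈ V₂ × j ∈ V₂)) →
      a ∈ V₁ ∩ V₂ → b ∈ V₁ ∩ V₂ → a ≢ b → (∀ {i} → i ∈ V₁ → i ∈ V₂ → a ≡ i ⊎ b ≡ i) →
      u ∈ V₁ → u ∉ V₂ → w ∈ V₂ → w ∉ V₁ →
      ¬ InducesK4 G V₁ → ¬ InducesK4 G V₂ → ⊥
    no-2-vertex-separation {V₁} {V₂} cover edges a b a≢b only p q r s k₁ k₂ =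
      no2 (V₁ , V₂ , ((λ v → case cover v of λ { (inj₁ (∈⁺ h)) → cong (_∨ V₂ v) h
                                                ; (inj₂ (∈⁺ h)) → trans (cong (V₁ v ∨_) h) (∨-zeroʳ (V₁ v)) })
        , (λ i j h → case edges h of λ { (inj₁ (∈⁺ x , ∈⁺ y)) → inj₁ (cong₂ _∧_ x y)
                                        ; (inj₂ (∈⁺ x , ∈⁺ y)) → inj₂ (cong₂ _∧_ x y) })
        , count≡2 a b a≢b (λ h → let (x , y) = ∈-∩ h in only x y)
        , (_ , ∈⁻ (∖-∈ p q)) , (_ , ∈⁻ (∖-∈ r s))) , k₁ , k₂)

    -- If no two of the three leaving edges met, `X` and `∁ X` would form a nontrivial
    -- 3-edge-separation. The alternatives record on which side the shared end `i` lies.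
    no-3-edge-separation : ∀ {X u w} → u ∈ X → w ∉ X → e X (∁ X) ≡ 3 →
      ∃₂ λ i j → ∃ λ k → i ~ j × i ~ k × j ≢ k ×
        ((i ∈ X × j ∉ X × k ∉ X) ⊎ (i ∉ X × j ∈ X × k ∈ X))
    no-3-edge-separation {X} {u} {w} u∈X w∉X three
      with Fin.any? (λ i → Fin.any? (λ j → Fin.any? (λ k →
             (cutSet X i j ≟ᵇ true) ×-dec ((cutSet X i k ≟ᵇ true) ×-dec ¬? (j ≟ᶠ k)))))
    ... | yes (i , j , k , p , q , j≢k) = i , j , k , edge p , edge q , j≢k , sides
      where
      crossing : ∀ {i j} → cutSet X i j ≡ true →
                 i ~ j × ((i ∈ X × j ∉ X) ⊎ (i ∉ X × j ∈ X))
      crossing {i} {j} h = case ∈-∪ {X = between X (∁ X) i} {between (∁ X) X i} {j} (∈⁺ h) of λ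
        { (inj₁ (∈⁺ l)) → let (x , y , z) = ∈-between {X} {∁ X} l in z , inj₁ (x , ∈-∁ y)
        ; (inj₂ (∈⁺ l)) → let (x , y , z) = ∈-between {∁ X} {X} l in z , inj₂ (∈-∁ x , y) }
      edge : ∀ {j} → cutSet X i j ≡ true → i ~ j
      edge h = proj₁ (crossing h)
      sides : (i ∈ X × j ∉ X × k ∉ X) ⊎ (i ∉ X × j ∈ X × k ∈ X)
      sides with proj₂ (crossing p) | proj₂ (crossing q)
      ... | inj₁ (a , b) | inj₁ (_ , c) = inj₁ (a , b , c)
      ... | inj₂ (a , b) | inj₂ (_ , c) = inj₂ (a , b , c)
      ... | inj₁ (a , _) | inj₂ (b , _) = ⊥-elim (∈-∉ a b)
      ... | inj₂ (a , _) | inj₁ (b , _) = ⊥-elim (∈-∉ b a)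
    ... | no disjoint = ⊥-elim (no3 (X , ∁ X , S
        , ( (u , ∈⁻ u∈X) , (w , ∈⁻ (∁-∈ w∉X))
          , (λ v → contradictory (X v)) , (λ v → exhaustive (X v))
          , S-subset , S-count
          , λ i j h → (λ s → inside (X i) (X j) (adj G i j) h s) , outside (X i) (X j) (adj G i j) )
        , nonadjacent))
      where
      S : EdgeSet n
      S = cutSet X
      contradictory : ∀ a → a ∧ not a ≡ false
      contradictory = toWitness {a? = allBool? λ a → _ ≟ᵇ _} tt
      exhaustive : ∀ a → a ∨ not a ≡ true
      exhaustive = toWitness {a? = allBool? λ a → _ ≟ᵇ _} tt
      S-subset : IsEdgeSubset G S
      S-subset = (λ i j → trans (symm (X i) (X j) (adj G i j))
                     (cong (λ a → (X j ∧ (not (X i) ∧ a)) ∨ (not (X j) ∧ (X i ∧ a))) (proj₁ simple i j)))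
               , λ i j → sub (X i) (X j) (adj G i j)
        where
        symm : ∀ x y a → (x ∧ (not y ∧ a)) ∨ (not x ∧ (y ∧ a)) ≡ (y ∧ (not x ∧ a)) ∨ (not y ∧ (x ∧ a))
        symm = toWitness {a? = allBool? λ a → allBool? λ b → allBool? λ c → _ ≟ᵇ _} tt
        sub : ∀ x y a → (x ∧ (not y ∧ a)) ∨ (not x ∧ (y ∧ a)) ≡ true → a ≡ true
        sub = toWitness {a? = allBool? λ a → allBool? λ b → allBool? λ c → (_ ≟ᵇ _) →-dec (_ ≟ᵇ _)} tt
      S-count : edgeCount S ≡ 3
      S-count = linear 4 (λ s c d k → (s ⊕ con 0 ≈ c ⊕ (d ⊕ con 0) ∷ c ≈ d ∷ c ≈ con 3 ∷ s ≈ 2 ⊛ k ∷ []) ⊢ k ≈ con 3)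
        (count₂ S ∷ e X (∁ X) ∷ e (∁ X) X ∷ edgeCount S ∷ []) parts (e-sym X (∁ X)) three
        (count₂≡2*edgeCount S (proj₁ S-subset) irreflexive)
        where
        opaque
          unfolding e
          parts : counts₂ (S ∷ []) ≡ e X (∁ X) + (e (∁ X) X + 0)
          parts = counts₂-≡ (S ∷ []) (between X (∁ X) ∷ between (∁ X) X ∷ []) λ i j → pointwise (X i) (X j) (adj G i j)
            where
            pointwise : ∀ x y a → total (((x ∧ (not y ∧ a)) ∨ (not x ∧ (y ∧ a))) ∷ []) ≡
                        total ((x ∧ (not y ∧ a)) ∷ (not x ∧ (y ∧ a)) ∷ [])
            pointwise = toWitness {a? = allBool? λ a → allBool? λ b → allBool? λ c → _ ≟ⁿ _} tt
        irreflexive : ∀ i → S i i ≡ false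
        irreflexive i = diagonal (X i) (adj G i i)
          where
          diagonal : ∀ x a → (x ∧ (not x ∧ a)) ∨ (not x ∧ (x ∧ a)) ≡ false
          diagonal = toWitness {a? = allBool? λ a → allBool? λ b → _ ≟ᵇ _} tt
      inside : ∀ x y a → a ≡ true → (x ∧ (not y ∧ a)) ∨ (not x ∧ (y ∧ a)) ≡ false →
               (x ∧ y ≡ true) ⊎ (not x ∧ not y ≡ true)
      inside true  true  _ _    _  = inj₁ refl
      inside false false _ _    _  = inj₂ refl
      inside true  false _ refl ()
      inside false true  _ refl ()
      outside : ∀ x y a → (x ∧ y ≡ true) ⊎ (not x ∧ not y ≡ true) →
                (x ∧ (not y ∧ a)) ∨ (not x ∧ (y ∧ a)) ≡ false
      outside true  true  a _ = refl
      outside false false a _ = refl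
      outside true  false a (inj₁ ())
      outside true  false a (inj₂ ())
      outside false true  a (inj₁ ())
      outside false true  a (inj₂ ())
      nonadjacent : PairwiseNonAdjacent S
      nonadjacent i j k p q with j ≟ᶠ k
      ... | yes r = r
      ... | no  r = ⊥-elim (disjoint (i , j , k , p , q , r))

  ¬K4-size : ∀ {X} → 5 ≤ ∣ X ∣ → ¬ InducesK4 G X
  ¬K4-size h (four , _) = case subst (5 ≤_) four h of λ { (s≤s (s≤s (s≤s (s≤s ())))) }

  ¬K4-nonadjacent : ∀ {X i j} → i ∈ X → j ∈ X → i ≢ j → ¬ i ~ j → ¬ InducesK4 G X
  ¬K4-nonadjacent (∈⁺ p) (∈⁺ q) r s (_ , clique) = s (clique _ _ p q r)

  e-split : ∀ {X i} Y → i ∈ X → e X Y ≡ ∣ Y ∩ N i ∣ + e (X ∖ ⁅ i ⁆) Y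
  e-split {X} {i} Y p = begin
    e X Y                             ≡⟨ ≤-antisym (e-mono there id) (e-mono back id) ⟩
    e (⁅ i ⁆ ∪ (X ∖ ⁅ i ⁆)) Y         ≡⟨ e-∪ˡ-disjoint Y (λ q r → ∈-∉ q (proj₂ (∈-∖ r))) ⟩
    e ⁅ i ⁆ Y + e (X ∖ ⁅ i ⁆) Y       ≡⟨ cong (_+ e (X ∖ ⁅ i ⁆) Y) (e-singleton i Y) ⟩
    ∣ Y ∩ N i ∣ + e (X ∖ ⁅ i ⁆) Y     ∎
    where
    open ≡-Reasoning
    there : X ⊆ ⁅ i ⁆ ∪ (X ∖ ⁅ i ⁆)
    there {j} q with j ∈? ⁅ i ⁆
    ... | inj₁ r = ∪-∈ˡ r
    ... | inj₂ r = ∪-∈ʳ (∖-∈ q r)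
    back : ⁅ i ⁆ ∪ (X ∖ ⁅ i ⁆) ⊆ X
    back q = case ∈-∪ q of λ { (inj₁ r) → subst (_∈ X) (∈-⁅⁆ r) p ; (inj₂ r) → proj₁ (∈-∖ r) }

  -- If two of three edges between X and Y meet at i ∈ X, and the third one ends at
  -- t ∈ Y, then {i, t} separates X from Y.
  no-adjacent-cut : ∀ {X Y i j k} → Tight X → Tight Y → Disjoint X Y → (∀ v → v ∈ X ⊎ v ∈ Y) →
    e X Y ≡ 3 → 2 ≤ ∣ X ∣ → 2 ≤ ∣ Y ∣ → i ∈ X → j ∈ Y → k ∈ Y → i ~ j → i ~ k → j ≢ k → ⊥
  no-adjacent-cut {X} {Y} {i} {j} {k} tX tY disj cover three X≥2 Y≥2 i∈X j∈Y k∈Y i~j i~k j≢k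
    with 3 ≤? ∣ Y ∩ N i ∣
  -- With all three edges at `i`, the set `Y` and `i` would exhaust the graph, but `X` has a second
  -- vertex.
  ... | yes h = let (x , p , i≢x) = findOther X i X≥2 in
    case ∈-∪ (insert-full tY (¬∈⇒∉ (disj i∈X)) h {x}) of λ
      { (inj₁ q) → disj p q ; (inj₂ q) → i≢x (∈-⁅⁆ q) }
  ... | no h = separate (e-find (X ∖ ⁅ i ⁆) Y (≤-reflexive (sym one)))
    where
    one : e (X ∖ ⁅ i ⁆) Y ≡ 1
    one = linear 3 (λ t d r → (t ≈ con 3 ∷ t ≈ d ⊕ r ∷ con 2 ≼ d ∷ con 1 ⊕ d ≼ con 3 ∷ []) ⊢ r ≈ con 1)
      (e X Y ∷ ∣ Y ∩ N i ∣ ∷ e (X ∖ ⁅ i ⁆) Y ∷ [])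
      three (e-split Y i∈X) (count≥2 (∩-∈ j∈Y (∈⁺ i~j)) (∩-∈ k∈Y (∈⁺ i~k)) j≢k) (≰⇒> h)
    -- A side consists of a tight set, of at least four vertices by `tight-size`, and one end of the
    -- third edge; five vertices are too many for a K₄.
    large : ∀ {Z v} → Tight Z → 2 ≤ ∣ Z ∣ → v ∉ Z → 5 ≤ ∣ Z ∪ ⁅ v ⁆ ∣
    large t s p = subst (5 ≤_) (sym (insert p)) (s≤s (tight-size t s))
    i∉Y : i ∉ Y
    i∉Y = ¬∈⇒∉ (disj i∈X)
    separate : (∃₂ λ s t → s ∈ X ∖ ⁅ i ⁆ × t ∈ Y × s ~ t) → ⊥
    separate (s , t , s∈ , t∈Y , s~t) = no-2-vertex-separation {X ∪ ⁅ t ⁆} {Y ∪ ⁅ i ⁆} {i} {t} {s} {proj₁ other}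
      (λ v → case cover v of λ { (inj₁ p) → inj₁ (∪-∈ˡ p) ; (inj₂ p) → inj₂ (∪-∈ˡ p) })
      edges (∩-∈ (∪-∈ˡ i∈X) (∪-∈ʳ (⁅⁆-refl i))) (∩-∈ (∪-∈ʳ (⁅⁆-refl t)) (∪-∈ˡ t∈Y))
      (λ { refl → disj i∈X t∈Y })
      (λ p q → case ∈-∪ p of λ
        { (inj₂ r) → inj₂ (∈-⁅⁆ r)
        ; (inj₁ r) → case ∈-∪ q of λ { (inj₁ r′) → ⊥-elim (disj r r′) ; (inj₂ r′) → inj₁ (∈-⁅⁆ r′) } })
      (∪-∈ˡ s∈X) (∪-∉ (¬∈⇒∉ (disj s∈X)) (proj₂ (∈-∖ s∈)))
      (∪-∈ˡ (proj₁ (proj₂ other))) (∪-∉ (¬∈⇒∉ λ p → disj p (proj₁ (proj₂ other))) (∉-⁅⁆ (proj₂ (proj₂ other))))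
      (¬K4-size (large tX X≥2 t∉X)) (¬K4-size (large tY Y≥2 i∉Y))
      where
      s∈X = proj₁ (∈-∖ s∈)
      t∉X : t ∉ X
      t∉X = ¬∈⇒∉ λ p → disj p t∈Y
      other = findOther Y t Y≥2
      crossing : ∀ {u v} → u ∈ X → v ∈ Y → u ~ v → (u ∈ Y ∪ ⁅ i ⁆ × v ∈ Y ∪ ⁅ i ⁆) ⊎ (u ∈ X ∪ ⁅ t ⁆ × v ∈ X ∪ ⁅ t ⁆)
      crossing {u} {v} p q r with u ∈? ⁅ i ⁆
      ... | inj₁ u=i = inj₁ (∪-∈ʳ u=i , ∪-∈ˡ q)
      ... | inj₂ u≠i = inj₂ (∪-∈ˡ p ,
        ∪-∈ʳ (subst (_∈ ⁅ t ⁆) (proj₂ (e≡1⇒≡ one s∈ t∈Y s~t (∖-∈ p u≠i) q r)) (⁅⁆-refl t)))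
      edges : ∀ {u v} → u ~ v → (u ∈ X ∪ ⁅ t ⁆ × v ∈ X ∪ ⁅ t ⁆) ⊎ (u ∈ Y ∪ ⁅ i ⁆ × v ∈ Y ∪ ⁅ i ⁆)
      edges {u} {v} r with cover u | cover v
      ... | inj₁ p | inj₁ q = inj₁ (∪-∈ˡ p , ∪-∈ˡ q)
      ... | inj₂ p | inj₂ q = inj₂ (∪-∈ˡ p , ∪-∈ˡ q)
      ... | inj₁ p | inj₂ q = case crossing p q r of λ { (inj₁ h) → inj₂ h ; (inj₂ h) → inj₁ h }
      ... | inj₂ p | inj₁ q = case crossing q p (~-sym r) of λ
        { (inj₁ (h , h′)) → inj₂ (h′ , h) ; (inj₂ (h , h′)) → inj₁ (h′ , h) }

  -- Sparsity of `∁ X` already gives three leaving edges. Exactly three would make `∁ X` tight too,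
  -- two of them would share an end, and `no-adjacent-cut` applies, from whichever side that end
  -- lies on.
  cut≥4 : ∀ {X} → Tight X → 2 ≤ ∣ X ∣ → 2 ≤ ∣ ∁ X ∣ → 4 ≤ e X (∁ X)
  cut≥4 {X} t X≥2 ∁≥2 = case 4 ≤? e X (∁ X) of λ
    { (yes h) → h
    ; (no h)  → ⊥-elim (small (≤-antisym (≤-pred (≰⇒> h)) cut≥3)) }
    where
    inX = find X (≤-trans (s≤s z≤n) X≥2)
    in∁ = find (∁ X) (≤-trans (s≤s z≤n) ∁≥2)
    ρ : Vec ℕ 7
    ρ = e full full ∷ e X X ∷ e (∁ X) (∁ X) ∷ e X (∁ X) ∷ ∣ X ∣ ∷ ∣ ∁ X ∣ ∷ n ∷ []
    cut≥3 : 3 ≤ e X (∁ X)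
    cut≥3 = linear 7 (λ f x y c s s′ m → (f ⊕ con 2 ≈ 4 ⊛ m ∷ f ≈ x ⊕ y ⊕ 2 ⊛ c ∷ s ⊕ s′ ≈ m ∷ x ⊕ con 4 ≈ 4 ⊛ s ∷
        y ⊕ con 4 ≼ 4 ⊛ s′ ∷ []) ⊢ con 3 ≼ c) ρ
      e-total (e-complement X) (∣∁∣ X) t (sparse (proj₂ in∁) (∁-∉ (proj₂ inX)))
    small : e X (∁ X) ≡ 3 → ⊥
    small three = case no-3-edge-separation (proj₂ inX) (∈-∁ (proj₂ in∁)) three of λ
      { (i , j , k , i~j , i~k , j≢k , inj₁ (p , q , r)) →
          no-adjacent-cut t ∁-tight (λ a b → ∈-∉ a (∈-∁ b)) cover three X≥2 ∁≥2 p (∁-∈ q) (∁-∈ r) i~j i~k j≢k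
      ; (i , j , k , i~j , i~k , j≢k , inj₂ (p , q , r)) →
          no-adjacent-cut ∁-tight t (λ a b → ∈-∉ b (∈-∁ a)) (λ v → case cover v of λ { (inj₁ a) → inj₂ a ; (inj₂ a) → inj₁ a })
            (trans (e-sym (∁ X) X) three) ∁≥2 X≥2 (∁-∈ p) q r i~j i~k j≢k }
      where
      cover : ∀ v → v ∈ X ⊎ v ∈ ∁ X
      cover v with v ∈? X
      ... | inj₁ p = inj₁ p
      ... | inj₂ p = inj₂ (∁-∈ p)
      ∁-tight : Tight (∁ X)
      ∁-tight = linear 7 (λ f x y c s s′ m → (f ⊕ con 2 ≈ 4 ⊛ m ∷ f ≈ x ⊕ y ⊕ 2 ⊛ c ∷ s ⊕ s′ ≈ m ∷ x ⊕ con 4 ≈ 4 ⊛ s ∷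
          c ≈ con 3 ∷ []) ⊢ y ⊕ con 4 ≈ 4 ⊛ s′) ρ
        e-total (e-complement X) (∣∁∣ X) t three

  -- Nodes and their critical sets

  IsNode? : ∀ v → Dec (IsNode G v)
  IsNode? v = degree G v ≟ⁿ 3

  neighbour : ∀ {v} → IsNode G v → ∃ (v ~_)
  neighbour {v} h = let (p , q) = find (N v) (subst (1 ≤_) (sym h) (s≤s z≤n)) in p , ∈⁻ q

  neighbour₂ : ∀ {v} p → IsNode G v → ∃ λ q → v ~ q × p ≢ q
  neighbour₂ {v} p h = let (q , r , s) = findOther (N v) p (subst (2 ≤_) (sym h) (s≤s (s≤s z≤n))) in q , ∈⁻ r , s

  neighbours-complete : ∀ {v p q r} → IsNode G v → v ~ p → v ~ q → v ~ r → p ≢ q → p ≢ r → q ≢ r →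
                        ∀ {w} → v ~ w → p ≡ w ⊎ q ≡ w ⊎ r ≡ w
  neighbours-complete {v} h a b c d e f g = count≡3⇒ {X = N v} h (∈⁺ a) (∈⁺ b) (∈⁺ c) d e f (∈⁺ g)

  neighbour₃ : ∀ {v p q} → IsNode G v → v ~ p → v ~ q → p ≢ q → ∃ λ r → v ~ r × p ≢ r × q ≢ r
  neighbour₃ {v} {p} {q} h a b p≢q =
    let (r , s) = find (N v ∖ ⁅ p ⁆ ∖ ⁅ q ⁆) (≤-reflexive (sym size))
        (t , r∉q) = ∈-∖ s ; (u , r∉p) = ∈-∖ t
    in r , ∈⁻ u , ∉-⁅⁆⇒≢ r∉p , ∉-⁅⁆⇒≢ r∉q
    where
    size : ∣ N v ∖ ⁅ p ⁆ ∖ ⁅ q ⁆ ∣ ≡ 1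
    size = suc-injective (suc-injective (trans
      (sym (trans (remove {X = N v} {p} (∈⁺ a)) (cong suc (remove {X = N v ∖ ⁅ p ⁆} (∖-∈ (∈⁺ b) (∉-⁅⁆ p≢q)))))) h))

  -- The obstruction to the 1-reduction that joins the two neighbours of `v` other than `r`: the new
  -- edge would be one too many inside `S`, and `r` witnesses that `S` is proper in `G − v`.
  record Critical (v r : Fin n) (S : VSet n) : Set where
    field
      tight : Tight S
      v∉    : v ∉ S
      r∉    : r ∉ S
      rest  : ∀ {w} → v ~ w → r ≢ w → w ∈ S

  Blocked : Fin n → Fin n → Set
  Blocked v r = ∃ (Critical v r)

  Critical? : ∀ v r S → Dec (Critical v r S)
  Critical? v r S = map′
    (λ (a , b , c , d) → record { tight = a ; v∉ = b ; r∉ = c ; rest = λ {w} → d w })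
    (λ k → let open Critical k in tight , v∉ , r∉ , λ w → rest {w})
    (Tight? S ×-dec (∉-dec v S ×-dec (∉-dec r S ×-dec
      Fin.all? (λ w → ~-dec v w →-dec (¬? (r ≟ᶠ w) →-dec ∈-dec w S)))))

  Blocked? : ∀ v r → Dec (Blocked v r)
  Blocked? v r = anyVSet?
    (λ h k → let open Critical k in record
      { tight = Tight-ext h tight ; v∉ = ∉⁺ (trans (sym (h v)) (∉⁻ v∉)) ; r∉ = ∉⁺ (trans (sym (h r)) (∉⁻ r∉))
      ; rest = λ a b → ∈⁺ (trans (sym (h _)) (∈⁻ (rest a b))) })
    (Critical? v r)

  Branching : Fin n → Set
  Branching v = IsNode G v × (∀ {r} → v ~ r → Blocked v r)

  Branching? : ∀ v → Dec (Branching v)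
  Branching? v = IsNode? v ×-dec map′ (λ h {r} → h r) (λ h r → h {r})
    (Fin.all? λ r → ~-dec v r →-dec Blocked? v r)

  -- At such a node there is no 1-reduction at all, because no pair of neighbours is left to be
  -- joined.
  InK4 : Fin n → Set
  InK4 v = IsNode G v × (∀ {p q} → v ~ p → v ~ q → p ≢ q → p ~ q)

  InK4? : ∀ v → Dec (InK4 v)
  InK4? v = IsNode? v ×-dec map′ (λ h {p} {q} → h p q) (λ h p q → h {p} {q})
    (Fin.all? λ p → Fin.all? λ q → ~-dec v p →-dec (~-dec v q →-dec (¬? (p ≟ᶠ q) →-dec ~-dec p q)))

  module _ {v p q S S′} (node : IsNode G v) (v~p : v ~ p) (v~q : v ~ q) (p≢q : p ≢ q)
           (k : Critical v p S) (k′ : Critical v q S′) where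

    private
      module K = Critical k
      module K′ = Critical k′
      third : ∃ λ r → v ~ r × p ≢ r × q ≢ r
      third = neighbour₃ node v~p v~q p≢q
      r∈S : proj₁ third ∈ S
      r∈S = K.rest (proj₁ (proj₂ third)) (proj₁ (proj₂ (proj₂ third)))
      r∈S′ : proj₁ third ∈ S′
      r∈S′ = K′.rest (proj₁ (proj₂ third)) (proj₂ (proj₂ (proj₂ third)))
      uncrossed : Tight (S ∪ S′) × Tight (S ∩ S′) × e (S ∖ S′) (S′ ∖ S) ≡ 0
      uncrossed = uncross K.tight K′.tight r∈S r∈S′ K.v∉ K′.v∉
      q∈S : q ∈ S
      q∈S = K.rest v~q p≢q
      p∈S′ : p ∈ S′
      p∈S′ = K′.rest v~p (p≢q ∘ sym)

    -- Both sets contain the third neighbour and miss `v`, so they uncross; `q` lies only in `S` and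
    -- `p` only in `S′`.
    critical-nonadjacent : ¬ p ~ q
    critical-nonadjacent h =
      e≡0⇒¬~ (proj₂ (proj₂ uncrossed)) (∖-∈ q∈S K′.r∉) (∖-∈ p∈S′ K.r∉) (~-sym h)

    -- The tight union contains all three neighbours of `v`, so `insert-full` leaves no vertex but
    -- `v` outside it.
    critical-cover : ∀ {w} → v ≢ w → w ∈ S ⊎ w ∈ S′
    critical-cover {w} h = case ∈-∪ (insert-full (proj₁ uncrossed) (∪-∉ K.v∉ K′.v∉) three {w}) of λ
      { (inj₁ a) → ∈-∪ a ; (inj₂ b) → ⊥-elim (h (∈-⁅⁆ b)) }
      where
      three : 3 ≤ ∣ (S ∪ S′) ∩ N v ∣
      three = count≥3 (∩-∈ (∪-∈ʳ p∈S′) (∈⁺ v~p)) (∩-∈ (∪-∈ˡ q∈S) (∈⁺ v~q))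
        (∩-∈ (∪-∈ˡ r∈S) (∈⁺ (proj₁ (proj₂ third)))) p≢q (proj₁ (proj₂ (proj₂ third))) (proj₂ (proj₂ (proj₂ third)))

  -- The vertices v and y see only each other and {p, q}, so {p, q} is separating.
  no-critical-two-edges : ∀ {v p q y S} → IsNode G v → v ~ p → v ~ q → v ~ y → p ≢ q → p ≢ y → q ≢ y →
    y ~ p → y ~ q → ¬ p ~ q → Critical v y S → ⊥
  no-critical-two-edges {v} {p} {q} {y} {S} node v~p v~q v~y p≢q p≢y q≢y y~p y~q p≁q k =
    no-2-vertex-separation {V} {S} {p} {q} {v} {proj₁ other} cover edges
      (∩-∈ p∈V p∈S) (∩-∈ q∈V q∈S) p≢q common
      v∈V K.v∉ (proj₁ (proj₂ other)) outside
      (¬K4-nonadjacent p∈V q∈V p≢q p≁q) (¬K4-nonadjacent p∈S q∈S p≢q p≁q)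
    where
    module K = Critical k
    p∈S = K.rest v~p (p≢y ∘ sym)
    q∈S = K.rest v~q (q≢y ∘ sym)
    V = ⁅ v ⁆ ∪ ⁅ y ⁆ ∪ (⁅ p ⁆ ∪ ⁅ q ⁆)
    v∈V : v ∈ V
    v∈V = ∪-∈ˡ (∪-∈ˡ (⁅⁆-refl v))
    y∈V : y ∈ V
    y∈V = ∪-∈ˡ (∪-∈ʳ (⁅⁆-refl y))
    p∈V : p ∈ V
    p∈V = ∪-∈ʳ (∪-∈ˡ (⁅⁆-refl p))
    q∈V : q ∈ V
    q∈V = ∪-∈ʳ (∪-∈ʳ (⁅⁆-refl q))
    v-neighbours : ∀ {w} → v ~ w → p ≡ w ⊎ q ≡ w ⊎ y ≡ w
    v-neighbours = neighbours-complete node v~p v~q v~y p≢q p≢y q≢y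
    -- Exactly two neighbours of `v` lie in `S`. Then `y` has three neighbours in the enlarged set,
    -- so it is the only vertex left, and the edge count makes it a node.
    S₁-tight : Tight (S ∪ ⁅ v ⁆)
    S₁-tight = tight-insert K.tight K.v∉ (count≡2 (∩-∈ p∈S (∈⁺ v~p)) (∩-∈ q∈S (∈⁺ v~q)) p≢q only)
      where
      only : ∀ {w} → w ∈ S ∩ N v → p ≡ w ⊎ q ≡ w
      only h = let (a , b) = ∈-∩ h in case v-neighbours (∈⁻ b) of λ
        { (inj₁ c) → inj₁ c ; (inj₂ (inj₁ c)) → inj₂ c ; (inj₂ (inj₂ refl)) → ⊥-elim (∈-∉ a K.r∉) }
    y∉S₁ : y ∉ S ∪ ⁅ v ⁆
    y∉S₁ = ∪-∉ K.r∉ (∉-⁅⁆ (~⇒≢ v~y))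
    all : ∀ {w} → w ∈ S ∪ ⁅ v ⁆ ∪ ⁅ y ⁆
    all = insert-full S₁-tight y∉S₁ (count≥3 (∩-∈ (∪-∈ˡ p∈S) (∈⁺ y~p)) (∩-∈ (∪-∈ˡ q∈S) (∈⁺ y~q))
      (∩-∈ (∪-∈ʳ (⁅⁆-refl v)) (∈⁺ (~-sym v~y))) p≢q (~⇒≢ (~-sym v~p)) (~⇒≢ (~-sym v~q)))
    y-neighbours : ∀ {w} → y ~ w → p ≡ w ⊎ q ≡ w ⊎ v ≡ w
    y-neighbours = neighbours-complete (proj₁ (last-vertex S₁-tight y∉S₁ all)) y~p y~q (~-sym v~y)
      p≢q (~⇒≢ (~-sym v~p)) (~⇒≢ (~-sym v~q))
    cover : ∀ i → i ∈ V ⊎ i ∈ S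
    cover i = case ∈-∪ (all {i}) of λ
      { (inj₂ a) → inj₁ (∪-∈ˡ (∪-∈ʳ a))
      ; (inj₁ a) → case ∈-∪ a of λ { (inj₁ b) → inj₂ b ; (inj₂ b) → inj₁ (∪-∈ˡ (∪-∈ˡ b)) } }
    v-edge : ∀ {j} → v ~ j → j ∈ V
    v-edge h = case v-neighbours h of λ
      { (inj₁ refl) → p∈V ; (inj₂ (inj₁ refl)) → q∈V ; (inj₂ (inj₂ refl)) → y∈V }
    y-edge : ∀ {j} → y ~ j → j ∈ V
    y-edge h = case y-neighbours h of λ
      { (inj₁ refl) → p∈V ; (inj₂ (inj₁ refl)) → q∈V ; (inj₂ (inj₂ refl)) → v∈V }
    place : ∀ i → i ∈ S ⊎ v ≡ i ⊎ y ≡ i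
    place i = case ∈-∪ (all {i}) of λ
      { (inj₂ a) → inj₂ (inj₂ (∈-⁅⁆ a))
      ; (inj₁ a) → case ∈-∪ a of λ { (inj₁ b) → inj₁ b ; (inj₂ b) → inj₂ (inj₁ (∈-⁅⁆ b)) } }
    touching : ∀ {u i j} → u ∈ V → (∀ {w} → u ~ w → w ∈ V) → u ≡ i → i ~ j → i ∈ V × j ∈ V
    touching u∈V near refl h = u∈V , near h
    leaving : ∀ {i j} → v ≡ i ⊎ y ≡ i → i ~ j → i ∈ V × j ∈ V
    leaving (inj₁ a) = touching v∈V v-edge a
    leaving (inj₂ a) = touching y∈V y-edge a
    sides : ∀ {i j} → i ∈ S ⊎ (v ≡ i ⊎ y ≡ i) → j ∈ S ⊎ (v ≡ j ⊎ y ≡ j) → i ~ j →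
            (i ∈ V × j ∈ V) ⊎ (i ∈ S × j ∈ S)
    sides (inj₁ a) (inj₁ b) h = inj₂ (a , b)
    sides (inj₂ a) _        h = inj₁ (leaving a h)
    sides (inj₁ _) (inj₂ b) h = inj₁ (let (x , y) = leaving b (~-sym h) in y , x)
    edges : ∀ {i j} → i ~ j → (i ∈ V × j ∈ V) ⊎ (i ∈ S × j ∈ S)
    edges {i} {j} = sides (place i) (place j)
    common : ∀ {i} → i ∈ V → i ∈ S → p ≡ i ⊎ q ≡ i
    common a b = case ∈-∪ a of λ
      { (inj₁ c) → case ∈-∪ c of λ
          { (inj₁ d) → ⊥-elim (∈-∉ (subst (_∈ S) (sym (∈-⁅⁆ d)) b) K.v∉)
          ; (inj₂ d) → ⊥-elim (∈-∉ (subst (_∈ S) (sym (∈-⁅⁆ d)) b) K.r∉) }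
      ; (inj₂ c) → case ∈-∪ c of λ { (inj₁ d) → inj₁ (∈-⁅⁆ d) ; (inj₂ d) → inj₂ (∈-⁅⁆ d) } }
    other : ∃ λ w → w ∈ S × w ∉ ⁅ p ⁆ ∪ ⁅ q ⁆
    other with find (S ∖ ⁅ p ⁆ ∖ ⁅ q ⁆) (≤-pred (≤-pred (≤-trans (s≤s (s≤s (s≤s z≤n))) (subst (4 ≤_)
      (trans (remove p∈S) (cong suc (remove (∖-∈ q∈S (∉-⁅⁆ p≢q))))) (tight-size K.tight (count≥2 p∈S q∈S p≢q))))))
    ... | w , h = let (a , w∉q) = ∈-∖ h ; (b , w∉p) = ∈-∖ a in w , b , ∪-∉ w∉p w∉q
    outside : proj₁ other ∉ V
    outside = ¬∈⇒∉ λ a → case common a (proj₁ (proj₂ other)) of λ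
      { (inj₁ b) → ∈-∉ (∪-∈ˡ (subst (_∈ ⁅ p ⁆) b (⁅⁆-refl p))) (proj₂ (proj₂ other))
      ; (inj₂ b) → ∈-∉ (∪-∈ʳ (subst (_∈ ⁅ q ⁆) b (⁅⁆-refl q))) (proj₂ (proj₂ other)) }

  branching-nonadjacent : ∀ {v p q} → Branching v → v ~ p → v ~ q → p ≢ q → ¬ p ~ q
  branching-nonadjacent (node , b) v~p v~q p≢q = critical-nonadjacent node v~p v~q p≢q (proj₂ (b v~p)) (proj₂ (b v~q))

  -- A K₄ around `w` contains `v` and a further vertex adjacent to both, so `v` would have two
  -- adjacent neighbours.
  branching⇒¬neighbourInK4 : ∀ {v w} → Branching v → v ~ w → ¬ InK4 w
  branching⇒¬neighbourInK4 {v} {w} b v~w (node , clique) =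
    let (g , w~g , v≢g) = neighbour₂ v node
    in branching-nonadjacent b v~w (clique (~-sym v~w) w~g v≢g) (~⇒≢ w~g) w~g

  branching⇒¬InK4 : ∀ {v} → Branching v → ¬ InK4 v
  branching⇒¬InK4 b (node , clique) =
    let (p , v~p) = neighbour node ; (q , v~q , p≢q) = neighbour₂ p node
    in branching-nonadjacent b v~p v~q p≢q (clique v~p v~q p≢q)

  -- Admissibility enters only through `reduce`. This keeps the argument free of the shape `suc m`
  -- of the vertex count, which `IsAdmissible` demands.
  module Classification (Admissible : Fin n → Set)
    (reduce : ∀ {v p q r} → IsNode G v → v ~ p → v ~ q → v ~ r → p ≢ q → p ≢ r → q ≢ r →
              ¬ p ~ q → ¬ Blocked v r → Admissible v) where

    private
      -- If `q` and `r` are not adjacent, joining them is obstructed only at `p`. If they are, then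
      -- `p` and `r` are not, by `no-critical-two-edges`, and joining these succeeds: an obstruction
      -- at `q` beside the one at `r` would contradict the edge between `q` and `r`.
      settle : ∀ {v p q r} → IsNode G v → v ~ p → v ~ q → v ~ r → p ≢ q → p ≢ r → q ≢ r →
               ¬ p ~ q → Blocked v r → Admissible v ⊎ Blocked v p
      settle {v} {p} {q} {r} node a b c d e f p≁q (S , k) with Blocked? v p
      ... | yes h = inj₂ h
      ... | no ¬p with ~-dec q r
      ...   | no q≁r = inj₁ (reduce node b c a f (d ∘ sym) (e ∘ sym) q≁r ¬p)
      ...   | yes q~r with ~-dec p r
      ...     | yes p~r = ⊥-elim (no-critical-two-edges node a b c d e f (~-sym p~r) (~-sym q~r) p≁q k)
      ...     | no p≁r with Blocked? v q
      ...       | yes (S′ , k′) = ⊥-elim (critical-nonadjacent node b c f k′ k q~r)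
      ...       | no ¬q = inj₁ (reduce node a c b e d (f ∘ sym) p≁r ¬q)

    classify : ∀ {v} → IsNode G v → Admissible v ⊎ InK4 v ⊎ Branching v
    classify {v} node with Fin.any? (λ p → Fin.any? (λ q →
      ~-dec v p ×-dec (~-dec v q ×-dec (¬? (p ≟ᶠ q) ×-dec ¬? (~-dec p q)))))
    ... | no none = inj₂ (inj₁ (node , λ {p} {q} a b c → case ~-dec p q of λ
            { (yes h) → h ; (no h) → ⊥-elim (none (p , q , a , b , c , h)) }))
    ... | yes (p , q , a , b , d , p≁q) with neighbour₃ node a b d
    ...   | r , c , e , f with Blocked? v r
    ...     | no ¬r = inj₁ (reduce node a b c d e f p≁q ¬r)
    ...     | yes kr with settle node a b c d e f p≁q kr
                        | settle node b a c (d ∘ sym) f e (p≁q ∘ ~-sym) kr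
    ...       | inj₁ h  | _       = inj₁ h
    ...       | inj₂ _  | inj₁ h  = inj₁ h
    ...       | inj₂ kp | inj₂ kq = inj₂ (inj₂ (node , λ h → case neighbours-complete node a b c d e f h of λ
                  { (inj₁ refl) → kp ; (inj₂ (inj₁ refl)) → kq ; (inj₂ (inj₂ refl)) → kr }))

  -- Clusters of tight sets

  -- By sparsity of `∁ D`, at least 2|D| + 1 edges meet `D`. The degree sum 3|D| counts the inner
  -- ones twice, so at most |D| - 1 edges are inner. Holding for every subset of the nodes, this
  -- excludes cycles.
  node-forest : ∀ {D w u} → (∀ {v} → v ∈ D → IsNode G v) → w ∈ D → u ∉ D → e D D + 2 ≤ 2 * ∣ D ∣
  node-forest {D} nodes w∈D u∉D =
    linear 8 (λ f d c x y s t m → (f ⊕ con 2 ≈ 4 ⊛ m ∷ f ≈ d ⊕ c ⊕ 2 ⊛ x ∷ y ≈ d ⊕ x ∷ s ⊕ t ≈ m ∷ c ⊕ con 4 ≼ 4 ⊛ t ∷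
        y ≼ 3 ⊛ s ∷ []) ⊢ d ⊕ con 2 ≼ 2 ⊛ s)
      (e full full ∷ e D D ∷ e (∁ D) (∁ D) ∷ e D (∁ D) ∷ e D full ∷ ∣ D ∣ ∷ ∣ ∁ D ∣ ∷ n ∷ [])
      e-total (e-complement D) (e-∁ʳ D) (∣∁∣ D) (sparse (∁-∈ u∉D) (∁-∉ w∈D))
      (degrees≤ λ {v} h → ≤-trans (countB-mono {P = full ∩ N v} (proj₂ ∘ ∈-∩)) (≤-reflexive (nodes h)))

  record FreshNeighbour (F M : VSet n) (w : Fin n) : Set where
    field
      ∈M   : w ∈ M
      ∉F   : w ∉ F
      g    : Fin n
      g∈F  : g ∈ F
      g~w  : g ~ w

  FreshNeighbour? : ∀ F M w → Dec (FreshNeighbour F M w)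
  FreshNeighbour? F M w = map′
    (λ (a , b , g , c , d) → record { ∈M = a ; ∉F = b ; g = g ; g∈F = c ; g~w = d })
    (λ f → let open FreshNeighbour f in ∈M , ∉F , g , g∈F , g~w)
    (∈-dec w M ×-dec (∉-dec w F ×-dec Fin.any? (λ g → ∈-dec g F ×-dec ~-dec g w)))

  -- G[F ∪ A] is a forest in which every vertex of F has degree at least two.
  two-fresh-neighbours : ∀ {F M f u} → f ∈ F → F ⊆ M → u ∉ M → (∀ {v} → v ∈ M → IsNode G v) →
    (∀ {v} → v ∈ F → 2 ≤ ∣ M ∩ N v ∣) → 2 ≤ ∣ ⟪ FreshNeighbour? F M ⟫ ∣
  two-fresh-neighbours {F} {M} f∈F F⊆M u∉M nodes two =
    -- At most |F| - 1 edges lie inside `F`, so at least 2|F| - (|F| - 1) = |F| + 1 edges of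
    -- G[F ∪ A] meet `F`, while this forest has at most |F| + |A| - 1 edges.
    linear 8 (λ fm ff fa aa ua uu f a → (2 ⊛ f ≼ fm ∷ fm ≼ ff ⊕ fa ∷ ff ⊕ con 2 ≼ 2 ⊛ f ∷ ua ⊕ con 2 ≼ 2 ⊛ uu ∷
        ua ≈ ff ⊕ aa ⊕ 2 ⊛ fa ∷ uu ≈ f ⊕ a ∷ []) ⊢ con 2 ≼ a)
      (e F M ∷ e F F ∷ e F A ∷ e A A ∷ e (F ∪ A) (F ∪ A) ∷ ∣ F ∪ A ∣ ∷ ∣ F ∣ ∷ ∣ A ∣ ∷ [])
      (degrees≥ two) reach
      (node-forest (nodes ∘ F⊆M) f∈F (¬∈⇒∉ λ h → ∈-∉ (F⊆M h) u∉M))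
      (node-forest (nodes ∘ inM) (∪-∈ˡ f∈F) (¬∈⇒∉ λ h → ∈-∉ (inM h) u∉M))
      (e-∪-disjoint disjoint) (∣∪∣-disjoint disjoint)
    where
    A : VSet n
    A = ⟪ FreshNeighbour? F M ⟫
    fresh : ∀ {w} → w ∈ A → FreshNeighbour F M w
    fresh = ∈-⟪⟫
    disjoint : Disjoint F A
    disjoint p q = ∈-∉ p (FreshNeighbour.∉F (fresh q))
    inM : F ∪ A ⊆ M
    inM h = case ∈-∪ h of λ { (inj₁ p) → F⊆M p ; (inj₂ q) → FreshNeighbour.∈M (fresh q) }
    reach : e F M ≤ e F F + e F A
    reach = ≤-trans (e-cover F (F ∪ A) M covered)
      (≤-reflexive (trans (e-sym F (F ∪ A)) (trans (e-∪ˡ-disjoint F disjoint) (cong (e F F +_) (e-sym A F)))))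
      where
      covered : ∀ {i j} → i ∈ F → j ∈ M → i ~ j → j ∈ F ∪ A
      covered {i} {j} p q r with j ∈? F
      ... | inj₁ h = ∪-∈ˡ h
      ... | inj₂ h = ∪-∈ʳ (⟪⟫-∈ record { ∈M = q ; ∉F = h ; g = i ; g∈F = p ; g~w = r })

  K : Fin n → VSet n
  K u = N u ∪ ⁅ u ⁆

  u∉N : ∀ {u} → u ∉ N u
  u∉N = ¬∈⇒∉ λ h → ~-irrefl (∈⁻ h)

  K-centre : ∀ u → u ∈ K u
  K-centre u = ∪-∈ʳ (⁅⁆-refl u)

  module _ {u} (k : InK4 u) where

    K-size : ∣ K u ∣ ≡ 4
    K-size = trans (insert u∉N) (cong suc (proj₁ k))

    K-clique : ∀ {i j} → i ∈ K u → j ∈ K u → i ≢ j → i ~ j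
    K-clique {i} {j} p q h with ∈-∪ p | ∈-∪ q
    ... | inj₁ (∈⁺ a) | inj₁ (∈⁺ b) = proj₂ k a b h
    ... | inj₁ (∈⁺ a) | inj₂ b      = subst (i ~_) (∈-⁅⁆ b) (~-sym a)
    ... | inj₂ a      | inj₁ (∈⁺ b) = subst (_~ j) (∈-⁅⁆ a) b
    ... | inj₂ a      | inj₂ b      = ⊥-elim (h (trans (sym (∈-⁅⁆ a)) (∈-⁅⁆ b)))

    K-tight : Tight (K u)
    K-tight = trans (complete K-size (e-clique (K u) K-clique)) (cong (4 *_) (sym K-size))
      where
      complete : ∀ {x k} → k ≡ 4 → x + k ≡ k * k → x + 4 ≡ 16
      complete refl h = h

  Closed : VSet n → Set
  Closed X = ∀ {u i} → InK4 u → i ∈ K u → i ∈ X → K u ⊆ X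

  Good : Fin n → Set
  Good v = IsNode G v × ¬ InK4 v

  Good? : ∀ v → Dec (Good v)
  Good? v = IsNode? v ×-dec ¬? (InK4? v)

  good : VSet n
  good = ⟪ Good? ⟫

  closed-∪ : ∀ {X Y} → Closed X → Closed Y → Closed (X ∪ Y)
  closed-∪ cX cY k p q = case ∈-∪ q of λ
    { (inj₁ a) r → ∪-∈ˡ (cX k p a r) ; (inj₂ b) r → ∪-∈ʳ (cY k p b r) }

  -- Outside X, the closed tight sets C each contribute Σ_C deg ≥ 4|C| unless C is a
  -- single good node, whereas Σ_V deg = 4n − 2.
  module _ {X} (tX : Tight X) (X≥2 : 2 ≤ ∣ X ∣) (∁≥2 : 2 ≤ ∣ ∁ X ∣) (cX : Closed X) where

    private
      -- The degree sum is 4|C| - 4 from inside plus the at least four leaving edges of `cut≥4`.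
      heavy : ∀ {C} → Tight C → 2 ≤ ∣ C ∣ → 2 ≤ ∣ ∁ C ∣ → 4 * ∣ C ∣ ≤ e C full
      heavy {C} t a b = linear 4 (λ c d f s → (f ≈ c ⊕ d ∷ c ⊕ con 4 ≈ 4 ⊛ s ∷ con 4 ≼ d ∷ []) ⊢ 4 ⊛ s ≼ f)
        (e C C ∷ e C (∁ C) ∷ e C full ∷ ∣ C ∣ ∷ []) (e-∁ʳ C) t (cut≥4 t a b)

      -- The invariant of the sweep: good nodes already absorbed pay for what the degree sum lacks
      -- to 4|S|.
      Stage : VSet n → Set
      Stage S = X ⊆ S × Closed S × 4 * ∣ S ∣ ≤ e S full + ∣ good ∩ (S ∖ X) ∣

      Cluster : VSet n → Fin n → VSet n → Set
      Cluster S v C = Tight C × v ∈ C × C ⊆ ∁ S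

      transport : ∀ {Y Z : VSet n} → (∀ i → Y i ≡ Z i) → Z ⊆ Y
      transport h p = ∈⁺ (trans (h _) (∈⁻ p))

      clusterAt : ∀ S v → v ∉ S → ∃ λ C → ⁅ v ⁆ ⊆ C × Maximal (Cluster S v) C
      clusterAt S v v∉S = extendToMaximal {P = Cluster S v}
        (λ h (a , b , c) → Tight-ext h a , transport (sym ∘ h) b , λ {i} p → c (transport h p))
        (λ C → Tight? C ×-dec (∈-dec v C ×-dec (C ⊆? ∁ S)))
        ⁅ v ⁆ (tight-singleton v , ⁅⁆-refl v , λ p → ∁-∈ (subst (_∉ S) (∈-⁅⁆ p) v∉S))

      x₀ : ∃ (_∈ X)
      x₀ = tight-nonempty tX

      module Extend {S v C} (stage : Stage S) (cluster : Maximal (Cluster S v) C) where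

        X⊆S = proj₁ stage
        cS = proj₁ (proj₂ stage)
        tC = proj₁ (proj₁ cluster)
        v∈C = proj₁ (proj₂ (proj₁ cluster))
        C⊆∁S = proj₂ (proj₂ (proj₁ cluster))

        disjoint : Disjoint S C
        disjoint p q = ∈-∉ p (∈-∁ (C⊆∁S q))

        -- A K₄ meeting `C` avoids `S`, which is closed and disjoint from `C`. Hence its union with
        -- `C` is still a candidate, tight because both parts miss the nonempty set `X`, and
        -- maximality absorbs it.
        cC : Closed C
        cC {u} {i} k p q r = proj₂ cluster (C ∪ K u)
          ( proj₁ (uncross tC (K-tight k) q p (¬∈⇒∉ (disjoint (X⊆S (proj₂ x₀)))) (K∌ (X⊆S (proj₂ x₀))))
          , ∪-∈ˡ v∈C
          , λ s → case ∈-∪ s of λ { (inj₁ a) → C⊆∁S a ; (inj₂ a) → ∁-∈ (¬∈⇒∉ λ b → ∈-∉ a (K∌ b)) } )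
          ∪-∈ˡ (∪-∈ʳ r)
          where
          K∌ : ∀ {j} → j ∈ S → j ∉ K u
          K∌ s = ¬∈⇒∉ λ a → disjoint (cS k a s p) q

        -- A large cluster is `heavy`. A single vertex falls short only if it has degree three, by
        -- one; closedness keeps it out of every K₄ around a node, so it is good and makes up the
        -- difference.
        weight : 4 * ∣ C ∣ ≤ e C full + ∣ good ∩ C ∣
        weight with 2 ≤? ∣ C ∣
        ... | yes large = ≤-trans (heavy tC large
                (≤-trans X≥2 (countB-mono {P = X} λ p → ∁-∈ (¬∈⇒∉ (disjoint (X⊆S p)))))) (m≤m+n _ _)
        ... | no small with 4 ≤? degree G v
        ...   | yes big = linear 5 (λ c f d g s → (s ≼ con 1 ∷ f ≈ d ∷ con 4 ≼ d ∷ f ≼ c ∷ []) ⊢ 4 ⊛ s ≼ c ⊕ g)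
                (e C full ∷ e ⁅ v ⁆ full ∷ degree G v ∷ ∣ good ∩ C ∣ ∷ ∣ C ∣ ∷ [])
                (≤-pred (≰⇒> small)) (e-degree v) big
                (e-mono (λ p → subst (_∈ C) (∈-⁅⁆ p) v∈C) id)
        ...   | no node = linear 5 (λ c f d g s → (s ≼ con 1 ∷ f ≈ d ∷ con 3 ≼ d ∷ f ≼ c ∷ con 1 ≼ g ∷ []) ⊢ 4 ⊛ s ≼ c ⊕ g)
                (e C full ∷ e ⁅ v ⁆ full ∷ degree G v ∷ ∣ good ∩ C ∣ ∷ ∣ C ∣ ∷ [])
                (≤-pred (≰⇒> small)) (e-degree v) (degree≥3 v)
                (e-mono (λ p → subst (_∈ C) (∈-⁅⁆ p) v∈C) id)
                (count≥1 (∩-∈ (⟪⟫-∈ (≤-antisym (≤-pred (≰⇒> node)) (degree≥3 v) , alone)) v∈C))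
          where
          alone : ¬ InK4 v
          alone k = small (≤-trans (s≤s (s≤s z≤n))
            (subst (_≤ ∣ C ∣) (K-size k) (countB-mono {P = K v} (cC k (K-centre v) v∈C))))

        extended : Stage (S ∪ C)
        extended = ∪-∈ˡ ∘ X⊆S , closed-∪ cS cC ,
          linear 10 (λ s c u es ec eu gs gc gu g → (u ≈ s ⊕ c ∷ eu ≈ es ⊕ ec ∷ 4 ⊛ s ≼ es ⊕ gs ∷ 4 ⊛ c ≼ ec ⊕ gc ∷
              g ≈ gs ⊕ gc ∷ g ≼ gu ∷ []) ⊢ 4 ⊛ u ≼ eu ⊕ gu)
            (∣ S ∣ ∷ ∣ C ∣ ∷ ∣ S ∪ C ∣ ∷ e S full ∷ e C full ∷ e (S ∪ C) full ∷
              ∣ good ∩ (S ∖ X) ∣ ∷ ∣ good ∩ C ∣ ∷ ∣ good ∩ ((S ∪ C) ∖ X) ∣ ∷ ∣ good ∩ (S ∖ X) ∪ good ∩ C ∣ ∷ [])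
            (∣∪∣-disjoint disjoint) (e-∪ˡ-disjoint full disjoint) (proj₂ (proj₂ stage)) weight
            (∣∪∣-disjoint λ p q → disjoint (proj₁ (∈-∖ (proj₂ (∈-∩ p)))) (proj₂ (∈-∩ q)))
            (countB-mono {P = good ∩ (S ∖ X) ∪ good ∩ C} λ p → case ∈-∪ p of λ
              { (inj₁ a) → let (b , c) = ∈-∩ a ; (d , f) = ∈-∖ c in ∩-∈ b (∖-∈ (∪-∈ˡ d) f)
              ; (inj₂ a) → let (b , c) = ∈-∩ a in ∩-∈ b (∖-∈ (∪-∈ʳ c) (¬∈⇒∉ λ x → disjoint (X⊆S x) c)) })

      grow : ∀ S → Stage S → Acc _<_ (n ∸ ∣ S ∣) → 2 ≤ ∣ good ∖ X ∣
      grow S stage (acc rs) = case full-or-missing S of λ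
        -- With everything absorbed, the invariant reads 4n ≤ (4n - 2) + the number of good nodes
        -- outside `X`.
        { (inj₁ all) → linear 6 (λ s f m g h t → (t ⊕ con 2 ≈ 4 ⊛ m ∷ s ≈ m ∷ f ≼ t ∷ 4 ⊛ s ≼ f ⊕ g ∷ g ≼ h ∷ []) ⊢ con 2 ≼ h)
            (∣ S ∣ ∷ e S full ∷ n ∷ ∣ good ∩ (S ∖ X) ∣ ∷ ∣ good ∖ X ∣ ∷ e full full ∷ [])
            e-total (all⇒∣∣≡n all) (e-mono (λ _ → ∈-full) id) (proj₂ (proj₂ stage))
            (countB-mono {P = good ∩ (S ∖ X)} λ p → let (a , b) = ∈-∩ p in ∖-∈ a (proj₂ (∈-∖ b)))
        ; (inj₂ (v , v∉S)) → let (C , _ , cluster) = clusterAt S v v∉S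
                                 open Extend stage cluster
                             in grow (S ∪ C) extended (rs (∸-monoʳ-< (subst (_≤ ∣ S ∪ C ∣) (insert v∉S)
                                  (countB-mono {P = S ∪ ⁅ v ⁆} λ p → case ∈-∪ p of λ
                                    { (inj₁ a) → ∪-∈ˡ a ; (inj₂ a) → ∪-∈ʳ (subst (_∈ C) (∈-⁅⁆ a) v∈C) })) (∣∣≤n (S ∪ C)))) }

    two-good-outside : 2 ≤ ∣ good ∖ X ∣
    two-good-outside = grow X (id , cX , ≤-trans (heavy tX X≥2 ∁≥2) (m≤m+n _ _)) (<-wellFounded _)

  -- K₄'s around a node that cross a tight set.

  record Crossing (X : VSet n) (u : Fin n) : Set where
    field
      one   : ∣ X ∩ K u ∣ ≡ 1
      cases : ((∀ {w} → w ∈ X ∪ K u) × e (X ∖ K u) (K u ∖ X) ≡ 1) ⊎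
              (Tight (X ∪ K u) × e (X ∖ K u) (K u ∖ X) ≡ 0)

  -- If the union is proper, the intersection is tight and complete; among orders one to three only
  -- one allows both. If the union is everything, three vertices of the K₄ lie outside `X`, and the
  -- total 2n - 1 leaves exactly one edge across.
  crossing : ∀ {X u i} → Tight X → 3 ≤ ∣ ∁ X ∣ → InK4 u → i ∈ K u → i ∈ X → ¬ K u ⊆ X → Crossing X u
  crossing {X} {u} {i} tX ∁≥3 k i∈K i∈X K⊈X = analyse (full-or-missing (X ∪ K u))
    where
    t = ∣ X ∩ K u ∣
    c = e (X ∖ K u) (K u ∖ X)
    t≥1 : 1 ≤ t
    t≥1 = count≥1 (∩-∈ i∈X i∈K)
    t≤3 : t ≤ 3
    t≤3 = ≮⇒≥ λ h → K⊈X λ p → proj₁ (∈-∩ (⊆∧≥⇒⊇ {X = X ∩ K u} (proj₂ ∘ ∈-∩) (subst (_≤ t) (sym (K-size k)) h) p))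
    t-clique : e (X ∩ K u) (X ∩ K u) + t ≡ t * t
    t-clique = e-clique (X ∩ K u) λ p q → K-clique k (proj₂ (∈-∩ p)) (proj₂ (∈-∩ q))
    analyse : (∀ {w} → w ∈ X ∪ K u) ⊎ ∃ (_∉ X ∪ K u) → Crossing X u
    analyse (inj₂ (w , w∉)) = record
      { one   = only t t≥1 t≤3 t-clique (proj₁ (proj₂ uncrossed))
      ; cases = inj₂ (proj₁ uncrossed , proj₂ (proj₂ uncrossed)) }
      where
      uncrossed : Tight (X ∪ K u) × Tight (X ∩ K u) × c ≡ 0
      uncrossed = uncross {w = i} {u = w} tX (K-tight k) i∈X i∈K (¬∈⇒∉ λ p → ∈-∉ (∪-∈ˡ p) w∉) (¬∈⇒∉ λ p → ∈-∉ (∪-∈ʳ p) w∉)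
      only : ∀ {x} t → 1 ≤ t → t ≤ 3 → x + t ≡ t * t → x + 4 ≡ 4 * t → t ≡ 1
      only 1 _ _ _ _ = refl
      only {x} 2 _ _ a b = absurd (linear 1 (λ x → (x ⊕ con 2 ≈ con 4 ∷ x ⊕ con 4 ≈ con 8 ∷ []) ⊢ con 1 ≼ con 0) (x ∷ []) a b)
      only {x} 3 _ _ a b = absurd (linear 1 (λ x → (x ⊕ con 3 ≈ con 9 ∷ x ⊕ con 4 ≈ con 12 ∷ []) ⊢ con 1 ≼ con 0) (x ∷ []) a b)
      only (suc (suc (suc (suc _)))) _ (s≤s (s≤s (s≤s ()))) _ _
    analyse (inj₁ all) = record { one = t≡1 ; cases = inj₁ (all , c≡1) }
      where
      t≡1 : t ≡ 1
      t≡1 = linear 6 (λ t s u x y m → (u ⊕ t ≈ s ⊕ x ∷ x ≈ con 4 ∷ s ⊕ y ≈ m ∷ u ≈ m ∷ con 3 ≼ y ∷ con 1 ≼ t ∷ []) ⊢ t ≈ con 1)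
        (t ∷ ∣ X ∣ ∷ ∣ X ∪ K u ∣ ∷ ∣ K u ∣ ∷ ∣ ∁ X ∣ ∷ n ∷ [])
        (∣∪∣+∣∩∣ X (K u)) (K-size k) (∣∁∣ X) (proj₂ (full-e all)) ∁≥3 t≥1
      inner : e (X ∩ K u) (X ∩ K u) ≡ 0
      inner = linear 1 (λ x → (x ⊕ con 1 ≈ con 1 ∷ []) ⊢ x ≈ con 0) (e (X ∩ K u) (X ∩ K u) ∷ [])
        (subst (λ t → e (X ∩ K u) (X ∩ K u) + t ≡ t * t) t≡1 t-clique)
      c≡1 : c ≡ 1
      c≡1 = linear 11 (λ uu ii xx kk c t s u k m f → (uu ⊕ ii ≈ xx ⊕ kk ⊕ 2 ⊛ c ∷ u ⊕ t ≈ s ⊕ k ∷ xx ⊕ con 4 ≈ 4 ⊛ s ∷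
          kk ⊕ con 4 ≈ 4 ⊛ k ∷ k ≈ con 4 ∷ t ≈ con 1 ∷ ii ≈ con 0 ∷ uu ≈ f ∷ u ≈ m ∷ f ⊕ con 2 ≈ 4 ⊛ m ∷ []) ⊢ c ≈ con 1)
        (e (X ∪ K u) (X ∪ K u) ∷ e (X ∩ K u) (X ∩ K u) ∷ e X X ∷ e (K u) (K u) ∷ c ∷ t ∷ ∣ X ∣ ∷ ∣ X ∪ K u ∣ ∷
          ∣ K u ∣ ∷ n ∷ e full full ∷ [])
        (e-uncross X (K u)) (∣∪∣+∣∩∣ X (K u)) tX (K-tight k) (K-size k) t≡1 inner
        (proj₁ (full-e all)) (proj₂ (full-e all)) e-total

  -- The three exceptional graphs

  private
    bool-ext : ∀ {a b} → (a ≡ true → b ≡ true) → (b ≡ true → a ≡ true) → a ≡ b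
    bool-ext {true}  {b}     f g = sym (f refl)
    bool-ext {false} {false} f g = refl
    bool-ext {false} {true}  f g = g refl

    enumerate₁ : ∀ (S : VSet n) → ∣ S ∣ ≡ 1 → ∃ λ p → p ∈ S × (∀ {w} → w ∈ S → p ≡ w)
    enumerate₁ S h = let (p , a) = find S (≤-reflexive (sym h)) in p , a , ∣∣≡1⇒≡ h a

    enumerate-suc : ∀ (S : VSet n) {k p} → ∣ S ∣ ≡ suc k → p ∈ S → ∣ S ∖ ⁅ p ⁆ ∣ ≡ k
    enumerate-suc S h a = suc-injective (trans (sym (remove a)) h)

    or-removed : ∀ {S : VSet n} {p w} → w ∈ S → p ≡ w ⊎ w ∈ S ∖ ⁅ p ⁆
    or-removed {S} {p} {w} h with w ∈? ⁅ p ⁆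
    ... | inj₁ a = inj₁ (∈-⁅⁆ a)
    ... | inj₂ a = inj₂ (∖-∈ h a)

    enumerate₂ : ∀ (S : VSet n) → ∣ S ∣ ≡ 2 → ∃₂ λ p q → p ∈ S × q ∈ S × (∀ {w} → w ∈ S → p ≡ w ⊎ q ≡ w)
    enumerate₂ S h =
      let (p , a) = find S (≤-trans (s≤s z≤n) (≤-reflexive (sym h)))
          (q , b , only) = enumerate₁ (S ∖ ⁅ p ⁆) (enumerate-suc S h a)
      in p , q , a , proj₁ (∈-∖ b) , λ c → case or-removed c of λ { (inj₁ d) → inj₁ d ; (inj₂ d) → inj₂ (only d) }

    enumerate₃ : ∀ (S : VSet n) → ∣ S ∣ ≡ 3 →
      ∃₂ λ p q → ∃ λ r → p ∈ S × q ∈ S × r ∈ S × (∀ {w} → w ∈ S → p ≡ w ⊎ q ≡ w ⊎ r ≡ w)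
    enumerate₃ S h =
      let (p , a) = find S (≤-trans (s≤s z≤n) (≤-reflexive (sym h)))
          (q , r , b , c , only) = enumerate₂ (S ∖ ⁅ p ⁆) (enumerate-suc S h a)
      in p , q , r , a , proj₁ (∈-∖ b) , proj₁ (∈-∖ c) ,
         λ d → case or-removed d of λ { (inj₁ x) → inj₁ x ; (inj₂ x) → inj₂ (only x) }

  -- A surjective enumeration suffices: if some index `i` were not recovered by `section`, then
  -- `section` would miss `i` and embed `Fin n` into `Fin k`.
  module Enumeration {k} (n≥ : suc k ≤ n) (g : Fin (suc k) → Fin n) (surjective : ∀ w → ∃ λ i → g i ≡ w) where

    private
      section : Fin n → Fin (suc k)
      section w = proj₁ (surjective w)

      section-injective : ∀ {u w} → section u ≡ section w → u ≡ w
      section-injective {u} {w} h = trans (sym (proj₂ (surjective u))) (trans (cong g h) (proj₂ (surjective w)))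

      section-g : ∀ i → section (g i) ≡ i
      section-g i with i ≟ᶠ section (g i)
      ... | yes h = sym h
      ... | no  h = ⊥-elim (<-irrefl refl (≤-trans n≥ (Fin.injective⇒≤ {f = λ w → punchOut (missed w)}
                      λ {u} {w} eq → section-injective (Fin.punchOut-injective (missed u) (missed w) eq))))
        where
        missed : ∀ w → i ≢ section w
        missed w eq = h (trans eq (cong section (sym (trans (cong g eq) (proj₂ (surjective w))))))

    eqᵇ-g : ∀ i j → eqᵇ (g i) (g j) ≡ eqᵇ i j
    eqᵇ-g i j with g i ≟ᶠ g j | i ≟ᶠ j
    ... | yes _ | yes _ = refl
    ... | no _  | no _  = refl
    ... | no h  | yes p = ⊥-elim (h (cong g p))
    ... | yes p | no h  = ⊥-elim (h (trans (sym (section-g i)) (trans (cong section p) (section-g j))))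

    isomorphism : (H : Graph (suc k)) → (∀ i j → adj G (g i) (g j) ≡ adj H i j) → G ≅ H
    isomorphism H h = mk↔ₛ′ section g section-g (λ w → proj₂ (surjective w)) ,
      λ u w → trans (cong₂ (adj G) (sym (proj₂ (surjective u))) (sym (proj₂ (surjective w)))) (h (section u) (section w))

  private
    ≢⇒not : ∀ {u w : Fin n} → u ≢ w → not (eqᵇ u w) ≡ true
    ≢⇒not {u} {w} h with u ≟ᶠ w
    ... | yes p = ⊥-elim (h p)
    ... | no _  = refl

    not⇒≢ : ∀ {u w : Fin n} → not (eqᵇ u w) ≡ true → u ≢ w
    not⇒≢ {u} {w} h p with u ≟ᶠ w
    not⇒≢ () p | yes _
    not⇒≢ _  p | no q = q p

    pair⇒ : ∀ (x y i j : Fin n) → pair x y i j ≡ true → (i ≡ x × j ≡ y) ⊎ (i ≡ y × j ≡ x)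
    pair⇒ x y i j h with i ≟ᶠ x | j ≟ᶠ y | i ≟ᶠ y | j ≟ᶠ x
    ... | yes p | yes q | _     | _     = inj₁ (p , q)
    ... | yes _ | no _  | yes p | yes q = inj₂ (p , q)
    ... | no _  | _     | yes p | yes q = inj₂ (p , q)

    ⇒pair : ∀ {x y i j : Fin n} → (i ≡ x × j ≡ y) ⊎ (i ≡ y × j ≡ x) → pair x y i j ≡ true
    ⇒pair {x} {y} (inj₁ (refl , refl)) rewrite eqᵇ-refl x | eqᵇ-refl y = refl
    ⇒pair {x} {y} (inj₂ (refl , refl)) rewrite eqᵇ-refl x | eqᵇ-refl y = ∨-zeroʳ _

    ∧⁻ : ∀ {a b} → a ∧ b ≡ true → a ≡ true × b ≡ true
    ∧⁻ {true} h = refl , h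

    ∨⁻ : ∀ {a b} → a ∨ b ≡ true → a ≡ true ⊎ b ≡ true
    ∨⁻ {true}  h = inj₁ refl
    ∨⁻ {false} h = inj₂ h

    ∨ˡ : ∀ {a b} → a ≡ true → a ∨ b ≡ true
    ∨ˡ refl = refl

    ∨ʳ : ∀ {a b} → b ≡ true → a ∨ b ≡ true
    ∨ʳ {a} refl = ∨-zeroʳ a

    -- The right-hand side imitates the definitions of `H1` and `H2`, with `cross` empty for the
    -- former and a single edge for the latter.
    two-cliques : ∀ {X Y} (cross : EdgeSet n) → (∀ {i j} → i ∈ X → j ∈ X → i ≢ j → i ~ j) →
      (∀ {i j} → i ∈ Y → j ∈ Y → i ≢ j → i ~ j) → (∀ {w} → w ∈ X ∪ Y) →
      (∀ {i j} → cross i j ≡ true → i ~ j) → IsSymmetric cross →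
      (∀ {i j} → i ∈ X ∖ Y → j ∈ Y ∖ X → i ~ j → cross i j ≡ true) →
      ∀ i j → adj G i j ≡ not (eqᵇ i j) ∧ ((X i ∧ X j) ∨ (Y i ∧ Y j) ∨ cross i j)
    two-cliques {X} {Y} cross cliqueX cliqueY all sound symm complete i j = bool-ext to from
      where
      to : i ~ j → not (eqᵇ i j) ∧ ((X i ∧ X j) ∨ (Y i ∧ Y j) ∨ cross i j) ≡ true
      to h = cong₂ _∧_ (≢⇒not (~⇒≢ h)) (inside (i ∈? X) (j ∈? X) (i ∈? Y) (j ∈? Y))
        where
        other : ∀ {k} → k ∉ X → k ∈ Y
        other p = case ∈-∪ all of λ { (inj₁ q) → ⊥-elim (∈-∉ q p) ; (inj₂ q) → q }
        inside : i ∈ X ⊎ i ∉ X → j ∈ X ⊎ j ∉ X → i ∈ Y ⊎ i ∉ Y → j ∈ Y ⊎ j ∉ Y →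
                 (X i ∧ X j) ∨ (Y i ∧ Y j) ∨ cross i j ≡ true
        inside (inj₁ (∈⁺ a)) (inj₁ (∈⁺ b)) _ _ = ∨ˡ {X i ∧ X j} (cong₂ _∧_ a b)
        inside _ _ (inj₁ (∈⁺ a)) (inj₁ (∈⁺ b)) = ∨ʳ {X i ∧ X j} (∨ˡ {Y i ∧ Y j} (cong₂ _∧_ a b))
        inside (inj₁ a) (inj₂ b) (inj₂ c) _ = ∨ʳ {X i ∧ X j} (∨ʳ {Y i ∧ Y j} (complete (∖-∈ a c) (∖-∈ (other b) b) h))
        inside (inj₂ a) (inj₁ b) _ (inj₂ c) =
          ∨ʳ {X i ∧ X j} (∨ʳ {Y i ∧ Y j} (trans (symm i j) (complete (∖-∈ b c) (∖-∈ (other a) a) (~-sym h))))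
        inside (inj₂ a) (inj₂ b) (inj₂ c) _ = ⊥-elim (∈-∉ (other a) c)
        inside (inj₂ a) (inj₂ b) _ (inj₂ c) = ⊥-elim (∈-∉ (other b) c)
        inside (inj₁ a) (inj₂ b) _ (inj₂ c) = ⊥-elim (∈-∉ (other b) c)
        inside (inj₂ a) (inj₁ b) (inj₂ c) _ = ⊥-elim (∈-∉ (other a) c)
      from : not (eqᵇ i j) ∧ ((X i ∧ X j) ∨ (Y i ∧ Y j) ∨ cross i j) ≡ true → i ~ j
      from h = let (d , k) = ∧⁻ h in case ∨⁻ {X i ∧ X j} k of λ
        { (inj₁ a) → let (x , y) = ∧⁻ a in cliqueX (∈⁺ x) (∈⁺ y) (not⇒≢ d)
        ; (inj₂ b) → case ∨⁻ {Y i ∧ Y j} b of λ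
            { (inj₁ a) → let (x , y) = ∧⁻ a in cliqueY (∈⁺ x) (∈⁺ y) (not⇒≢ d)
            ; (inj₂ c) → sound c } }

  private
    module K4∪vertex {u w} (k : InK4 u) (w∉ : w ∉ K u) (all : ∀ {v} → v ∈ K u ∪ ⁅ w ⁆)
      (b : Fin n) (b∈ : b ∈ K u ∖ N w) (onlyb : ∀ {v} → v ∈ K u ∖ N w → b ≡ v)
      (x y z : Fin n) (onlyxyz : ∀ {v} → v ∈ K u ∩ N w → x ≡ v ⊎ y ≡ v ⊎ z ≡ v) where

      g : Fin 5 → Fin n
      -- `K5-e` lacks the edge between its vertices 0 and 1, so `w` and its only non-neighbour `b`
      -- come first.
      g = lookup (w ∷ b ∷ x ∷ y ∷ z ∷ [])
      surjective : ∀ v → ∃ λ i → g i ≡ v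
      surjective v = case ∈-∪ (all {v}) of λ
        { (inj₂ p) → zero , ∈-⁅⁆ p
        ; (inj₁ p) → case v ∈? N w of λ
            { (inj₂ q) → suc zero , onlyb (∖-∈ p q)
            ; (inj₁ q) → case onlyxyz (∩-∈ p q) of λ
                { (inj₁ r) → suc (suc zero) , r
                ; (inj₂ (inj₁ r)) → suc (suc (suc zero)) , r
                ; (inj₂ (inj₂ r)) → suc (suc (suc (suc zero))) , r } } }
      open Enumeration (≤-reflexive (trans (cong suc (sym (K-size k))) (trans (sym (insert w∉)) (all⇒∣∣≡n all)))) g surjective
      labels : ∀ i j → pair w b (g i) (g j) ≡ isPair 0 1 i j
      labels i j = cong₂ _∨_ (cong₂ _∧_ (at i zero) (at j (suc zero))) (cong₂ _∧_ (at i (suc zero)) (at j zero))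
        where
        code : ∀ (i j : Fin 5) → eqᵇ i j ≡ (toℕ i ≡ᵇ toℕ j)
        code = toWitness {a? = Fin.all? λ i → Fin.all? λ j → _ ≟ᵇ _} tt
        at : ∀ i j → eqᵇ (g i) (g j) ≡ (toℕ i ≡ᵇ toℕ j)
        at i j = trans (eqᵇ-g i j) (code i j)
      w≁b : ¬ w ~ b
      w≁b h = ∈-∉ (∈⁺ {X = N w} h) (proj₂ (∈-∖ b∈))
      formula : ∀ i j → adj G i j ≡ not (eqᵇ i j) ∧ not (pair w b i j)
      formula i j = bool-ext
        (λ h → cong₂ _∧_ (≢⇒not (~⇒≢ h)) (notPair λ p → case pair⇒ w b i j p of λ
          { (inj₁ (refl , refl)) → w≁b h ; (inj₂ (refl , refl)) → w≁b (~-sym h) }))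
        (λ h → let (d , p) = ∧⁻ {not (eqᵇ i j)} h in edge (not⇒≢ d) (¬pair p) (∈-∪ (all {i})) (∈-∪ (all {j})))
        where
        notPair : ¬ pair w b i j ≡ true → not (pair w b i j) ≡ true
        notPair h with pair w b i j
        ... | true  = ⊥-elim (h refl)
        ... | false = refl
        ¬pair : not (pair w b i j) ≡ true → ¬ pair w b i j ≡ true
        ¬pair p q with pair w b i j
        ¬pair () q | true
        ¬pair p () | false
        w-edge : ∀ {j} → b ≢ j → j ∈ K u → w ~ j
        w-edge {j} h p with j ∈? N w
        ... | inj₁ q = ∈⁻ q
        ... | inj₂ q = ⊥-elim (h (onlyb (∖-∈ p q)))
        edge : i ≢ j → ¬ pair w b i j ≡ true → i ∈ K u ⊎ i ∈ ⁅ w ⁆ → j ∈ K u ⊎ j ∈ ⁅ w ⁆ → i ~ j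
        edge d p (inj₁ a) (inj₁ c) = K-clique k a c d
        edge d p (inj₂ a) (inj₁ c) = subst (_~ j) (∈-⁅⁆ a) (w-edge (λ q → p (⇒pair {w} {b} (inj₁ (sym (∈-⁅⁆ a) , sym q)))) c)
        edge d p (inj₁ a) (inj₂ c) =
          ~-sym (subst (_~ i) (∈-⁅⁆ c) (w-edge (λ q → p (⇒pair {w} {b} (inj₂ (sym q , sym (∈-⁅⁆ c))))) a))
        edge d p (inj₂ a) (inj₂ c) = ⊥-elim (d (trans (sym (∈-⁅⁆ a)) (∈-⁅⁆ c)))

      build : G ≅ K5-e
      build = isomorphism K5-e λ i j →
        trans (formula (g i) (g j)) (cong₂ (λ p q → not p ∧ not q) (eqᵇ-g i j) (labels i j))

  K4∪vertex≅K5-e : ∀ {u w} → InK4 u → w ∉ K u → (∀ {v} → v ∈ K u ∪ ⁅ w ⁆) → G ≅ K5-e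
  K4∪vertex≅K5-e {u} {w} k w∉ all =
    let three = proj₂ (last-vertex (K-tight k) w∉ all)
        (b , b∈ , onlyb) = enumerate₁ (K u ∖ N w) (suc-injective (suc-injective (suc-injective
          (trans (cong (_+ ∣ K u ∖ N w ∣) (sym three)) (trans (sym (∣∣-split (K u) (N w))) (K-size k))))))
        (x , y , z , _ , _ , _ , onlyxyz) = enumerate₃ (K u ∩ N w) three
    in K4∪vertex.build k w∉ all b b∈ onlyb x y z onlyxyz

  module _ {u v} (k : InK4 u) (l : InK4 v) (all : ∀ {w} → w ∈ K u ∪ K v) where

    private
      X = K u
      Y = K v

      sizes : ∀ {t} → ∣ X ∩ Y ∣ ≡ t → ∣ X ∖ Y ∣ + t ≡ 4 × ∣ Y ∖ X ∣ + t ≡ 4 × n + t ≡ 8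
      sizes {t} h =
          linear 4 (λ x i d t → (x ≈ i ⊕ d ∷ x ≈ con 4 ∷ i ≈ t ∷ []) ⊢ d ⊕ t ≈ con 4)
            (∣ X ∣ ∷ ∣ X ∩ Y ∣ ∷ ∣ X ∖ Y ∣ ∷ t ∷ []) (∣∣-split X Y) (K-size k) h
        , linear 5 (λ x i j d t → (x ≈ j ⊕ d ∷ x ≈ con 4 ∷ i ≈ t ∷ i ≈ j ∷ []) ⊢ d ⊕ t ≈ con 4)
            (∣ Y ∣ ∷ ∣ X ∩ Y ∣ ∷ ∣ Y ∩ X ∣ ∷ ∣ Y ∖ X ∣ ∷ t ∷ []) (∣∣-split Y X) (K-size l) h
            (≤-antisym (countB-mono {P = X ∩ Y} λ p → let (a , b) = ∈-∩ p in ∩-∈ b a)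
                       (countB-mono {P = Y ∩ X} λ p → let (a , b) = ∈-∩ p in ∩-∈ b a))
        , linear 6 (λ w i x y m t → (w ⊕ i ≈ x ⊕ y ∷ x ≈ con 4 ∷ y ≈ con 4 ∷ i ≈ t ∷ w ≈ m ∷ []) ⊢ m ⊕ t ≈ con 8)
            (∣ X ∪ Y ∣ ∷ ∣ X ∩ Y ∣ ∷ ∣ X ∣ ∷ ∣ Y ∣ ∷ n ∷ t ∷ [])
            (∣∪∣+∣∩∣ X Y) (K-size k) (K-size l) h (all⇒∣∣≡n all)

      both : ∀ {w} → w ∈ X ∩ Y → X w ≡ true × Y w ≡ true
      both p = let (∈⁺ a , ∈⁺ b) = ∈-∩ p in a , b
      left : ∀ {w} → w ∈ X ∖ Y → X w ≡ true × Y w ≡ false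
      left p = let (∈⁺ a , ∉⁺ b) = ∈-∖ p in a , b
      right : ∀ {w} → w ∈ Y ∖ X → X w ≡ false × Y w ≡ true
      right p = let (∈⁺ a , ∉⁺ b) = ∈-∖ p in b , a

      region : ∀ w → w ∈ X ∖ Y ⊎ w ∈ X ∩ Y ⊎ w ∈ Y ∖ X
      region w with w ∈? X | w ∈? Y
      ... | inj₁ a | inj₁ b = inj₂ (inj₁ (∩-∈ a b))
      ... | inj₁ a | inj₂ b = inj₁ (∖-∈ a b)
      ... | inj₂ a | inj₁ b = inj₂ (inj₂ (∖-∈ b a))
      ... | inj₂ a | inj₂ b = ⊥-elim (∈-∉ all (∪-∉ a b))

      ∨-false : ∀ a → a ∨ false ≡ a
      ∨-false true  = refl
      ∨-false false = refl

    private
      module TwoK4H1 (two : ∣ X ∩ Y ∣ ≡ 2) (none : e (X ∖ Y) (Y ∖ X) ≡ 0)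
        {p q a b c d} (p∈ : p ∈ X ∖ Y) (q∈ : q ∈ X ∖ Y) (onlyX : ∀ {w} → w ∈ X ∖ Y → p ≡ w ⊎ q ≡ w)
        (a∈ : a ∈ X ∩ Y) (b∈ : b ∈ X ∩ Y) (onlyXY : ∀ {w} → w ∈ X ∩ Y → a ≡ w ⊎ b ≡ w)
        (c∈ : c ∈ Y ∖ X) (d∈ : d ∈ Y ∖ X) (onlyY : ∀ {w} → w ∈ Y ∖ X → c ≡ w ⊎ d ≡ w) where

        g : Fin 6 → Fin n
        -- In this order the two K₄'s occupy the ranges 0 to 3 and 2 to 5 of `H1`.
        g = lookup (p ∷ q ∷ a ∷ b ∷ c ∷ d ∷ [])
        surjective : ∀ w → ∃ λ i → g i ≡ w
        surjective w = case region w of λ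
          { (inj₁ r) → case onlyX r of λ { (inj₁ s) → zero , s ; (inj₂ s) → suc zero , s }
          ; (inj₂ (inj₁ r)) → case onlyXY r of λ { (inj₁ s) → suc (suc zero) , s ; (inj₂ s) → suc (suc (suc zero)) , s }
          ; (inj₂ (inj₂ r)) → case onlyY r of λ
              { (inj₁ s) → suc (suc (suc (suc zero))) , s ; (inj₂ s) → suc (suc (suc (suc (suc zero)))) , s } }
        open Enumeration (≤-reflexive (sym (+-cancelʳ-≡ 2 n 6 (proj₂ (proj₂ (sizes two)))))) g surjective
        labels : ∀ i → X (g i) ≡ (toℕ i ≤ᵇ 3) × Y (g i) ≡ (2 ≤ᵇ toℕ i)
        labels zero                               = left p∈
        labels (suc zero)                         = left q∈
        labels (suc (suc zero))                   = both a∈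
        labels (suc (suc (suc zero)))             = both b∈
        labels (suc (suc (suc (suc zero))))       = right c∈
        labels (suc (suc (suc (suc (suc zero))))) = right d∈

        build : G ≅ H1
        build = isomorphism H1 λ i j →
          trans (two-cliques {X} {Y} (λ _ _ → false) (K-clique k) (K-clique l) all (λ ()) (λ _ _ → refl)
                  (λ r s t → ⊥-elim (e≡0⇒¬~ none r s t)) (g i) (g j))
            (cong₂ (λ x y → not x ∧ y) (eqᵇ-g i j) (cong₂ _∨_ (cong₂ _∧_ (proj₁ (labels i)) (proj₁ (labels j)))
              (trans (∨-false _) (cong₂ _∧_ (proj₂ (labels i)) (proj₂ (labels j))))))

      module TwoK4H2 (one : ∣ X ∩ Y ∣ ≡ 1) (edge : e (X ∖ Y) (Y ∖ X) ≡ 1) {s t p q a c d}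
        (s∈ : s ∈ X ∖ Y) (t∈ : t ∈ Y ∖ X) (s~t : s ~ t)
        (p∈ : p ∈ X ∖ Y ∖ ⁅ s ⁆) (q∈ : q ∈ X ∖ Y ∖ ⁅ s ⁆) (onlyX : ∀ {w} → w ∈ X ∖ Y ∖ ⁅ s ⁆ → p ≡ w ⊎ q ≡ w)
        (a∈ : a ∈ X ∩ Y) (onlyXY : ∀ {w} → w ∈ X ∩ Y → a ≡ w)
        (c∈ : c ∈ Y ∖ X ∖ ⁅ t ⁆) (d∈ : d ∈ Y ∖ X ∖ ⁅ t ⁆) (onlyY : ∀ {w} → w ∈ Y ∖ X ∖ ⁅ t ⁆ → c ≡ w ⊎ d ≡ w) where

        last : Fin 7
        last = suc (suc (suc (suc (suc (suc zero)))))
        g : Fin 7 → Fin n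
        -- The extra edge of `H2` joins 0 and 6, so the ends `s` and `t` of the crossing edge stand
        -- first and last, and the shared vertex `a` gets index 3.
        g = lookup (s ∷ p ∷ q ∷ a ∷ c ∷ d ∷ t ∷ [])
        surjective : ∀ w → ∃ λ i → g i ≡ w
        surjective w = case region w of λ
          { (inj₁ r) → case or-removed r of λ
              { (inj₁ h) → zero , h
              ; (inj₂ h) → case onlyX h of λ { (inj₁ h) → suc zero , h ; (inj₂ h) → suc (suc zero) , h } }
          ; (inj₂ (inj₁ r)) → suc (suc (suc zero)) , onlyXY r
          ; (inj₂ (inj₂ r)) → case or-removed r of λ
              { (inj₁ h) → last , h
              ; (inj₂ h) → case onlyY h of λ
                  { (inj₁ h) → suc (suc (suc (suc zero))) , h ; (inj₂ h) → suc (suc (suc (suc (suc zero)))) , h } } }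
        open Enumeration (≤-reflexive (sym (+-cancelʳ-≡ 1 n 7 (proj₂ (proj₂ (sizes one)))))) g surjective
        labels : ∀ i → X (g i) ≡ (toℕ i ≤ᵇ 3) × Y (g i) ≡ (3 ≤ᵇ toℕ i)
        labels zero                                     = left s∈
        labels (suc zero)                               = left (proj₁ (∈-∖ p∈))
        labels (suc (suc zero))                         = left (proj₁ (∈-∖ q∈))
        labels (suc (suc (suc zero)))                   = both a∈
        labels (suc (suc (suc (suc zero))))             = right (proj₁ (∈-∖ c∈))
        labels (suc (suc (suc (suc (suc zero)))))       = right (proj₁ (∈-∖ d∈))
        labels (suc (suc (suc (suc (suc (suc zero)))))) = right t∈
        at : ∀ i j → eqᵇ (g i) (g j) ≡ (toℕ i ≡ᵇ toℕ j)
        at i j = trans (eqᵇ-g i j) (code i j)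
          where
          code : ∀ (i j : Fin 7) → eqᵇ i j ≡ (toℕ i ≡ᵇ toℕ j)
          code = toWitness {a? = Fin.all? λ i → Fin.all? λ j → _ ≟ᵇ _} tt

        build : G ≅ H2
        build = isomorphism H2 λ i j →
          trans (two-cliques {X} {Y} (pair s t) (K-clique k) (K-clique l) all
                  (λ {i} {j} h → case pair⇒ s t i j h of λ
                    { (inj₁ (refl , refl)) → s~t ; (inj₂ (refl , refl)) → ~-sym s~t })
                  (pair-sym s t)
                  (λ x y z → let (h , h′) = e≡1⇒≡ edge x y z s∈ t∈ s~t in ⇒pair {s} {t} (inj₁ (h , h′))) (g i) (g j))
            (cong₂ (λ x y → not x ∧ y) (eqᵇ-g i j) (cong₂ _∨_ (cong₂ _∧_ (proj₁ (labels i)) (proj₁ (labels j)))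
              (cong₂ _∨_ (cong₂ _∧_ (proj₂ (labels i)) (proj₂ (labels j)))
                (cong₂ _∨_ (cong₂ _∧_ (at i zero) (at j last)) (cong₂ _∧_ (at i last) (at j zero))))))

    two-K4≅H1 : ∣ X ∩ Y ∣ ≡ 2 → e (X ∖ Y) (Y ∖ X) ≡ 0 → G ≅ H1
    two-K4≅H1 two none =
      let (p , q , p∈ , q∈ , onlyX)  = enumerate₂ (X ∖ Y) (+-cancelʳ-≡ 2 _ 2 (proj₁ (sizes two)))
          (a , b , a∈ , b∈ , onlyXY) = enumerate₂ (X ∩ Y) two
          (c , d , c∈ , d∈ , onlyY)  = enumerate₂ (Y ∖ X) (+-cancelʳ-≡ 2 _ 2 (proj₁ (proj₂ (sizes two))))
      in TwoK4H1.build two none p∈ q∈ onlyX a∈ b∈ onlyXY c∈ d∈ onlyY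

    two-K4≅H2 : ∣ X ∩ Y ∣ ≡ 1 → e (X ∖ Y) (Y ∖ X) ≡ 1 → G ≅ H2
    two-K4≅H2 one edge =
      let (s , t , s∈ , t∈ , s~t)   = e-find (X ∖ Y) (Y ∖ X) (≤-reflexive (sym edge))
          (p , q , p∈ , q∈ , onlyX) = enumerate₂ (X ∖ Y ∖ ⁅ s ⁆)
            (enumerate-suc (X ∖ Y) (+-cancelʳ-≡ 1 _ 3 (proj₁ (sizes one))) s∈)
          (a , a∈ , onlyXY)         = enumerate₁ (X ∩ Y) one
          (c , d , c∈ , d∈ , onlyY) = enumerate₂ (Y ∖ X ∖ ⁅ t ⁆)
            (enumerate-suc (Y ∖ X) (+-cancelʳ-≡ 1 _ 3 (proj₁ (proj₂ (sizes one)))) t∈)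
      in TwoK4H2.build one edge s∈ t∈ s~t p∈ q∈ onlyX a∈ onlyXY c∈ d∈ onlyY

-- The two cases: some node is branching, or none is.

module Conclusion {n : ℕ} (G : Graph n) (circuit : IsCircuit G)
  (no2 : ¬ HasNontrivial2VertexSep G) (no3 : ¬ HasNontrivial3EdgeSep G)
  (¬K5-e : ¬ G ≅ K5-e) (¬H1 : ¬ G ≅ H1) (¬H2 : ¬ G ≅ H2) where

  open Separated G circuit no2 no3

  -- Five edges are not induced by `Y`. The degree sum of the last two vertices is thus at most 6,
  -- reached when they are adjacent, and each degree is at least 3.
  last-two-nodes : ∀ {Y c} → Tight Y → ∣ ∁ Y ∣ ≡ 2 → c ∈ ∁ Y → IsNode G c
  last-two-nodes {Y} {c} tY two c∈ = ≤-antisym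
    (subst (_≤ 3) (full∩ c) (linear 12 (λ f y z x o o′ r d s t m q →
        (f ⊕ con 2 ≈ 4 ⊛ m ∷ f ≈ y ⊕ z ⊕ 2 ⊛ x ∷ s ⊕ t ≈ m ∷ t ≈ con 2 ∷ y ⊕ con 4 ≈ 4 ⊛ s ∷ z ⊕ t ≼ con 4 ∷
         o ≈ z ⊕ o′ ∷ o′ ≼ x ∷ o ≈ d ⊕ r ∷ 3 ⊛ q ≼ r ∷ t ≈ con 1 ⊕ q ∷ []) ⊢ d ≼ con 3)
      (e full full ∷ e Y Y ∷ e (∁ Y) (∁ Y) ∷ e Y (∁ Y) ∷ e (∁ Y) full ∷ e (∁ Y) (∁ (∁ Y)) ∷ e (∁ Y ∖ ⁅ c ⁆) full ∷
        ∣ full ∩ N c ∣ ∷ ∣ Y ∣ ∷ ∣ ∁ Y ∣ ∷ n ∷ ∣ ∁ Y ∖ ⁅ c ⁆ ∣ ∷ [])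
      e-total (e-complement Y) (∣∁∣ Y) two tY
      (subst (λ t → e (∁ Y) (∁ Y) + ∣ ∁ Y ∣ ≤ t * t) two (e≤complete (∁ Y)))
      (e-∁ʳ (∁ Y))
      (≤-trans (≤-reflexive (e-sym (∁ Y) (∁ (∁ Y)))) (e-mono (λ p → ∈-∁∁ (∈-∁ p)) id))
      (e-split full c∈)
      (degrees≥ λ {v} _ → subst (3 ≤_) (sym (full∩ v)) (degree≥3 v))
      (remove c∈)))
    (degree≥3 c)
    where
    full∩ : ∀ v → ∣ full ∩ N v ∣ ≡ degree G v
    full∩ v = ≤-antisym (countB-mono {P = full ∩ N v} (proj₂ ∘ ∈-∩)) (countB-mono {P = N v} (∩-∈ ∈-full))
    ∈-∁∁ : ∀ {i} → i ∉ ∁ Y → i ∈ Y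
    ∈-∁∁ {i} p = case i ∈? Y of λ { (inj₁ q) → q ; (inj₂ q) → ⊥-elim (∈-∉ (∁-∈ q) p) }

  module _ {X u} (tX : Tight X) (k : InK4 u) (cr : Crossing X u) where

    private
      module C = Crossing cr
      p : Fin n
      p = proj₁ (find (X ∩ K u) (≤-reflexive (sym C.one)))
      p∈ : p ∈ X ∩ K u
      p∈ = proj₂ (find (X ∩ K u) (≤-reflexive (sym C.one)))
      p∈X = proj₁ (∈-∩ p∈)
      p∈K = proj₂ (∈-∩ p∈)
      only : ∀ {i} → i ∈ X → i ∈ K u → p ≡ i
      only a b = ∣∣≡1⇒≡ C.one p∈ (∩-∈ a b)
      X∖K≥ : ∀ {l} → suc l ≤ ∣ X ∣ → l ≤ ∣ X ∖ K u ∣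
      X∖K≥ h = ≤-pred (≤-trans h (≤-reflexive (trans (∣∣-split X (K u)) (cong (_+ ∣ X ∖ K u ∣) C.one))))
      K≥4 : 4 ≤ ∣ K u ∣
      K≥4 = ≤-reflexive (sym (K-size k))

    -- The common vertex `p` and the end `s` in `X` of the only crossing edge separate the K₄ from
    -- the rest; both sides have at least five vertices.
    covering⇒⊥ : 5 ≤ ∣ X ∣ → (∀ {w} → w ∈ X ∪ K u) → e (X ∖ K u) (K u ∖ X) ≡ 1 → ⊥
    covering⇒⊥ X≥5 all one with e-find (X ∖ K u) (K u ∖ X) (≤-reflexive (sym one))
    ... | s , t , s∈ , t∈ , s~t with findOther (X ∖ K u) s (≤-trans (s≤s (s≤s z≤n)) (X∖K≥ X≥5))
    ...   | w , w∈ , s≢w = no-2-vertex-separation {K u ∪ ⁅ s ⁆} {X} {p} {s} {t} {w}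
      (λ i → case ∈-∪ (all {i}) of λ { (inj₁ a) → inj₂ a ; (inj₂ a) → inj₁ (∪-∈ˡ a) })
      (λ {i} {j} h → edges h (i ∈? X) (j ∈? X) (i ∈? K u) (j ∈? K u))
      (∩-∈ (∪-∈ˡ p∈K) p∈X) (∩-∈ (∪-∈ʳ (⁅⁆-refl s)) (proj₁ (∈-∖ s∈)))
      (∈∧∉⇒≢ p∈K (proj₂ (∈-∖ s∈)))
      (λ a b → case ∈-∪ a of λ { (inj₁ c) → inj₁ (only b c) ; (inj₂ c) → inj₂ (∈-⁅⁆ c) })
      (∪-∈ˡ (proj₁ (∈-∖ t∈))) (proj₂ (∈-∖ t∈))
      (proj₁ (∈-∖ w∈)) (∪-∉ (proj₂ (∈-∖ w∈)) (∉-⁅⁆ s≢w))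
      (¬K4-size (subst (5 ≤_) (sym (insert (proj₂ (∈-∖ s∈)))) (s≤s K≥4))) (¬K4-size X≥5)
      where
      other : ∀ {i} → i ∉ X → i ∈ K u
      other a = case ∈-∪ all of λ { (inj₁ b) → ⊥-elim (∈-∉ b a) ; (inj₂ b) → b }
      here : ∀ {i j} → i ∈ X ∖ K u → j ∈ K u ∖ X → i ~ j → i ∈ K u ∪ ⁅ s ⁆ × j ∈ K u ∪ ⁅ s ⁆
      here a b h = ∪-∈ʳ (subst (_∈ ⁅ s ⁆) (proj₁ (e≡1⇒≡ one s∈ t∈ s~t a b h)) (⁅⁆-refl s)) , ∪-∈ˡ (proj₁ (∈-∖ b))
      edges : ∀ {i j} → i ~ j → i ∈ X ⊎ i ∉ X → j ∈ X ⊎ j ∉ X → i ∈ K u ⊎ i ∉ K u → j ∈ K u ⊎ j ∉ K u →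
              (i ∈ K u ∪ ⁅ s ⁆ × j ∈ K u ∪ ⁅ s ⁆) ⊎ (i ∈ X × j ∈ X)
      edges h (inj₁ a) (inj₁ b) _ _ = inj₂ (a , b)
      edges h (inj₂ a) (inj₂ b) _ _ = inj₁ (∪-∈ˡ (other a) , ∪-∈ˡ (other b))
      edges h (inj₁ a) (inj₂ b) (inj₁ c) _ = inj₁ (∪-∈ˡ c , ∪-∈ˡ (other b))
      edges h (inj₁ a) (inj₂ b) (inj₂ c) _ = inj₁ (here (∖-∈ a c) (∖-∈ (other b) b) h)
      edges h (inj₂ a) (inj₁ b) _ (inj₁ c) = inj₁ (∪-∈ˡ (other a) , ∪-∈ˡ c)
      edges h (inj₂ a) (inj₁ b) _ (inj₂ c) =
        inj₁ (let (x , y) = here (∖-∈ b c) (∖-∈ (other a) a) (~-sym h) in y , x)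

    -- With no edge across, `X` and the K₄ are connected only through the common vertex `p` and the
    -- last vertex `w`, which form a separating pair.
    almost-covering⇒⊥ : 4 ≤ ∣ X ∣ → ∣ ∁ (X ∪ K u) ∣ ≡ 1 → e (X ∖ K u) (K u ∖ X) ≡ 0 → ⊥
    almost-covering⇒⊥ X≥4 one none with find (∁ (X ∪ K u)) (≤-reflexive (sym one))
      | find (X ∖ K u) (≤-trans (s≤s z≤n) (X∖K≥ X≥4))
      | findOther (K u) p (≤-trans (s≤s (s≤s z≤n)) K≥4)
    ... | w , w∈ | x , x∈ | y , y∈K , p≢y = no-2-vertex-separation {K u ∪ ⁅ w ⁆} {X ∪ ⁅ w ⁆} {p} {w} {y} {x}
      (λ i → cover (place i))
      (λ {i} {j} → edges (place i) (place j))
      (∩-∈ (∪-∈ˡ p∈K) (∪-∈ˡ p∈X)) (∩-∈ (∪-∈ʳ (⁅⁆-refl w)) (∪-∈ʳ (⁅⁆-refl w)))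
      (∈∧∉⇒≢ p∈X w∉X)
      (λ a b → case ∈-∪ a of λ
        { (inj₂ c) → inj₂ (∈-⁅⁆ c)
        ; (inj₁ c) → case ∈-∪ b of λ { (inj₂ d) → inj₂ (∈-⁅⁆ d) ; (inj₁ d) → inj₁ (only d c) } })
      (∪-∈ˡ y∈K) (∪-∉ (¬∈⇒∉ λ a → p≢y (only a y∈K)) (∉-⁅⁆ (∈∧∉⇒≢ y∈K w∉K ∘ sym)))
      (∪-∈ˡ (proj₁ (∈-∖ x∈))) (∪-∉ (proj₂ (∈-∖ x∈)) (∉-⁅⁆ (∈∧∉⇒≢ (proj₁ (∈-∖ x∈)) w∉X ∘ sym)))
      (¬K4-size (subst (5 ≤_) (sym (insert w∉K)) (s≤s K≥4)))
      (¬K4-size (subst (5 ≤_) (sym (insert w∉X)) (s≤s X≥4)))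
      where
      w∉X : w ∉ X
      w∉X = ¬∈⇒∉ λ a → ∈-∉ (∪-∈ˡ a) (∈-∁ w∈)
      w∉K : w ∉ K u
      w∉K = ¬∈⇒∉ λ a → ∈-∉ (∪-∈ʳ a) (∈-∁ w∈)
      place : ∀ i → i ∈ X ⊎ i ∈ K u ⊎ i ∈ ⁅ w ⁆
      place i with i ∈? X | i ∈? K u
      ... | inj₁ a | _      = inj₁ a
      ... | inj₂ _ | inj₁ b = inj₂ (inj₁ b)
      ... | inj₂ a | inj₂ b = inj₂ (inj₂ (subst (_∈ ⁅ w ⁆) (∣∣≡1⇒≡ one w∈ (∁-∈ (∪-∉ a b))) (⁅⁆-refl w)))
      cover : ∀ {i} → i ∈ X ⊎ i ∈ K u ⊎ i ∈ ⁅ w ⁆ → i ∈ K u ∪ ⁅ w ⁆ ⊎ i ∈ X ∪ ⁅ w ⁆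
      cover (inj₁ a)        = inj₂ (∪-∈ˡ a)
      cover (inj₂ (inj₁ a)) = inj₁ (∪-∈ˡ a)
      cover (inj₂ (inj₂ a)) = inj₁ (∪-∈ʳ a)
      opposite : ∀ {i j} → i ∈ X → j ∈ K u → i ~ j →
                 (i ∈ K u ∪ ⁅ w ⁆ × j ∈ K u ∪ ⁅ w ⁆) ⊎ (i ∈ X ∪ ⁅ w ⁆ × j ∈ X ∪ ⁅ w ⁆)
      opposite {i} {j} a b h with i ∈? K u | j ∈? X
      ... | inj₁ c | _      = inj₁ (∪-∈ˡ c , ∪-∈ˡ b)
      ... | inj₂ _ | inj₁ c = inj₂ (∪-∈ˡ a , ∪-∈ˡ c)
      ... | inj₂ c | inj₂ d = ⊥-elim (e≡0⇒¬~ none (∖-∈ a c) (∖-∈ b d) h)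
      edges : ∀ {i j} → i ∈ X ⊎ i ∈ K u ⊎ i ∈ ⁅ w ⁆ → j ∈ X ⊎ j ∈ K u ⊎ j ∈ ⁅ w ⁆ → i ~ j →
              (i ∈ K u ∪ ⁅ w ⁆ × j ∈ K u ∪ ⁅ w ⁆) ⊎ (i ∈ X ∪ ⁅ w ⁆ × j ∈ X ∪ ⁅ w ⁆)
      edges (inj₁ a)        (inj₁ b)        _ = inj₂ (∪-∈ˡ a , ∪-∈ˡ b)
      edges (inj₁ a)        (inj₂ (inj₂ b)) _ = inj₂ (∪-∈ˡ a , ∪-∈ʳ b)
      edges (inj₂ (inj₁ a)) (inj₂ (inj₁ b)) _ = inj₁ (∪-∈ˡ a , ∪-∈ˡ b)
      edges (inj₂ (inj₁ a)) (inj₂ (inj₂ b)) _ = inj₁ (∪-∈ˡ a , ∪-∈ʳ b)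
      edges (inj₂ (inj₂ a)) (inj₁ b)        _ = inj₂ (∪-∈ʳ a , ∪-∈ˡ b)
      edges (inj₂ (inj₂ a)) (inj₂ (inj₁ b)) _ = inj₁ (∪-∈ʳ a , ∪-∈ˡ b)
      edges (inj₂ (inj₂ a)) (inj₂ (inj₂ b)) _ = inj₁ (∪-∈ʳ a , ∪-∈ʳ b)
      edges (inj₁ a)        (inj₂ (inj₁ b)) h = opposite a b h
      edges (inj₂ (inj₁ a)) (inj₁ b)        h =
        case opposite b a (~-sym h) of λ { (inj₁ (x , y)) → inj₁ (y , x) ; (inj₂ (x , y)) → inj₂ (y , x) }

  module _ (Admissible : Fin n → Set)
    (reduce : ∀ {v p q r} → IsNode G v → v ~ p → v ~ q → v ~ r → p ≢ q → p ≢ r → q ≢ r →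
              ¬ p ~ q → ¬ Blocked v r → Admissible v) where

    open Classification Admissible reduce

    TwoAdmissible : Set
    TwoAdmissible = ∃₂ λ v w → v ≢ w × Admissible v × Admissible w

    two-from : ∀ (S : VSet n) → 2 ≤ ∣ S ∣ → (∀ {v} → v ∈ S → Admissible v) → TwoAdmissible
    two-from S h adm = let (v , w , a , b , v≢w) = find₂ S h in v , w , v≢w , adm a , adm b

    good⇒admissible : ∀ {v} → Good v → ¬ Branching v → Admissible v
    good⇒admissible (node , ¬k) ¬b = case classify node of λ
      { (inj₁ a) → a ; (inj₂ (inj₁ k)) → ⊥-elim (¬k k) ; (inj₂ (inj₂ b)) → ⊥-elim (¬b b) }

    fresh⇒admissible : ∀ {F M w} → (∀ {v} → v ∈ F → Branching v) → (∀ {v} → v ∈ M → IsNode G v) →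
      (∀ {v} → v ∈ M → Branching v → v ∈ F) → FreshNeighbour F M w → Admissible w
    fresh⇒admissible bF nM bM f = good⇒admissible
      (nM ∈M , branching⇒¬neighbourInK4 (bF g∈F) g~w) λ b → ∈-∉ (bM ∈M b) ∉F
      where open FreshNeighbour f

    module Branch {v a} (b : Branching v) (v~a : v ~ a) (a-big : ¬ IsNode G a) {Z} (kZ : Critical v a Z) where

      private module Z = Critical kZ

      -- The situation of this module with a strictly larger critical set. Sizes are bounded by `n`,
      -- so `branch` can recurse on it.
      Enlarged : Set
      Enlarged = ∃₂ λ u r → Branching u × u ~ r × ¬ IsNode G r × (∃ λ W → Critical u r W × ∣ Z ∣ < ∣ W ∣)

      x : Fin n
      x = proj₁ (neighbour₂ a (proj₁ b))
      v~x : v ~ x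
      v~x = proj₁ (proj₂ (neighbour₂ a (proj₁ b)))
      a≢x : a ≢ x
      a≢x = proj₂ (proj₂ (neighbour₂ a (proj₁ b)))
      y : Fin n
      y = proj₁ (neighbour₃ (proj₁ b) v~a v~x a≢x)
      v~y : v ~ y
      v~y = proj₁ (proj₂ (neighbour₃ (proj₁ b) v~a v~x a≢x))
      a≢y : a ≢ y
      a≢y = proj₁ (proj₂ (proj₂ (neighbour₃ (proj₁ b) v~a v~x a≢x)))
      x≢y : x ≢ y
      x≢y = proj₂ (proj₂ (proj₂ (neighbour₃ (proj₁ b) v~a v~x a≢x)))

      start : Tight (Z ∪ ⁅ v ⁆)
      start = tight-insert Z.tight Z.v∉ (count≡2 (∩-∈ (Z.rest v~x a≢x) (∈⁺ v~x)) (∩-∈ (Z.rest v~y a≢y) (∈⁺ v~y)) x≢y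
        λ h → let (p , q) = ∈-∩ h in case neighbours-complete (proj₁ b) v~a v~x v~y a≢x a≢y x≢y (∈⁻ q) of λ
          { (inj₁ refl) → ⊥-elim (∈-∉ p Z.r∉) ; (inj₂ r) → r })

      Avoiding : VSet n → Set
      Avoiding Y = Tight Y × a ∉ Y

      extension : ∃ λ X → Z ∪ ⁅ v ⁆ ⊆ X × Maximal Avoiding X
      extension = extendToMaximal {P = Avoiding}
        (λ h (t , p) → Tight-ext h t , ∉⁺ (trans (sym (h a)) (∉⁻ p)))
        (λ Y → Tight? Y ×-dec ∉-dec a Y)
        (Z ∪ ⁅ v ⁆) (start , ∪-∉ Z.r∉ (∉-⁅⁆ (~⇒≢ v~a)))

      module Extension {X} (Z⊆X : Z ∪ ⁅ v ⁆ ⊆ X) (tX : Tight X) (a∉X : a ∉ X)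
        (maximal : ∀ Y → Tight Y → a ∉ Y → X ⊆ Y → Y ⊆ X) where

        v∈X : v ∈ X
        v∈X = Z⊆X (∪-∈ʳ (⁅⁆-refl v))

        Z<X : ∣ Z ∣ < ∣ X ∣
        Z<X = subst (_≤ ∣ X ∣) (insert Z.v∉) (countB-mono {P = Z ∪ ⁅ v ⁆} Z⊆X)

        X≥5 : 5 ≤ ∣ X ∣
        X≥5 = ≤-trans (s≤s (tight-size Z.tight (count≥2 (Z.rest v~x a≢x) (Z.rest v~y a≢y) x≢y))) Z<X

        -- With only one or two vertices missing, the edge count would turn `a` into a node.
        ∁≥3 : 3 ≤ ∣ ∁ X ∣
        ∁≥3 with ∣ ∁ X ∣ in eq
        ... | 0 = ⊥-elim (∈-∉ (∁-∈ a∉X) (∣∣≡0⇒∉ eq))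
        ... | 1 = ⊥-elim (a-big (proj₁ (last-vertex tX a∉X λ {w} → case w ∈? X of λ
                    { (inj₁ p) → ∪-∈ˡ p
                    ; (inj₂ p) → ∪-∈ʳ (subst (_∈ ⁅ a ⁆) (∣∣≡1⇒≡ eq (∁-∈ a∉X) (∁-∈ p)) (⁅⁆-refl a)) })))
        ... | 2 = ⊥-elim (a-big (last-two-nodes tX eq (∁-∈ a∉X)))
        ... | suc (suc (suc _)) = s≤s (s≤s (s≤s z≤n))

        v∉K : ∀ {u} → InK4 u → v ∉ K u
        v∉K k = ¬∈⇒∉ λ h → case ∈-∪ h of λ
          { (inj₁ (∈⁺ u~v)) → branching⇒¬neighbourInK4 b (~-sym u~v) k
          ; (inj₂ h) → branching⇒¬InK4 b (subst InK4 (∈-⁅⁆ h) k) }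

        -- A crossing K₄ cannot cover the rest, since `X` has five vertices. Otherwise its union
        -- with `X` is tight: without `a` it contradicts maximality, and with `a` the edge from `v`
        -- to `a` runs across, as `v` lies in no K₄ around a node.
        closed : Closed X
        closed {u} {i} k i∈K i∈X = case K u ⊆? X of λ
          { (yes s) → s
          ; (no ¬s) → ⊥-elim (¬s (contained (crossing tX ∁≥3 k i∈K i∈X ¬s))) }
          where
          contained : Crossing X u → K u ⊆ X
          contained cr with Crossing.cases cr
          ... | inj₁ (all , one) = ⊥-elim (covering⇒⊥ tX k cr X≥5 all one)
          ... | inj₂ (t , none) with a ∈? K u
          ...   | inj₁ a∈K = ⊥-elim (e≡0⇒¬~ none (∖-∈ v∈X (v∉K k)) (∖-∈ a∈K a∉X) v~a)
          ...   | inj₂ a∉K = λ p → maximal (X ∪ K u) t (∪-∉ a∉X a∉K) ∪-∈ˡ (∪-∈ʳ p)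

        InF : Fin n → Set
        InF u = Branching u × u ∉ X

        InM : Fin n → Set
        InM u = IsNode G u × u ∉ X

        F M : VSet n
        F = ⟪ (λ u → Branching? u ×-dec ∉-dec u X) ⟫
        M = ⟪ (λ u → IsNode? u ×-dec ∉-dec u X) ⟫

        F⇒ : ∀ {u} → u ∈ F → InF u
        F⇒ = ∈-⟪⟫
        M⇒ : ∀ {u} → u ∈ M → InM u
        M⇒ = ∈-⟪⟫

        -- The union is tight because `u` lies outside both sets, and it is larger than `Z` because
        -- `X` contains `Z` and `v`.
        enlarge : ∀ {u r W i} → Branching u → u ∉ X → u ~ r → r ∉ X → ¬ IsNode G r → Critical u r W →
                  i ∈ W → i ∈ X → Enlarged
        enlarge {u} {r} {W} bu u∉X u~r r∉X r-big k i∈W i∈X = u , r , bu , u~r , r-big , W ∪ X ,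
          record { tight = proj₁ (uncross W.tight tX i∈W i∈X W.v∉ u∉X) ; v∉ = ∪-∉ W.v∉ u∉X ; r∉ = ∪-∉ W.r∉ r∉X
                 ; rest = λ p q → ∪-∈ˡ (W.rest p q) } ,
          ≤-trans Z<X (countB-mono {P = X} ∪-∈ʳ)
          where module W = Critical k

        outer : ∀ {r} → r ∉ M → r ∉ X → ¬ IsNode G r
        outer r∉M r∉X node = ∈-∉ (⟪⟫-∈ (node , r∉X)) r∉M

        -- Three neighbours in `X` would leave no room for `a`, and exactly two would let `X` grow
        -- by `u` while avoiding `a`; here `a` differs from `u` because `u` is a node.
        two-in-X : ∀ {u r q} → Branching u → u ∉ X → r ∈ X → q ∈ X → u ~ r → u ~ q → r ≢ q → ⊥
        two-in-X {u} {r} {q} bu u∉X r∈X q∈X u~r u~q r≢q with 3 ≤? ∣ X ∩ N u ∣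
        ... | yes three = case ∈-∪ (insert-full tX u∉X three {a}) of λ
                { (inj₁ p) → ∈-∉ p a∉X ; (inj₂ p) → a-big (subst (IsNode G) (∈-⁅⁆ p) (proj₁ bu)) }
        ... | no small = ∈-∉ (maximal (X ∪ ⁅ u ⁆) (tight-insert tX u∉X
                (≤-antisym (≤-pred (≰⇒> small)) (count≥2 (∩-∈ r∈X (∈⁺ u~r)) (∩-∈ q∈X (∈⁺ u~q)) r≢q)))
                (∪-∉ a∉X (∉-⁅⁆ λ { refl → a-big (proj₁ bu) })) ∪-∈ˡ (∪-∈ʳ (⁅⁆-refl u))) u∉X

        -- Two neighbours of `u` lie in `X` or are not nodes, and not both lie in `X`. If one does,
        -- it belongs to the critical set of the other. If none does, the two critical sets cover
        -- `v`, so one of them meets `X`.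
        few-nodes⇒enlarged : ∀ {u} → u ∈ F → ¬ 2 ≤ ∣ M ∩ N u ∣ → Enlarged
        few-nodes⇒enlarged {u} u∈F few = cases (find₂ (N u ∖ M) twoOutside)
          where
          bu = proj₁ (F⇒ u∈F)
          u∉X = proj₂ (F⇒ u∈F)
          twoOutside : 2 ≤ ∣ N u ∖ M ∣
          twoOutside = linear 4 (λ t i o j → (t ≈ con 3 ∷ t ≈ i ⊕ o ∷ i ≼ j ∷ con 1 ⊕ j ≼ con 2 ∷ []) ⊢ con 2 ≼ o)
            (∣ N u ∣ ∷ ∣ N u ∩ M ∣ ∷ ∣ N u ∖ M ∣ ∷ ∣ M ∩ N u ∣ ∷ []) (proj₁ bu) (∣∣-split (N u) M)
            (countB-mono {P = N u ∩ M} λ h → let (p , q) = ∈-∩ h in ∩-∈ q p) (≰⇒> few)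
          cases : (∃₂ λ r q → r ∈ N u ∖ M × q ∈ N u ∖ M × r ≢ q) → Enlarged
          cases (r , q , r∈ , q∈ , r≢q) = go (r ∈? X) (q ∈? X)
            where
            u~r = ∈⁻ (proj₁ (∈-∖ r∈))
            u~q = ∈⁻ (proj₁ (∈-∖ q∈))
            r∉M = proj₂ (∈-∖ r∈)
            q∉M = proj₂ (∈-∖ q∈)
            kr = proj₂ (proj₂ bu u~r)
            kq = proj₂ (proj₂ bu u~q)
            go : r ∈ X ⊎ r ∉ X → q ∈ X ⊎ q ∉ X → Enlarged
            go (inj₁ r∈X) (inj₁ q∈X) = ⊥-elim (two-in-X bu u∉X r∈X q∈X u~r u~q r≢q)
            go (inj₂ r∉X) (inj₁ q∈X) =
              enlarge bu u∉X u~r r∉X (outer r∉M r∉X) kr (Critical.rest kr u~q r≢q) q∈X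
            go (inj₁ r∈X) (inj₂ q∉X) =
              enlarge bu u∉X u~q q∉X (outer q∉M q∉X) kq (Critical.rest kq u~r (r≢q ∘ sym)) r∈X
            go (inj₂ r∉X) (inj₂ q∉X) = case critical-cover (proj₁ bu) u~r u~q r≢q kr kq (∈∧∉⇒≢ v∈X u∉X ∘ sym) of λ
              { (inj₁ h) → enlarge bu u∉X u~r r∉X (outer r∉M r∉X) kr h v∈X
              ; (inj₂ h) → enlarge bu u∉X u~q q∉X (outer q∉M q∉X) kq h v∈X }

        many-nodes⇒two : (∀ {u} → u ∈ F → 2 ≤ ∣ M ∩ N u ∣) → TwoAdmissible
        many-nodes⇒two many = case Fin.any? (λ u → ∈-dec u F) of λ
          { (yes (f , f∈F)) → two-from ⟪ FreshNeighbour? F M ⟫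
              (two-fresh-neighbours f∈F (λ h → let (p , q) = F⇒ h in ⟪⟫-∈ (proj₁ p , q))
                (¬∈⇒∉ λ h → ∈-∉ v∈X (proj₂ (M⇒ h))) (proj₁ ∘ M⇒) many)
              (λ h → fresh⇒admissible (proj₁ ∘ F⇒) (proj₁ ∘ M⇒) (λ p q → ⟪⟫-∈ (q , proj₂ (M⇒ p))) (∈-⟪⟫ h))
          ; (no none) → two-from (good ∖ X)
              (two-good-outside tX (≤-trans (s≤s (s≤s z≤n)) X≥5) (≤-trans (s≤s (s≤s z≤n)) ∁≥3) closed)
              (λ h → let (p , q) = ∈-∖ h in good⇒admissible (∈-⟪⟫ p) λ bu → none (_ , ⟪⟫-∈ (bu , q))) }

        result : TwoAdmissible ⊎ Enlarged
        result = case Fin.any? (λ u → ∈-dec u F ×-dec ¬? (2 ≤? ∣ M ∩ N u ∣)) of λ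
          { (yes (u , u∈F , few)) → inj₂ (few-nodes⇒enlarged u∈F few)
          ; (no none) → inj₁ (many-nodes⇒two λ {u} h → case 2 ≤? ∣ M ∩ N u ∣ of λ
              { (yes p) → p ; (no p) → ⊥-elim (none (u , h , p)) }) }

      two-or-enlarged : TwoAdmissible ⊎ Enlarged
      two-or-enlarged = let (X , Z⊆X , (tX , a∉X) , maximal) = extension in
        Extension.result Z⊆X tX a∉X (λ Y t p → maximal Y (t , p))

    branch : ∀ {v a Z} → Branching v → v ~ a → ¬ IsNode G a → Critical v a Z → Acc _<_ (n ∸ ∣ Z ∣) → TwoAdmissible
    branch b v~a a-big kZ (acc rs) = case Branch.two-or-enlarged b v~a a-big kZ of λ
      { (inj₁ two) → two
      ; (inj₂ (u , r , bu , u~r , r-big , W , kW , larger)) →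
          branch bu u~r r-big kW (rs (∸-monoʳ-< larger (∣∣≤n W))) }

    nodes : VSet n
    nodes = ⟪ IsNode? ⟫

    all-neighbours-nodes : ∀ {v} → Branching v → (∀ {u a} → Branching u → u ~ a → IsNode G a) → TwoAdmissible
    all-neighbours-nodes {v} b nbr = two-from ⟪ FreshNeighbour? F nodes ⟫
      (two-fresh-neighbours {F} {nodes} {v} (⟪⟫-∈ b) (λ h → ⟪⟫-∈ (proj₁ (F⇒ h))) (proj₂ missing) ∈-⟪⟫
        λ {u} h → let bu = F⇒ h in ≤-trans (s≤s (s≤s z≤n)) (≤-trans (≤-reflexive (sym (proj₁ bu)))
          (countB-mono {P = N u} λ p → ∩-∈ (⟪⟫-∈ (nbr bu (∈⁻ p))) p)))
      (λ h → fresh⇒admissible F⇒ ∈-⟪⟫ (λ _ → ⟪⟫-∈) (∈-⟪⟫ h))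
      where
      F : VSet n
      F = ⟪ Branching? ⟫
      F⇒ : ∀ {u} → u ∈ F → Branching u
      F⇒ = ∈-⟪⟫
      -- The degree sum 4n - 2 exceeds 3n, so not every vertex is a node.
      missing : ∃ (_∉ nodes)
      missing = case full-or-missing nodes of λ
        { (inj₂ m) → m
        ; (inj₁ all) → absurd (linear 3 (λ f s m → (f ⊕ con 2 ≈ 4 ⊛ m ∷ f ≼ 3 ⊛ s ∷ s ≈ m ∷ con 5 ≼ m ∷ []) ⊢ con 1 ≼ con 0)
            (e full full ∷ ∣ full {n} ∣ ∷ n ∷ []) e-total
            (degrees≤ λ {u} _ → ≤-trans (countB-mono {P = full ∩ N u} (proj₂ ∘ ∈-∩)) (≤-reflexive (∈-⟪⟫ (all {u}))))
            (∣full∣ n) n≥5) }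

    -- No branching nodes: tight sets around a K₄.

    module NoBranching (none : ∀ {v} → ¬ Branching v) where

      good⇒adm : ∀ {v} → Good v → Admissible v
      good⇒adm g = good⇒admissible g none

      -- Nodes have degree three and all other vertices at least four; a degree sum of 4n - 2
      -- therefore needs two nodes.
      no-K4 : (∀ {u} → ¬ InK4 u) → TwoAdmissible
      no-K4 ¬k = two-from nodes
        (linear 7 (λ f c a b s t m →
            (f ⊕ con 2 ≈ 4 ⊛ m ∷ c ≈ a ⊕ b ∷ c ≼ f ∷ 3 ⊛ s ≼ a ∷ 4 ⊛ t ≼ b ∷ s ⊕ t ≈ m ∷ []) ⊢ con 2 ≼ s)
          (e full full ∷ e (nodes ∪ ∁ nodes) full ∷ e nodes full ∷ e (∁ nodes) full ∷ ∣ nodes ∣ ∷ ∣ ∁ nodes ∣ ∷ n ∷ [])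
          e-total (e-∪ˡ-disjoint full λ p q → ∈-∉ p (∈-∁ q)) (e-mono (λ _ → ∈-full) id)
          (degrees≥ λ {v} _ → full-degree (degree≥3 v))
          (degrees≥ λ {v} h → full-degree (≤∧≢⇒< (degree≥3 v) λ eq → ∈-∉ (⟪⟫-∈ {P? = IsNode?} (sym eq)) (∈-∁ h)))
          (∣∁∣ nodes))
        λ h → good⇒adm (∈-⟪⟫ h , ¬k)
        where
        full-degree : ∀ {v l} → l ≤ degree G v → l ≤ ∣ full ∩ N v ∣
        full-degree {v} h = ≤-trans h (countB-mono {P = N v} (∩-∈ ∈-full))

      last-two : ∀ {Y} → Tight Y → ∣ ∁ Y ∣ ≡ 2 → (∀ {c} → c ∈ ∁ Y → ¬ InK4 c) → TwoAdmissible
      last-two {Y} tY two ¬k = two-from (∁ Y) (≤-reflexive (sym two)) λ h → good⇒adm (last-two-nodes tY two h , ¬k h)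

      module _ {u₀} (k₀ : InK4 u₀) where

        K₀ = K u₀

        ∁K₀ : ∣ ∁ K₀ ∣ + 4 ≡ n
        ∁K₀ = trans (+-comm ∣ ∁ K₀ ∣ 4) (trans (cong (_+ ∣ ∁ K₀ ∣) (sym (K-size k₀))) (∣∁∣ K₀))

        two-in : ∀ {Y c} → ∣ ∁ Y ∣ ≡ 2 → InK4 c → 2 ≤ ∣ Y ∩ K c ∣
        two-in {Y} {c} two k = linear 4 (λ s i d t → (s ≈ con 4 ∷ s ≈ i ⊕ d ∷ d ≼ t ∷ t ≈ con 2 ∷ []) ⊢ con 2 ≼ i)
          (∣ K c ∣ ∷ ∣ Y ∩ K c ∣ ∷ ∣ K c ∖ Y ∣ ∷ ∣ ∁ Y ∣ ∷ []) (K-size k)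
          (trans (∣∣-split (K c) Y) (cong (_+ ∣ K c ∖ Y ∣) (≤-antisym
            (countB-mono {P = K c ∩ Y} λ h → let (p , q) = ∈-∩ h in ∩-∈ q p)
            (countB-mono {P = Y ∩ K c} λ h → let (p , q) = ∈-∩ h in ∩-∈ q p))))
          (countB-mono {P = K c ∖ Y} (∁-∈ ∘ proj₂ ∘ ∈-∖)) two

        one-left : ∣ ∁ K₀ ∣ ≡ 1 → ⊥
        one-left one = let (w , w∈) = find (∁ K₀) (≤-reflexive (sym one)) in
          ¬K5-e (K4∪vertex≅K5-e {w = w} k₀ (∈-∁ w∈) λ {i} → case i ∈? K₀ of λ
            { (inj₁ p) → ∪-∈ˡ p
            ; (inj₂ p) → ∪-∈ʳ (subst (_∈ ⁅ w ⁆) (∣∣≡1⇒≡ one w∈ (∁-∈ p)) (⁅⁆-refl w)) })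

        -- The second K₄ shares at least two vertices with `K₀`. If their union were proper, the
        -- intersection would be tight and thus of order four, putting `c` into `K₀`. So the union
        -- is everything, n is 6, and the 11 edges are those of two K₄'s with a common edge.
        two-left : ∣ ∁ K₀ ∣ ≡ 2 → ∀ {c} → c ∈ ∁ K₀ → ¬ InK4 c
        two-left two {c} c∈ k = ¬H1 (two-K4≅H1 k₀ k all common none′)
          where
          shared : ∃ (_∈ K₀ ∩ K c)
          shared = find (K₀ ∩ K c) (≤-trans (s≤s z≤n) (two-in two k))
          all : ∀ {w} → w ∈ K₀ ∪ K c
          all = case full-or-missing (K₀ ∪ K c) of λ
            { (inj₁ h) → h
            ; (inj₂ (w , w∉)) → ⊥-elim (∈-∉ (proj₁ (∈-∩ (⊆∧≥⇒⊇ {X = K₀ ∩ K c} (proj₂ ∘ ∈-∩)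
                (subst (_≤ ∣ K₀ ∩ K c ∣) (sym (K-size k)) (tight-size (proj₁ (proj₂ (uncross (K-tight k₀) (K-tight k)
                  (proj₁ (∈-∩ (proj₂ shared))) (proj₂ (∈-∩ (proj₂ shared)))
                  (¬∈⇒∉ λ p → ∈-∉ (∪-∈ˡ p) w∉) (¬∈⇒∉ λ p → ∈-∉ (∪-∈ʳ p) w∉)))) (two-in two k)))
                (K-centre c)))) (∈-∁ c∈)) }
          common : ∣ K₀ ∩ K c ∣ ≡ 2
          common = linear 6
            (λ u i x y z m → (u ⊕ i ≈ x ⊕ y ∷ x ≈ con 4 ∷ y ≈ con 4 ∷ z ⊕ con 4 ≈ m ∷ z ≈ con 2 ∷ u ≈ m ∷ []) ⊢ i ≈ con 2)
            (∣ K₀ ∪ K c ∣ ∷ ∣ K₀ ∩ K c ∣ ∷ ∣ K₀ ∣ ∷ ∣ K c ∣ ∷ ∣ ∁ K₀ ∣ ∷ n ∷ [])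
            (∣∪∣+∣∩∣ K₀ (K c)) (K-size k₀) (K-size k) ∁K₀ two (all⇒∣∣≡n all)
          none′ : e (K₀ ∖ K c) (K c ∖ K₀) ≡ 0
          none′ = linear 10 (λ u i x y d f m s t z → (u ⊕ i ≈ x ⊕ y ⊕ 2 ⊛ d ∷ u ≈ f ∷ f ⊕ con 2 ≈ 4 ⊛ m ∷ i ⊕ con 2 ≈ con 4 ∷
              x ⊕ con 4 ≈ 4 ⊛ s ∷ s ≈ con 4 ∷ y ⊕ con 4 ≈ 4 ⊛ t ∷ t ≈ con 4 ∷ z ⊕ con 4 ≈ m ∷ z ≈ con 2 ∷ []) ⊢ d ≈ con 0)
            (e (K₀ ∪ K c) (K₀ ∪ K c) ∷ e (K₀ ∩ K c) (K₀ ∩ K c) ∷ e K₀ K₀ ∷ e (K c) (K c) ∷ e (K₀ ∖ K c) (K c ∖ K₀) ∷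
              e full full ∷ n ∷ ∣ K₀ ∣ ∷ ∣ K c ∣ ∷ ∣ ∁ K₀ ∣ ∷ [])
            (e-uncross K₀ (K c)) (proj₁ (full-e all)) e-total
            (subst (λ t → e (K₀ ∩ K c) (K₀ ∩ K c) + t ≡ t * t) common
              (e-clique (K₀ ∩ K c) λ p q → K-clique k (proj₂ (∈-∩ p)) (proj₂ (∈-∩ q))))
            (K-tight k₀) (K-size k₀) (K-tight k) (K-size k) ∁K₀ two

        module Large {X} (K₀⊆X : K₀ ⊆ X) (tX : Tight X) (∁≥3 : 3 ≤ ∣ ∁ X ∣)
          (maximal : ∀ Y → Tight Y → 3 ≤ ∣ ∁ Y ∣ → X ⊆ Y → Y ⊆ X) where

          X≥4 : 4 ≤ ∣ X ∣
          X≥4 = subst (_≤ ∣ X ∣) (K-size k₀) (countB-mono {P = K₀} K₀⊆X)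

          one-common : ∀ {S u} → Tight S → 3 ≤ ∣ ∁ S ∣ → InK4 u → u ∉ S → ∀ {i j} → i ∈ S → i ∈ K u → j ∈ S → j ∈ K u → i ≡ j
          one-common {u = u} tS large k u∉S i∈S i∈K j∈S j∈K =
            ∣∣≡1⇒≡ (Crossing.one (crossing tS large k i∈K i∈S λ s → ∈-∉ (s (K-centre u)) u∉S)) (∩-∈ i∈S i∈K) (∩-∈ j∈S j∈K)

          -- A K₄ around `c` has at least two vertices in `X ∪ K u`, but at most one in `X` and at
          -- most one in `K u`. These two vertices would be joined by an edge across.
          no-third-K4 : ∀ {u c} → InK4 u → e (X ∖ K u) (K u ∖ X) ≡ 0 → ∣ ∁ (X ∪ K u) ∣ ≡ 2 → c ∈ ∁ (X ∪ K u) → ¬ InK4 c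
          no-third-K4 {u} {c} k none two c∈ l =
            let (a , b , a∈ , b∈ , a≢b) = find₂ ((X ∪ K u) ∩ K c) (two-in two l)
            in refute (proj₁ (∈-∩ a∈)) (proj₂ (∈-∩ a∈)) (proj₁ (∈-∩ b∈)) (proj₂ (∈-∩ b∈)) a≢b
            where
            c∉X : c ∉ X
            c∉X = ¬∈⇒∉ λ p → ∈-∉ (∪-∈ˡ p) (∈-∁ c∈)
            c∉K : c ∉ K u
            c∉K = ¬∈⇒∉ λ p → ∈-∉ (∪-∈ʳ p) (∈-∁ c∈)
            K-large : 3 ≤ ∣ ∁ (K u) ∣
            K-large = linear 5 (λ k d x y m → (k ⊕ d ≈ m ∷ k ≈ con 4 ∷ x ⊕ y ≈ m ∷ con 4 ≼ x ∷ con 3 ≼ y ∷ []) ⊢ con 3 ≼ d)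
              (∣ K u ∣ ∷ ∣ ∁ (K u) ∣ ∷ ∣ X ∣ ∷ ∣ ∁ X ∣ ∷ n ∷ []) (∣∁∣ (K u)) (K-size k) (∣∁∣ X) X≥4 ∁≥3
            split-edge : ∀ {a b} → a ∈ X → b ∈ K u → a ∈ K c → b ∈ K c → a ≢ b → ⊥
            split-edge {a} {b} a∈X b∈K a∈ b∈ a≢b with a ∈? K u | b ∈? X
            ... | inj₁ a∈K | _        = a≢b (one-common (K-tight k) K-large l c∉K a∈K a∈ b∈K b∈)
            ... | inj₂ _   | inj₁ b∈X = a≢b (one-common tX ∁≥3 l c∉X a∈X a∈ b∈X b∈)
            ... | inj₂ a∉K | inj₂ b∉X = e≡0⇒¬~ none (∖-∈ a∈X a∉K) (∖-∈ b∈K b∉X) (K-clique l a∈ b∈ a≢b)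
            refute : ∀ {a b} → a ∈ X ∪ K u → a ∈ K c → b ∈ X ∪ K u → b ∈ K c → a ≢ b → ⊥
            refute a∈Y a∈ b∈Y b∈ a≢b with ∈-∪ a∈Y | ∈-∪ b∈Y
            ... | inj₁ p | inj₁ q = a≢b (one-common tX ∁≥3 l c∉X p a∈ q b∈)
            ... | inj₂ p | inj₂ q = a≢b (one-common (K-tight k) K-large l c∉K p a∈ q b∈)
            ... | inj₁ p | inj₂ q = split-edge p q a∈ b∈ a≢b
            ... | inj₂ p | inj₁ q = split-edge q p b∈ a∈ (a≢b ∘ sym)

          covering-K4⇒H2 : ∀ {u} → InK4 u → Crossing X u → ∣ X ∣ ≤ 4 → (∀ {w} → w ∈ X ∪ K u) →
                           e (X ∖ K u) (K u ∖ X) ≡ 1 → G ≅ H2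
          covering-K4⇒H2 {u} k cr small all one = two-K4≅H2 k₀ k
            (case ∈-∪ all of λ { (inj₁ p) → ∪-∈ˡ (X⊆K₀ p) ; (inj₂ p) → ∪-∈ʳ p })
            (trans (≤-antisym (countB-mono {P = K₀ ∩ K u} λ h → let (p , q) = ∈-∩ h in ∩-∈ (K₀⊆X p) q)
              (countB-mono {P = X ∩ K u} λ h → let (p , q) = ∈-∩ h in ∩-∈ (X⊆K₀ p) q)) (Crossing.one cr))
            (trans (≤-antisym (e-mono (subtractˡ K₀⊆X) (subtractʳ X⊆K₀)) (e-mono (subtractˡ X⊆K₀) (subtractʳ K₀⊆X))) one)
            where
            X⊆K₀ : X ⊆ K₀
            X⊆K₀ = ⊆∧≥⇒⊇ K₀⊆X (subst (∣ X ∣ ≤_) (sym (K-size k₀)) small)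
            subtractˡ : ∀ {S T} → S ⊆ T → S ∖ K u ⊆ T ∖ K u
            subtractˡ s h = let (p , q) = ∈-∖ h in ∖-∈ (s p) q
            subtractʳ : ∀ {S T} → T ⊆ S → K u ∖ S ⊆ K u ∖ T
            subtractʳ s h = let (p , q) = ∈-∖ h in ∖-∈ p (¬∈⇒∉ λ r → ∈-∉ (s r) q)

          -- A covering union is excluded: it gives a separation if `X` has five vertices and `H2`
          -- if `X` is a K₄. Otherwise the union is tight, and the number of vertices it misses
          -- decides: one gives a separation, two are nodes in no K₄, and three or more contradict
          -- maximality.
          crossed : ∀ {u} → InK4 u → Crossing X u → ¬ K u ⊆ X → TwoAdmissible
          crossed {u} k cr ¬s with Crossing.cases cr
          ... | inj₁ (all , one) = ⊥-elim (case 5 ≤? ∣ X ∣ of λ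
                  { (yes X≥5) → covering⇒⊥ tX k cr X≥5 all one
                  ; (no small) → ¬H2 (covering-K4⇒H2 k cr (≤-pred (≰⇒> small)) all one) })
          ... | inj₂ (t , none) with ∣ ∁ (X ∪ K u) ∣ in eq
          ...   | 0 = ⊥-elim (∈-∉ (∁-∈ (proj₂ (tight-proper t))) (∣∣≡0⇒∉ eq))
          ...   | 1 = ⊥-elim (almost-covering⇒⊥ tX k cr X≥4 eq none)
          ...   | 2 = last-two t eq (no-third-K4 k none eq)
          ...   | suc (suc (suc _)) = ⊥-elim (¬s λ p →
                    maximal (X ∪ K u) t (subst (3 ≤_) (sym eq) (s≤s (s≤s (s≤s z≤n)))) ∪-∈ˡ (∪-∈ʳ p))

          result : TwoAdmissible
          result = case Fin.any? (λ u → InK4? u ×-dec (Fin.any? (λ i → ∈-dec i (K u) ×-dec ∈-dec i X) ×-dec ¬? (K u ⊆? X))) of λ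
            { (yes (u , k , (i , i∈K , i∈X) , ¬s)) → crossed k (crossing tX ∁≥3 k i∈K i∈X ¬s) ¬s
            ; (no none) → two-from (good ∖ X)
                (two-good-outside tX (≤-trans (s≤s (s≤s z≤n)) X≥4) (≤-trans (s≤s (s≤s z≤n)) ∁≥3)
                  λ {u} {i} k i∈K i∈X → case K u ⊆? X of λ
                    { (yes s) → s ; (no ¬s) → ⊥-elim (none (u , k , (i , i∈K , i∈X) , ¬s)) })
                λ h → good⇒adm (∈-⟪⟫ (proj₁ (∈-∖ h))) }

        some-K4 : TwoAdmissible
        some-K4 with ∣ ∁ K₀ ∣ in eq
        ... | 0 = ⊥-elim (∈-∉ (∁-∈ (proj₂ (tight-proper (K-tight k₀)))) (∣∣≡0⇒∉ eq))
        ... | 1 = ⊥-elim (one-left eq)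
        ... | 2 = last-two (K-tight k₀) eq (two-left eq)
        ... | suc (suc (suc _)) =
          let (X , K₀⊆X , (tX , large) , maximal) = extendToMaximal {P = Spacious}
                (λ {Y} h (t , l) → Tight-ext h t , ≤-trans l (countB-mono {P = ∁ Y} λ {i} p →
                  ∁-∈ (∉⁺ (trans (sym (h i)) (∉⁻ (∈-∁ p))))))
                (λ Y → Tight? Y ×-dec (3 ≤? ∣ ∁ Y ∣))
                K₀ (K-tight k₀ , subst (3 ≤_) (sym eq) (s≤s (s≤s (s≤s z≤n))))
          in Large.result K₀⊆X tX large λ Y t l → maximal Y (t , l)
          where
          Spacious : VSet n → Set
          Spacious Y = Tight Y × 3 ≤ ∣ ∁ Y ∣

    two-admissible : TwoAdmissible
    two-admissible = case Fin.any? (λ v → Fin.any? (λ a → Branching? v ×-dec (~-dec v a ×-dec ¬? (IsNode? a)))) of λ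
      { (yes (v , a , b , v~a , a-big)) → branch b v~a a-big (proj₂ (proj₂ b v~a)) (<-wellFounded _)
      ; (no nbr) → case Fin.any? Branching? of λ
          { (yes (v , b)) → all-neighbours-nodes b λ {u} {a} b′ u~a → case IsNode? a of λ
              { (yes h) → h ; (no h) → ⊥-elim (nbr (u , a , b′ , u~a , h)) }
          ; (no none) → let open NoBranching (λ {v} b → none (v , b)) in case Fin.any? InK4? of λ
              { (yes (u , k)) → some-K4 k ; (no ¬k) → no-K4 (λ {u} k → ¬k (u , k)) } } }

-- 1-reductions that produce circuits.

module Reduction {m : ℕ} (G : Graph (suc m)) (circuit : IsCircuit G) (v : Fin (suc m)) where

  open Circuit G circuit

  private
    lift : VSet m → VSet (suc m)
    lift X j with v ≟ᶠ j
    ... | yes _ = false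
    ... | no  h = X (punchOut h)

    lift-v : ∀ X → lift X v ≡ false
    lift-v X with v ≟ᶠ v
    ... | yes _ = refl
    ... | no  h = ⊥-elim (h refl)

    lift-punchIn : ∀ X i → lift X (punchIn v i) ≡ X i
    lift-punchIn X i with v ≟ᶠ punchIn v i
    ... | yes h = ⊥-elim (Fin.punchInᵢ≢i v i (sym h))
    ... | no  h = cong X (trans (Fin.punchOut-cong v refl) (Fin.punchOut-punchIn v))

    ∣lift∣ : ∀ X → ∣ lift X ∣ ≡ ∣ X ∣
    ∣lift∣ X = begin
      ∣ lift X ∣
        ≡⟨ countB≡sumF (lift X) ⟩
      sumF (𝟙 ∘ lift X)
        ≡⟨ sumF-punchIn v (𝟙 ∘ lift X) ⟩
      𝟙 (lift X v) + sumF (λ i → 𝟙 (lift X (punchIn v i)))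
        ≡⟨ cong₂ _+_ (cong 𝟙 (lift-v X)) (sumF-cong λ i → cong 𝟙 (lift-punchIn X i)) ⟩
      sumF (𝟙 ∘ X)
        ≡⟨ sym (countB≡sumF X) ⟩
      ∣ X ∣ ∎
      where open ≡-Reasoning

    count-punchIn : ∀ (P : VSet (suc m)) → ∣ P ∣ ≡ 𝟙 (P v) + countB (P ∘ punchIn v)
    count-punchIn P = trans (countB≡sumF P) (trans (sumF-punchIn v (𝟙 ∘ P))
      (cong (𝟙 (P v) +_) (sym (countB≡sumF (P ∘ punchIn v)))))

    adj⁻ : EdgeSet m
    adj⁻ i j = adj G (punchIn v i) (punchIn v j)

    count₂-adj⁻ : count₂ (adj G) ≡ count₂ adj⁻ + 2 * degree G v
    count₂-adj⁻ = linear 5 (λ a d r c b → (a ≈ d ⊕ r ∷ r ≈ b ⊕ c ∷ d ≈ b ∷ []) ⊢ a ≈ c ⊕ 2 ⊛ d)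
      (count₂ (adj G) ∷ degree G v ∷ sumF (λ i → countB (adj G (punchIn v i))) ∷ count₂ adj⁻ ∷
        sumF (λ i → 𝟙 (adj G (punchIn v i) v)) ∷ [])
      (sumF-punchIn v (λ i → countB (adj G i)))
      (trans (sumF-cong λ i → count-punchIn (adj G (punchIn v i))) (sumF-+ (λ i → 𝟙 (adj G (punchIn v i) v)) _))
      (trans (count-punchIn (adj G v)) (trans (cong (λ b → 𝟙 b + countB (adj G v ∘ punchIn v)) (proj₂ simple v))
        (trans (countB≡sumF (adj G v ∘ punchIn v)) (sumF-cong λ i → cong 𝟙 (proj₁ simple v (punchIn v i))))))

    opaque
      unfolding e

      e-lift : ∀ X → e (lift X) (lift X) ≡ count₂ (λ i j → X i ∧ (X j ∧ adj⁻ i j))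
      e-lift X = begin
        e (lift X) (lift X)
          ≡⟨ sumF-punchIn v (λ i → countB (between (lift X) (lift X) i)) ⟩
        countB (between (lift X) (lift X) v) + sumF (λ i → countB (between (lift X) (lift X) (punchIn v i)))
          ≡⟨ cong₂ _+_ (trans (countB-cong λ j → cong (_∧ (lift X j ∧ adj G v j)) (lift-v X)) (∣∅∣ (suc m))) (sumF-cong row-i) ⟩
        count₂ (λ i j → X i ∧ (X j ∧ adj⁻ i j)) ∎
        where
        open ≡-Reasoning
        row-i : ∀ i → countB (between (lift X) (lift X) (punchIn v i)) ≡ countB (λ j → X i ∧ (X j ∧ adj⁻ i j))
        row-i i = trans (count-punchIn (between (lift X) (lift X) (punchIn v i)))
          (cong₂ _+_ (cong 𝟙 corner) (countB-cong λ j →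
            cong₂ (λ a b → a ∧ (b ∧ adj⁻ i j)) (lift-punchIn X i) (lift-punchIn X j)))
          where
          corner : between (lift X) (lift X) (punchIn v i) v ≡ false
          corner rewrite lift-v X with lift X (punchIn v i)
          ... | true  = refl
          ... | false = refl

  anyB-∃ : ∀ {k} (P : Fin k → Bool) {i} → P i ≡ true → anyB P ≡ true
  anyB-∃ P {zero}  h rewrite h = refl
  anyB-∃ P {suc i} h = trans (cong (P zero ∨_) (anyB-∃ (P ∘ suc) h)) (∨-zeroʳ (P zero))

  module _ (x y : Fin m) (node : IsNode G v) (x≢y : x ≢ y)
    (free : ∀ {S u} → Tight S → v ∉ S → punchIn v x ∈ S → punchIn v y ∈ S → u ∉ S → v ≢ u → ⊥)
    (x≁y : ¬ punchIn v x ~ punchIn v y) where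

    private
      G⁻ : Graph m
      G⁻ = oneReduction G v x y

      adj⁻⇒≢xy : ∀ i j → pair x y i j ≡ true → adj⁻ i j ≡ false
      adj⁻⇒≢xy i j h with i ≟ᶠ x | j ≟ᶠ y | i ≟ᶠ y | j ≟ᶠ x
      ... | yes refl | yes refl | _        | _        = ¬~⇒false x≁y
      ... | yes _    | no _     | yes refl | yes refl = ¬~⇒false (x≁y ∘ ~-sym)
      ... | no _     | _        | yes refl | yes refl = ¬~⇒false (x≁y ∘ ~-sym)

      G⁻-symmetric : IsSymmetric (adj G⁻)
      G⁻-symmetric i j = cong₂ _∨_ (proj₁ simple (punchIn v i) (punchIn v j)) (pair-sym x y i j)

      G⁻-simple : IsSimple G⁻
      G⁻-simple = G⁻-symmetric , irreflexive
        where
        irreflexive : ∀ i → adj G⁻ i i ≡ false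
        irreflexive i rewrite proj₂ simple (punchIn v i) with i ≟ᶠ x | i ≟ᶠ y
        ... | yes refl | yes p = ⊥-elim (x≢y p)
        ... | yes _    | no _  = refl
        ... | no _     | yes _ = refl
        ... | no _     | no _  = refl

      G⁻-edges : edgeCount (adj G⁻) + 1 ≡ 2 * m
      G⁻-edges = linear 8 (λ k⁻ c⁻ c p a k d m → (c⁻ ≈ 2 ⊛ k⁻ ∷ c⁻ ⊕ con 0 ≈ c ⊕ (p ⊕ con 0) ∷ p ≈ con 2 ∷ a ≈ c ⊕ 2 ⊛ d ∷
          d ≈ con 3 ∷ a ≈ 2 ⊛ k ∷ k ⊕ con 1 ≈ 2 ⊛ (con 1 ⊕ m) ∷ []) ⊢ k⁻ ⊕ con 1 ≈ 2 ⊛ m)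
        (edgeCount (adj G⁻) ∷ count₂ (adj G⁻) ∷ count₂ adj⁻ ∷ count₂ (pair x y) ∷ count₂ (adj G) ∷
          edgeCount (adj G) ∷ degree G v ∷ m ∷ [])
        (count₂≡2*edgeCount (adj G⁻) G⁻-symmetric (proj₂ G⁻-simple))
        (counts₂-≡ (adj G⁻ ∷ []) (adj⁻ ∷ pair x y ∷ []) λ i j → pointwise (adj⁻ i j) (pair x y i j) (adj⁻⇒≢xy i j))
        (count₂-pair x≢y) count₂-adj⁻ node
        (count₂≡2*edgeCount (adj G) (proj₁ simple) (proj₂ simple)) (proj₁ (proj₂ circuit))
        where
        pointwise : ∀ a b → (b ≡ true → a ≡ false) → total ((a ∨ b) ∷ []) ≡ total (a ∷ b ∷ [])
        pointwise true  true  h = case h refl of λ ()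
        pointwise true  false _ = refl
        pointwise false b     _ = refl

      pairWithin : VSet m → EdgeSet m
      pairWithin X i j = X i ∧ (X j ∧ pair x y i j)

      inside : VSet m → EdgeSet m
      inside X i j = X i ∧ (X j ∧ adj⁻ i j)

      -- Without both ends of the new edge, `X` inherits sparsity from its `lift`. With both ends,
      -- `free` says that the lift is not tight; its doubled edge count is even, so the slack is at
      -- least 2, enough for both directions of the new edge.
      bound : ∀ X {w u} → w ∈ X → u ∉ X → count₂ (inside X) + count₂ (pairWithin X) + 4 ≤ 4 * ∣ X ∣
      bound X {w} {u} w∈X u∉X = cases (x ∈? X) (y ∈? X)
        where
        lifted∈ : ∀ {i} → i ∈ X → punchIn v i ∈ lift X
        lifted∈ {i} (∈⁺ h) = ∈⁺ (trans (lift-punchIn X i) h)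
        lifted∉ : ∀ {i} → i ∉ X → punchIn v i ∉ lift X
        lifted∉ {i} (∉⁺ h) = ∉⁺ (trans (lift-punchIn X i) h)
        L = lift X
        sparseL : e L L + 4 ≤ 4 * ∣ L ∣
        sparseL = sparse (lifted∈ w∈X) (lifted∉ u∉X)
        separated : (∀ i j → pairWithin X i j ≡ true → ⊥) → count₂ (inside X) + count₂ (pairWithin X) + 4 ≤ 4 * ∣ X ∣
        separated none = linear 5 (λ a p s t l → (p ≼ con 0 ∷ l ⊕ con 4 ≼ 4 ⊛ t ∷ l ≈ a ∷ t ≈ s ∷ []) ⊢ a ⊕ p ⊕ con 4 ≼ 4 ⊛ s)
          (count₂ (inside X) ∷ count₂ (pairWithin X) ∷ ∣ X ∣ ∷ ∣ L ∣ ∷ e L L ∷ [])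
          (≤-pred (≰⇒> λ h → let (i , j , q) = count₂-find (pairWithin X) h in none i j q))
          sparseL (e-lift X) (∣lift∣ X)
        ends : ∀ i j → pairWithin X i j ≡ true → x ∈ X × y ∈ X
        ends i j h with X i in a | X j in b | i ≟ᶠ x | j ≟ᶠ y | i ≟ᶠ y | j ≟ᶠ x
        ... | true | true | yes refl | yes refl | _        | _        = ∈⁺ a , ∈⁺ b
        ... | true | true | yes _    | no _     | yes refl | yes refl = ∈⁺ b , ∈⁺ a
        ... | true | true | no _     | _        | yes refl | yes refl = ∈⁺ b , ∈⁺ a
        cases : x ∈ X ⊎ x ∉ X → y ∈ X ⊎ y ∉ X → count₂ (inside X) + count₂ (pairWithin X) + 4 ≤ 4 * ∣ X ∣
        cases (inj₂ x∉) _ = separated λ i j h → ∈-∉ (proj₁ (ends i j h)) x∉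
        cases _ (inj₂ y∉) = separated λ i j h → ∈-∉ (proj₂ (ends i j h)) y∉
        cases (inj₁ x∈) (inj₁ y∈) with e-even L
        ... | k , even = linear 6 (λ a p s t l k → (p ≼ con 2 ∷ l ≈ 2 ⊛ k ∷ con 1 ⊕ (k ⊕ con 2) ≼ 2 ⊛ t ∷ l ≈ a ∷ t ≈ s ∷ [])
              ⊢ a ⊕ p ⊕ con 4 ≼ 4 ⊛ s)
            (count₂ (inside X) ∷ count₂ (pairWithin X) ∷ ∣ X ∣ ∷ ∣ L ∣ ∷ e L L ∷ k ∷ [])
            (subst (count₂ (pairWithin X) ≤_) (count₂-pair x≢y) (count₂-mono {R = pairWithin X} {S = pair x y} subset))
            even strict (e-lift X) (∣lift∣ X)
          where
          subset : ∀ i j → pairWithin X i j ≡ true → pair x y i j ≡ true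
          subset i j h with X i | X j
          ... | true | true = h
          strict : suc (k + 2) ≤ 2 * ∣ L ∣
          strict = ≤∧≢⇒< (linear 3 (λ l k t → (l ≈ 2 ⊛ k ∷ l ⊕ con 4 ≼ 4 ⊛ t ∷ []) ⊢ k ⊕ con 2 ≼ 2 ⊛ t)
              (e L L ∷ k ∷ ∣ L ∣ ∷ []) even sparseL)
            λ eq → free {L} (linear 3 (λ l k t → (l ≈ 2 ⊛ k ∷ k ⊕ con 2 ≈ 2 ⊛ t ∷ []) ⊢ l ⊕ con 4 ≈ 4 ⊛ t)
                (e L L ∷ k ∷ ∣ L ∣ ∷ []) even eq)
              (∉⁺ (lift-v X)) (lifted∈ x∈) (lifted∈ y∈) (lifted∉ u∉X) (Fin.punchInᵢ≢i v u ∘ sym)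

    -- An edge set that reaches every vertex obeys the bound because it omits at least one of the 2m
    -- - 1 edges. Any other one lies inside the proper vertex set to which `bound` applies.
    reduction-circuit : IsCircuit G⁻
    reduction-circuit = G⁻-simple , G⁻-edges , λ F F-sub pos fewer → cases F F-sub pos fewer (full-or-missing (incident F))
      where
      cases : ∀ F → IsEdgeSubset G⁻ F → 1 ≤ edgeCount F → edgeCount F < edgeCount (adj G⁻) →
              (∀ {i} → i ∈ incident F) ⊎ ∃ (_∉ incident F) → edgeCount F + 2 ≤ 2 * ∣ incident F ∣
      cases F F-sub pos fewer (inj₁ all) =
        linear 4 (λ f k i m → (con 1 ⊕ f ≼ k ∷ k ⊕ con 1 ≈ 2 ⊛ m ∷ i ≈ m ∷ []) ⊢ f ⊕ con 2 ≼ 2 ⊛ i)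
          (edgeCount F ∷ edgeCount (adj G⁻) ∷ ∣ incident F ∣ ∷ m ∷ []) fewer G⁻-edges (all⇒∣∣≡n all)
      cases F F-sub pos fewer (inj₂ (u , u∉)) =
        linear 5 (λ f c a p s → (c ≈ 2 ⊛ f ∷ c ⊕ con 0 ≼ a ⊕ (p ⊕ con 0) ∷ a ⊕ p ⊕ con 4 ≼ 4 ⊛ s ∷ []) ⊢ f ⊕ con 2 ≼ 2 ⊛ s)
          (edgeCount F ∷ count₂ F ∷ count₂ (inside X) ∷ count₂ (pairWithin X) ∷ ∣ X ∣ ∷ [])
          doubled
          (counts₂-≤ (F ∷ []) (inside X ∷ pairWithin X ∷ []) λ i j →
            pointwise (F i j) (X i) (X j) (adj⁻ i j) (pair x y i j) (support i j) (proj₂ F-sub i j))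
          (let (i , j , h) = count₂-find F (subst (1 ≤_) (sym doubled) (≤-trans pos (m≤m+n _ _)))
           in bound X {i} (∈⁺ (proj₁ (support i j h))) u∉)
        where
        X = incident F
        support : ∀ i j → F i j ≡ true → X i ≡ true × X j ≡ true
        support i j h = anyB-∃ (F i) h , anyB-∃ (F j) (trans (proj₁ F-sub j i) h)
        doubled : count₂ F ≡ 2 * edgeCount F
        doubled = count₂≡2*edgeCount F (proj₁ F-sub) irreflexive
          where
          irreflexive : ∀ i → F i i ≡ false
          irreflexive i with F i i in p
          ... | true  = case trans (sym (proj₂ F-sub i i p)) (proj₂ G⁻-simple i) of λ ()
          ... | false = refl
        pointwise : ∀ f a b c p → (f ≡ true → a ≡ true × b ≡ true) → (f ≡ true → c ∨ p ≡ true) →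
                    total (f ∷ []) ≤ total ((a ∧ (b ∧ c)) ∷ (a ∧ (b ∧ p)) ∷ [])
        pointwise false _ _ _ _ _ _ = z≤n
        pointwise true a b c p h k with h refl | k refl
        ... | refl , refl | q with c
        ...   | true  = s≤s z≤n
        ...   | false rewrite q = ≤-refl

module _ {m : ℕ} (G : Graph (suc m)) (circuit : IsCircuit G)
  (no2 : ¬ HasNontrivial2VertexSep G) (no3 : ¬ HasNontrivial3EdgeSep G) where

  open Separated G circuit no2 no3

  private
    -- Supplies the hypothesis `free` of the reduction: a tight set with `p` and `q` but not `v`
    -- either contains `r`, and is then all of `V − v`, or is critical for `r`.
    unblocked : ∀ {v p q r} → IsNode G v → v ~ p → v ~ q → v ~ r → p ≢ q → p ≢ r → q ≢ r → ¬ Blocked v r →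
                ∀ {S u} → Tight S → v ∉ S → p ∈ S → q ∈ S → u ∉ S → v ≢ u → ⊥
    unblocked {v} {p} {q} {r} node v~p v~q v~r p≢q p≢r q≢r ¬blocked {S} {u} tS v∉S p∈S q∈S u∉S v≢u with r ∈? S
    ... | inj₁ r∈S = case ∈-∪ (insert-full tS v∉S
                       (count≥3 (∩-∈ p∈S (∈⁺ v~p)) (∩-∈ q∈S (∈⁺ v~q)) (∩-∈ r∈S (∈⁺ v~r)) p≢q p≢r q≢r) {u}) of λ
                       { (inj₁ h) → ∈-∉ h u∉S ; (inj₂ h) → v≢u (∈-⁅⁆ h) }
    ... | inj₂ r∉S = ¬blocked (S , record { tight = tS ; v∉ = v∉S ; r∉ = r∉S ; rest = λ h r≢w →
                       case neighbours-complete node v~p v~q v~r p≢q p≢r q≢r h of λ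
                         { (inj₁ refl) → p∈S ; (inj₂ (inj₁ refl)) → q∈S ; (inj₂ (inj₂ eq)) → ⊥-elim (r≢w eq) } })

    preimage : ∀ {v w} → v ~ w → ∃ λ w′ → punchIn v w′ ≡ w
    preimage v~w = punchOut (~⇒≢ v~w) , Fin.punchIn-punchOut (~⇒≢ v~w)

  unblocked⇒admissible : ∀ {v p q r} → IsNode G v → v ~ p → v ~ q → v ~ r → p ≢ q → p ≢ r → q ≢ r →
                         ¬ p ~ q → ¬ Blocked v r → IsAdmissible G v
  unblocked⇒admissible {v} {p} {q} node v~p v~q v~r p≢q p≢r q≢r p≁q ¬blocked with preimage v~p | preimage v~q
  ... | x , refl | y , refl = node , x , y , p≢q ∘ cong (punchIn v) , v~p , v~q , ¬~⇒false p≁q ,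
    Reduction.reduction-circuit G circuit v x y node (p≢q ∘ cong (punchIn v))
      (unblocked node v~p v~q v~r p≢q p≢r q≢r ¬blocked) p≁q

theorem2p2 : (m : ℕ) (G : Graph (suc m)) →
    IsCircuit G → ¬ (G ≅ K5-e) → ¬ (G ≅ H1) → ¬ (G ≅ H2) →
    ¬ HasNontrivial2VertexSep G → ¬ HasNontrivial3EdgeSep G →
    Σ (Fin (suc m)) λ v → Σ (Fin (suc m)) λ w →
    (v ≢ w) × IsAdmissible G v × IsAdmissible G w
theorem2p2 m G circuit ¬K5-e ¬H1 ¬H2 no2 no3 =
  Conclusion.two-admissible G circuit no2 no3 ¬K5-e ¬H1 ¬H2 (IsAdmissible G) (unblocked⇒admissible G circuit no2 no3)
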